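{- Let $m\ge1$, $n\ge2$, and let $B^{c,Int}=[(b_{i,j},r_{i,j})]_{m\times n}$ be the matrix associated (as in the context) with a contractible Hamiltonian cycle on $P_{m+1}\times C_n$ whose split tree has $w_{1,1}$ as up root; let $a_{i,j}\in\{0,1\}$ be $1$ iff $b_{i,j}\ne0$, with conventions $(b_{i,n+1},r_{i,n+1})=(b_{i,1},r_{i,1})$, $(b_{i,0},r_{i,0})=(b_{i,n},r_{i,n})$ (similarly for $a$). Then: 1. (a) $[a_{i,j}]$ satisfies FL$^{c,Int}$ and AC$^{c,Int}$. (b) For $2\le i\le m$, $1\le k\le n$: $a_{i-1,k}=a_{i,k}$ implies $(b_{i-1,k},r_{i-1,k})=(b_{i,k},r_{i,k})$. (c) $a_{i,j}=0$ implies $r_{i,j}=0$. 2. For $1\le k\le n$: (a) if $(s,r)$ with $s\ge3$ occurs in column $k$, then for each $\ell\in\{2,\dots,s-1\}$ some $(\ell,r)$ occurs in column $k$ before (above) the first occurrence of $(s,r)$. (b) The truncated roll word of column $1$, if nonempty, begins with $0$ or $1$; for $k\ne1$ the truncated roll word of column $k$ is nonempty and begins with $0$. 3. For $1\le k\le n$: (a) for $2\le k\le n$, $a_{i,k-1}=a_{i,k}=1$ implies $r_{i,k-1}=r_{i,k}$. (b) For each pair $(b,r)$ with $b\ne0$ occurring in column $k$, except in the two cases (i) $b=2$, $r>0$ is the maximal roll number in column $k$ and $(3,r)$ does not occur in column $k$; (ii) $k=n$, $b=2$, $r=0$ is the maximal roll number in column $k$ and $(3,0)$ does not occur in column $k$,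 there is an index $i$ with $(b_{i,k},r_{i,k})=(b,r)$ and $b_{i,k+1}\ne0$. (c) For $i\ne j$: $(b_{i,k-1},r_{i,k-1})=(b_{j,k-1},r_{j,k-1})$ and $a_{i,k}=a_{j,k}=a_{i,k-1}=a_{j,k-1}=1$ imply $b_{i,k}=b_{j,k}$. (d) For $i\ne j$: if $(b_{i,k-1},r_{i,k-1})=(b_{j,k-1},r_{j,k-1})$, $a_{i,k}=a_{j,k}=a_{i,k-1}=a_{j,k-1}=1$ and $b_{i,k}=b_{j,k}=b$, then no $b$-factor of column $k$ contains both positions $i$ and $j$. (e) For $b\ne0$, if $v\ne u$ are maximal $b$-factors of column $k$ with the same roll number, there is a unique sequence $v=v_1,\dots,v_p=u$, $p>1$, of distinct maximal $b$-factors such that for every $1\le i\le p-1$ there is exactly one $j_i$ with $a_{j_i,k-1}=a_{j_i,k}=1$ and position $j_i$ in $v_i$, and a unique $s_{i+1}$ with $a_{s_{i+1},k-1}=a_{s_{i+1},k}=1$ and position $s_{i+1}$ in $v_{i+1}$, with $(b_{j_i,k-1},r_{j_i,k-1})=(b_{s_{i+1},k-1},r_{s_{i+1},k-1})$ and $j_i\ne s_i$. (f) For $r>0$, if $(2,r)$ occurs in column $k$, there is an index $i$ such that: if $k=1$, then $r_{i,n}=r-1$ and $a_{i,1}=a_{i,n}=1$; if $k>1$, then $r_{i,k-1}=r$ and $a_{i,k-1}=a_{i,k}=1$. 4. (a) $(b_{1,1},r_{1,1})=(b_{2,1},r_{2,1})=(0,0)$ and $(b_{1,n},r_{1,n})=(2,0)$.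 (b) For $2<i\le m$, $a_{i,n}=a_{i,1}=1$ implies $r_{i,1}=r_{i,n}+1$. 5. For $1\le k\le n$: (a) for $1<i_1<j_1<i_2<j_2\le m$, if $b_{i_1,k}=b_{i_2,k}>1$, $b_{j_1,k}=b_{j_2,k}>1$ and $r_{i_1,k}=r_{i_2,k}=r_{j_1,k}=r_{j_2,k}$, then $b_{i_1,k}=b_{j_1,k}$. (b) Any two adjacent letters of the nonempty truncated roll word of column $k$ differ in absolute value by at most 1.
   Context: Graph and windows: $P_{m+1}\times C_n$ has vertices $(i,j)$, $0\le i\le m$, $j\in\mathbb{Z}_n$, embedded on an infinite cylinder; for $1\le i\le m$, $1\le j\le n$, $w_{i,j}$ is the square face with corners $(i-1,j-1),(i-1,j),(i,j),(i,j-1)$ (columns mod $n$), row 1 adjacent to the boundary cycle $\{(0,j)\}$, row $m$ to $\{(m,j)\}$; $W_{m,n}\cong P_m\times C_n$ is the window graph (adjacent when sharing an edge). A contractible Hamiltonian cycle (contractible as a closed curve on the cylinder) bounds a disc whose windows induce the interior tree IT; the other windows induce exterior trees (ETs); exactly one ET, the split tree ST, contains exactly one row-1 window (up root) and one row-$m$ window (down root); every other ET contains exactly one row-1 window or exactly one row-$m$ window (its root), not both. $A^{c,Int}=[a_{i,j}]$ has $a_{i,j}=1$ iff $w_{i,j}$ is in the IT. FL$^{c,Int}$: $a_{1,1}=0$; for $1\le j\le n$, $(a_{1,j},a_{1,j+1})\ne(0,0)$ and $(a_{m,j},a_{m,j+1})\ne(0,0)$ (columns mod $n$). AC$^{c,Int}$: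 for $1\le i\le m-1$, $1\le j\le n$, $(a_{i,j},a_{i+1,j},a_{i,j+1},a_{i+1,j+1})\notin\{(1,1,1,1),(0,0,0,0),(0,1,1,0),(1,0,0,1)\}$. Rolling imprint: $\mathcal{W}_m$ is the infinite grid of cells $w^k_{i,j}$ ($1\le i\le m$, $1\le j\le n$, $k\in\mathbb{Z}$), $w^k_{i,j}$ being the unit square in row $i$ and column $j+nk$ of the strip $\mathbb{Z}\times[0,m]$, cells adjacent when sharing an edge; $\mathcal{R}_k$ is the set of cells with superscript $k$. The strip covers the cylinder by reducing columns mod $n$, $w^k_{i,j}\mapsto w_{i,j}$; each tree of the cycle (IT, ST, other ETs) lifts to infinitely many disjoint copies in $\mathcal{W}_m$, each mapped isomorphically onto it, consecutive copies being translates by $n$ columns. The basis of the rolling imprint (BRI) is the union of the copy of the ST whose down root lies in $\mathcal{R}_0$, the copy of each other ET whose root lies in $\mathcal{R}_0$, and the copy of the IT whose leftmost row-1 window lies in $\mathcal{R}_0$; each window $w_{i,j}$ has exactly one copy in the BRI. In this coding the non-zero windows are the IT windows. The roll number $r(w_{i,j})$ of a non-zero window is the $k$ with $w^k_{i,j}$ in the BRI, and $r(w_{i,j})=0$ for other windows. For $1\le k\le n$ and integer $r$, two non-zero windows are $k^r$-joined if their BRI copies lie in one component of the subgraph of $\mathcal{W}_m$ induced by the BRI copies $w^z_{x,y}$ of non-zero windows $w_{x,y}$ with either $z=r(w_{x,y})<r$, or $z=r(w_{x,y})=r$ and $y\le k$. The matrix $B^{c,Int}=[(b_{i,j},r_{i,j})]$: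 $r_{i,j}=r(w_{i,j})$; $b_{i,j}=0$ if $w_{i,j}$ belongs to an ET; for each column $j$ and each roll value $r$, the IT windows of column $j$ with roll $r$ are partitioned into $j^r$-joined classes, which are labelled $2,3,\dots$ in the order in which the classes first appear in column $j$ from top to bottom, and $b_{i,j}$ is the label of the class of $w_{i,j}$. Factors: in column $k$, a $b$-factor is a block of consecutive positions with the same value $b$ of $b_{\cdot,k}$; maximal if not contained in a longer one; its roll number is the common value of $r_{\cdot,k}$ on it. The truncated roll word of column $k$ is the sequence of roll numbers of its maximal $b$-factors with $b>0$, listed from top to bottom. -}

module Defs where

open import Data.Nat using (ℕ; zero; suc; _+_; _*_; _∸_; _≤_; _<_; _≡ᵇ_; _<ᵇ_)
open import Data.Bool using (Bool; true; false; if_then_else_; _∧_; _∨_; not)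
import Data.Integer as ℤ
open ℤ using (ℤ; +_; 0ℤ; 1ℤ; ∣_∣)
open import Data.Product using (Σ; ∃; ∃-syntax; _×_; _,_; proj₁)
open import Data.Sum using (_⊎_)
open import Data.List using (List; []; _∷_; concatMap; map; upTo)
open import Data.List.Relation.Unary.Linked using (Linked)
open import Relation.Nullary using (¬_)
open import Relation.Binary.PropositionalEquality using (_≡_; _≢_)
open import Function.Bundles using (_⇔_)

count : ℕ → (ℕ → Bool) → ℕ
count zero    p = 0
count (suc N) p = count N p + (if p N then 1 else 0)

odd : ℕ → Bool
odd zero    = false
odd (suc k) = not (odd k)

sumℤ : ℕ → (ℕ → ℤ) → ℤ
sumℤ zero    f = 0ℤ
sumℤ (suc N) f = sumℤ N f ℤ.+ f N

InR : ℕ → ℕ → Set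
InR m i = 1 ≤ i × i ≤ m

data Path {A : Set} (S : A → Set) (Adj : A → A → Set) : A → A → Set where
  here : ∀ {x} → S x → Path S Adj x x
  step : ∀ {x y z} → S x → Adj x y → Path S Adj y z → Path S Adj x z

-- The graph P_{m+1} × C_n.  Vertices (i , c) with 0 ≤ i ≤ m and
-- c ∈ {0,…,n-1} representing Z_n.

sucMod : ℕ → ℕ → ℕ
sucMod n c = if suc c <ᵇ n then suc c else 0

predMod : ℕ → ℕ → ℕ
predMod n zero    = n ∸ 1
predMod n (suc c) = c

ValidV : ℕ → ℕ → ℕ × ℕ → Set
ValidV m n (i , c) = i ≤ m × c < n

-- A move along an edge: U = row i to i-1, D = row i to i+1,
-- R = column c to c+1 (mod n), L = column c to c-1 (mod n).
-- (Moves, not just vertices, are recorded, so that for n = 2 the two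
-- parallel horizontal edges of the cylinder embedding are distinguished.)
data Move : Set where
  U D L R : Move

data Step (m n : ℕ) : ℕ × ℕ → Move → ℕ × ℕ → Set where
  stepU : ∀ {i c} → Step m n (suc i , c) U (i , c)
  stepD : ∀ {i c} → suc i ≤ m → Step m n (i , c) D (suc i , c)
  stepR : ∀ {i c} → Step m n (i , c) R (i , sucMod n c)
  stepL : ∀ {i c} → Step m n (i , c) L (i , predMod n c)

record HamCycle (m n : ℕ) : Set where
  field
    vert      : ℕ → ℕ × ℕ
    move      : ℕ → Move
    valid     : ∀ t → t < suc m * n → ValidV m n (vert t)
    steps     : ∀ t → t < suc m * n → Step m n (vert t) (move t) (vert (suc t))
    closed    : vert (suc m * n) ≡ vert 0
    injective : ∀ s t → s < suc m * n → t < suc m * n → vert s ≡ vert t → s ≡ t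
    covering  : ∀ v → ValidV m n v → ∃[ t ] (t < suc m * n × vert t ≡ v)
open HamCycle public

hdisp : Move → ℤ
hdisp R = 1ℤ
hdisp L = ℤ.-[1+ 0 ]
hdisp U = 0ℤ
hdisp D = 0ℤ

-- Contractible as a closed curve on the cylinder: winding number 0,
-- i.e. net horizontal displacement 0.
Contractible : ∀ {m n} → HamCycle m n → Set
Contractible {m} {n} C = sumℤ (suc m * n) (λ t → hdisp (move C t)) ≡ 0ℤ

isR : Move → Bool
isR R = true
isR _ = false

isL : Move → Bool
isL L = true
isL _ = false

-- Does step t cross the upward vertical ray from the centre of window
-- w_{i,j} (1 ≤ i ≤ m, 1 ≤ j ≤ n)?  Such a ray crosses the horizontal edges
-- between vertex columns j-1 and j (mod n) at rows 0,…,i-1.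
crosses : ∀ {m n} → HamCycle m n → ℕ → ℕ → ℕ → Bool
crosses {m} {n} C i j t with vert C t
... | (ρ , c) = (ρ <ᵇ i) ∧ ((isR (move C t) ∧ (c ≡ᵇ (j ∸ 1)))
                           ∨ (isL (move C t) ∧ (c ≡ᵇ sucMod n (j ∸ 1))))

-- Window w_{i,j} lies in the disc bounded by the cycle (i.e. in the IT)
-- iff the ray to the top end of the cylinder crosses the cycle an odd
-- number of times.
inside : ∀ {m n} → HamCycle m n → ℕ → ℕ → Bool
inside {m} {n} C i j = odd (count (suc m * n) (crosses C i j))

data WAdj (m n : ℕ) : ℕ × ℕ → ℕ × ℕ → Set where
  vdown : ∀ {i j} → WAdj m n (i , j) (suc i , j)
  vup   : ∀ {i j} → WAdj m n (suc i , j) (i , j)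
  hright : ∀ {i j} → suc j ≤ n → WAdj m n (i , j) (i , suc j)
  hleft  : ∀ {i j} → suc j ≤ n → WAdj m n (i , suc j) (i , j)
  wrapR  : ∀ {i} → WAdj m n (i , n) (i , 1)
  wrapL  : ∀ {i} → WAdj m n (i , 1) (i , n)

OutW : ∀ {m n} → HamCycle m n → ℕ × ℕ → Set
OutW {m} {n} C (i , j) = InR m i × InR n j × inside C i j ≡ false

-- The split tree (the ET containing both a row-1 and a row-m window) has
-- w_{1,1} as up root.
STUpRoot11 : ∀ {m n} → HamCycle m n → Set
STUpRoot11 {m} {n} C =
  inside C 1 1 ≡ false × ∃[ j ] Path (OutW C) (WAdj m n) (1 , 1) (m , j)

-- The strip 𝒲_m: cells w^k_{i,j} written (i , j , k).

Cell : Set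
Cell = ℕ × ℕ × ℤ

data SAdj (m n : ℕ) : Cell → Cell → Set where
  vdown  : ∀ {i j k} → SAdj m n (i , j , k) (suc i , j , k)
  vup    : ∀ {i j k} → SAdj m n (suc i , j , k) (i , j , k)
  hright : ∀ {i j k} → suc j ≤ n → SAdj m n (i , j , k) (i , suc j , k)
  hleft  : ∀ {i j k} → suc j ≤ n → SAdj m n (i , suc j , k) (i , j , k)
  wrapR  : ∀ {i k k'} → k' ≡ k ℤ.+ 1ℤ → SAdj m n (i , n , k) (i , 1 , k')
  wrapL  : ∀ {i k k'} → k' ≡ k ℤ.+ 1ℤ → SAdj m n (i , 1 , k') (i , n , k)

InL : ∀ {m n} → HamCycle m n → Cell → Set
InL {m} {n} C (i , j , k) = InR m i × InR n j × inside C i j ≡ true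

-- w^ρ_{i,j} belongs to the copy of the IT whose leftmost row-1 window
-- lies in ℛ_0, i.e. the copy containing w^0_{1,q0} such that every row-1
-- window w^{k'}_{1,q'} of that copy has (k',q') ≥ (0,q0) lexicographically.
IsRoll : ∀ {m n} → HamCycle m n → ℕ → ℕ → ℤ → Set
IsRoll {m} {n} C i j ρ =
  ∃[ q0 ] (InR n q0
    × Path (InL C) (SAdj m n) (1 , q0 , 0ℤ) (i , j , ρ)
    × (∀ q' k' → Path (InL C) (SAdj m n) (1 , q' , k') (i , j , ρ) →
         (0ℤ ℤ.< k') ⊎ (k' ≡ 0ℤ × q0 ≤ q')))

JoinSet : ∀ {m n} → HamCycle m n → (ℕ → ℕ → ℤ) → ℕ → ℤ → Cell → Set
JoinSet C r k ρ (x , y , z) =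
  InL C (x , y , z) × z ≡ r x y × ((z ℤ.< ρ) ⊎ (z ≡ ρ × y ≤ k))

Joined : ∀ {m n} → HamCycle m n → (ℕ → ℕ → ℤ) → ℕ → ℤ →
         ℕ × ℕ → ℕ × ℕ → Set
Joined {m} {n} C r k ρ (i₁ , j₁) (i₂ , j₂) =
  Path (JoinSet C r k ρ) (SAdj m n) (i₁ , j₁ , r i₁ j₁) (i₂ , j₂ , r i₂ j₂)

-- (b , r) is the matrix B^{c,Int} of the cycle C (entries (b i j , r i j)
-- for 1 ≤ i ≤ m, 1 ≤ j ≤ n).  Labels: within a column j and roll value ρ,
-- equal labels ⇔ j^ρ-joined, and the classes get labels 2,3,… in order of
-- first appearance from top to bottom (every label L > 2 is preceded,
-- strictly above, by the label L-1 with the same roll).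
record IsB {m n} (C : HamCycle m n) (b : ℕ → ℕ → ℕ) (r : ℕ → ℕ → ℤ) : Set where
  field
    outZero  : ∀ i j → InR m i → InR n j → inside C i j ≡ false →
               b i j ≡ 0 × r i j ≡ 0ℤ
    inRoll   : ∀ i j → InR m i → InR n j → inside C i j ≡ true →
               IsRoll C i j (r i j)
    inLabel  : ∀ i j → InR m i → InR n j → inside C i j ≡ true → 2 ≤ b i j
    classes  : ∀ j i i' → InR n j → InR m i → InR m i' →
               inside C i j ≡ true → inside C i' j ≡ true → r i j ≡ r i' j →
               (b i j ≡ b i' j ⇔ Joined C r j (r i j) (i , j) (i' , j))
    order    : ∀ j i → InR n j → InR m i → inside C i j ≡ true → 2 < b i j →
               ∃[ i' ] (1 ≤ i' × i' < i × inside C i' j ≡ true ×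
                        r i' j ≡ r i j × suc (b i' j) ≡ b i j)

nx : ℕ → ℕ → ℕ
nx n k = if k <ᵇ n then suc k else 1

pv : ℕ → ℕ → ℕ
pv n k = if k ≡ᵇ 1 then n else k ∸ 1

aM : (ℕ → ℕ → ℕ) → ℕ → ℕ → ℕ
aM b i j = if b i j ≡ᵇ 0 then 0 else 1

FLcInt : ℕ → ℕ → (ℕ → ℕ → ℕ) → Set
FLcInt m n a =
  a 1 1 ≡ 0
  × (∀ j → InR n j → (a 1 j , a 1 (nx n j)) ≢ (0 , 0))
  × (∀ j → InR n j → (a m j , a m (nx n j)) ≢ (0 , 0))

ACcInt : ℕ → ℕ → (ℕ → ℕ → ℕ) → Set
ACcInt m n a =
  ∀ i j → 1 ≤ i → i < m → InR n j →
    let q = (a i j , a (suc i) j , a i (nx n j) , a (suc i) (nx n j)) in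
    q ≢ (1 , 1 , 1 , 1) × q ≢ (0 , 0 , 0 , 0)
    × q ≢ (0 , 1 , 1 , 0) × q ≢ (1 , 0 , 0 , 1)

module Conclusions (m n : ℕ) (b : ℕ → ℕ → ℕ) (r : ℕ → ℕ → ℤ) where

  a : ℕ → ℕ → ℕ
  a = aM b

  BR : ℕ → ℕ → ℕ × ℤ
  BR i k = (b i k , r i k)

  Occ : ℕ → ℕ × ℤ → Set
  Occ k p = ∃[ i ] (InR m i × BR i k ≡ p)

  startB : ℕ → ℕ → Bool
  startB k i = not (b i k ≡ᵇ 0) ∧ ((i ≡ᵇ 1) ∨ not (b (i ∸ 1) k ≡ᵇ b i k))

  rollWord : ℕ → List ℤ
  rollWord k = concatMap (λ i → if startB k i then r i k ∷ [] else [])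
                         (map suc (upTo m))

  Factor : ℕ → ℕ → ℕ × ℕ → Set
  Factor k β (u , v) = 1 ≤ u × u ≤ v × v ≤ m × (∀ t → u ≤ t → t ≤ v → b t k ≡ β)

  MaxFactor : ℕ → ℕ → ℕ × ℕ → Set
  MaxFactor k β (u , v) =
    Factor k β (u , v) × (u ≡ 1 ⊎ b (u ∸ 1) k ≢ β) × (v ≡ m ⊎ b (suc v) k ≢ β)

  InF : ℕ × ℕ → ℕ → Set
  InF (u , v) j = u ≤ j × j ≤ v

  MaxRoll : ℕ → ℤ → Set
  MaxRoll k ρ = ∀ i → InR m i → r i k ℤ.≤ ρ

  Link : ℕ → ℕ × ℕ → ℕ × ℕ → ℕ → ℕ → Set
  Link k f₁ f₂ j s =
    InF f₁ j × InF f₂ s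
    × a j (pv n k) ≡ 1 × a j k ≡ 1 × a s (pv n k) ≡ 1 × a s k ≡ 1
    × BR j (pv n k) ≡ BR s (pv n k)

  UniqueLink : ℕ → ℕ × ℕ → ℕ × ℕ → Set
  UniqueLink k f₁ f₂ =
    ∃[ j ] ∃[ s ] (Link k f₁ f₂ j s
      × (∀ j' s' → Link k f₁ f₂ j' s' → j' ≡ j × s' ≡ s))

  -- a sequence v₁,…,v_p is (p , f) with v_{i+1} = f i
  Seq : Set
  Seq = ℕ × (ℕ → ℕ × ℕ)

  SeqEq : Seq → Seq → Set
  SeqEq (p , f) (p' , f') = p ≡ p' × (∀ i → i < p → f i ≡ f' i)

  GoodSeq : ℕ → ℕ → ℕ × ℕ → ℕ × ℕ → Seq → Set
  GoodSeq k β v u (p , f) =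
    1 < p × f 0 ≡ v × f (p ∸ 1) ≡ u
    × (∀ i → i < p → MaxFactor k β (f i))
    × (∀ i i' → i < p → i' < p → f i ≡ f i' → i ≡ i')
    × (∀ i → suc i < p → UniqueLink k (f i) (f (suc i)))
    × (∀ i → suc (suc i) < p → ∀ j s j' s' →
         Link k (f i) (f (suc i)) j s →
         Link k (f (suc i)) (f (suc (suc i))) j' s' → s ≢ j')

  Part1 : Set
  Part1 =
    (FLcInt m n a × ACcInt m n a)
    × (∀ i k → 2 ≤ i → i ≤ m → InR n k → a (i ∸ 1) k ≡ a i k →
         BR (i ∸ 1) k ≡ BR i k)
    × (∀ i j → InR m i → InR n j → a i j ≡ 0 → r i j ≡ 0ℤ)

  Part2 : Set
  Part2 =
    (∀ k → InR n k → ∀ s ρ → 3 ≤ s → Occ k (s , ρ) →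
       ∀ ℓ → 2 ≤ ℓ → ℓ < s →
         ∃[ i' ] (InR m i' × BR i' k ≡ (ℓ , ρ)
                  × (∀ i → InR m i → BR i k ≡ (s , ρ) → i' < i)))
    × ((rollWord 1 ≡ []
        ⊎ ∃[ ρ ] ∃[ w ] (rollWord 1 ≡ ρ ∷ w × (ρ ≡ 0ℤ ⊎ ρ ≡ 1ℤ)))
       × (∀ k → 2 ≤ k → k ≤ n → ∃[ w ] (rollWord k ≡ 0ℤ ∷ w)))

  Exc1 : ℕ → ℕ → ℤ → Set
  Exc1 k β ρ = β ≡ 2 × 0ℤ ℤ.< ρ × MaxRoll k ρ × ¬ Occ k (3 , ρ)

  Exc2 : ℕ → ℕ → ℤ → Set
  Exc2 k β ρ = k ≡ n × β ≡ 2 × ρ ≡ 0ℤ × MaxRoll k ρ × ¬ Occ k (3 , 0ℤ)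

  Part3 : Set
  Part3 =
    (∀ i k → InR m i → 2 ≤ k → k ≤ n → a i (k ∸ 1) ≡ 1 → a i k ≡ 1 →
       r i (k ∸ 1) ≡ r i k)
    × (∀ k → InR n k → ∀ β ρ → β ≢ 0 → Occ k (β , ρ) →
         ¬ Exc1 k β ρ → ¬ Exc2 k β ρ →
         ∃[ i ] (InR m i × BR i k ≡ (β , ρ) × b i (nx n k) ≢ 0))
    × (∀ k → InR n k → ∀ i j → InR m i → InR m j → i ≢ j →
         BR i (pv n k) ≡ BR j (pv n k) →
         a i k ≡ 1 → a j k ≡ 1 → a i (pv n k) ≡ 1 → a j (pv n k) ≡ 1 →
         b i k ≡ b j k)
    × (∀ k → InR n k → ∀ i j β → InR m i → InR m j → i ≢ j →
         BR i (pv n k) ≡ BR j (pv n k) →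
         a i k ≡ 1 → a j k ≡ 1 → a i (pv n k) ≡ 1 → a j (pv n k) ≡ 1 →
         b i k ≡ β → b j k ≡ β →
         ¬ (∃[ f ] (Factor k β f × InF f i × InF f j)))
    × (∀ k → InR n k → ∀ β → β ≢ 0 → ∀ v u →
         MaxFactor k β v → MaxFactor k β u → v ≢ u →
         r (proj₁ v) k ≡ r (proj₁ u) k →
         ∃[ σ ] (GoodSeq k β v u σ × (∀ σ' → GoodSeq k β v u σ' → SeqEq σ' σ)))
    × (∀ k → InR n k → ∀ ρ → 0ℤ ℤ.< ρ → Occ k (2 , ρ) →
         ∃[ i ] (InR m i
           × (k ≡ 1 → r i n ≡ ρ ℤ.- 1ℤ × a i 1 ≡ 1 × a i n ≡ 1)
           × (1 < k → r i (k ∸ 1) ≡ ρ × a i (k ∸ 1) ≡ 1 × a i k ≡ 1)))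

  Part4 : Set
  Part4 =
    (BR 1 1 ≡ (0 , 0ℤ) × (2 ≤ m → BR 2 1 ≡ (0 , 0ℤ)) × BR 1 n ≡ (2 , 0ℤ))
    × (∀ i → 2 < i → i ≤ m → a i n ≡ 1 → a i 1 ≡ 1 → r i 1 ≡ r i n ℤ.+ 1ℤ)

  Part5 : Set
  Part5 =
    (∀ k → InR n k → ∀ i₁ j₁ i₂ j₂ → 1 < i₁ → i₁ < j₁ → j₁ < i₂ → i₂ < j₂ →
       j₂ ≤ m → b i₁ k ≡ b i₂ k → 1 < b i₁ k → b j₁ k ≡ b j₂ k → 1 < b j₁ k →
       r i₁ k ≡ r i₂ k → r i₂ k ≡ r j₁ k → r j₁ k ≡ r j₂ k → b i₁ k ≡ b j₁ k)
    × (∀ k → InR n k → Linked (λ x y → ∣ x ℤ.- y ∣ ≤ 1) (rollWord k))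

  Theorem5Conclusion : Set
  Theorem5Conclusion = Part1 × Part2 × Part3 × Part4 × Part5

{-# OPTIONS --safe #-}
-- The Hamiltonian cycle separates windows: adjacent windows differ exactly across cycle edges, because every vertex
-- has even degree. Every window touches the cycle, so following the cycle shows that the interior is connected.
-- The Jordan curve theorem is replaced by signed crossing numbers of paths of cells in the strip. For a closed
-- interior path the crossing number above a vertex is constant along the cycle, hence zero: the interior has no
-- cycles, and the net number of crossings of an edge defines a potential on the interior. For disjoint paths the
-- crossing number of one is constant along the other: lifts of the split tree separate the copies of the interior,
-- which determines roll numbers near the top row and across gaps of a column, and classes of a column do not interlace.
-- The sequences of factors in 3(e) are the simple paths of a forest; uniqueness is read off the potentials of the
-- edges through which a factor is entered.
module Submission where

open import Defs
open import Data.Nat using (ℕ; zero; suc; _+_; _*_; _∸_; _≤_; _<_; _≡ᵇ_; _<ᵇ_; z≤n; s≤s)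
import Data.Nat.Properties as ℕₚ
open import Data.Bool using (Bool; true; false; if_then_else_; _∧_; _∨_; not; _xor_)
import Data.Bool.Properties as Boolₚ
import Data.Integer as ℤ
open ℤ using (ℤ; +_; -[1+_]; 0ℤ; 1ℤ; ∣_∣)
import Data.Integer.Properties as ℤₚ
open import Data.Integer.Tactic.RingSolver using (solve-∀)
open import Data.Product using (∃-syntax; _×_; _,_; proj₁; proj₂)
import Data.Product.Properties as ×ₚ
open import Data.Sum using (_⊎_; inj₁; inj₂)
open import Data.Empty using (⊥; ⊥-elim)
open import Data.List using (List; []; _∷_; concatMap; map; upTo; applyUpTo)
open import Data.List.Properties using (map-upTo)
open import Data.List.Relation.Unary.Linked using (Linked; []; [-]; _∷_)
open import Relation.Nullary using (¬_; Dec; yes; no)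
open import Relation.Binary.Definitions using (tri<; tri≈; tri>)
open import Relation.Binary.PropositionalEquality
  using (_≡_; _≢_; refl; sym; trans; cong; cong₂; subst; subst₂; module ≡-Reasoning)
open import Function.Bundles using (Equivalence)

-- Paths

-- Nothing about trees is given beforehand: the hypotheses supply a cyclic list of vertices, its
-- zero displacement and one outside path from `(1 , 1)` to the bottom row. The proof therefore
-- never handles regions or faces. A Hamiltonian cycle passes through every vertex, so a quantity
-- that survives each cycle edge is constant on the whole grid, and the top boundary fixes its
-- value. Parities suffice to separate windows, since `inside` is defined by a parity; the sequences
-- of factors need to know through which edge and in which direction a path went, hence signed
-- counts in `ℤ`. They are taken in the strip because a path from top to bottom of the cylinder does
-- not have two sides. All crossing arguments rest on one conservation law, `κ-column`: what enters
-- the upper part of a column leaves it sideways, ends in it, or goes out through its bottom. Roll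
-- numbers are never computed: `root` turns a roll number into the level of the window `(1 , n)` in
-- a copy of the interior, and then only positions in the top row are compared.

module _ {A : Set} {S : A → Set} {Adj : A → A → Set} where

  infixr 5 _⊕_
  _⊕_ : ∀ {x y z} → Path S Adj x y → Path S Adj y z → Path S Adj x z
  here _     ⊕ q = q
  step s a p ⊕ q = step s a (p ⊕ q)

  path-start : ∀ {x y} → Path S Adj x y → S x
  path-start (here s)     = s
  path-start (step s _ _) = s

  path-end : ∀ {x y} → Path S Adj x y → S y
  path-end (here s)     = s
  path-end (step _ _ p) = path-end p

  snoc : ∀ {x y z} → Path S Adj x y → Adj y z → S z → Path S Adj x z
  snoc p a s = p ⊕ step (path-end p) a (here s)

  reversePath : (∀ {x y} → Adj x y → Adj y x) → ∀ {x y} → Path S Adj x y → Path S Adj y x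
  reversePath σ (here s)     = here s
  reversePath σ (step s a p) = snoc (reversePath σ p) (σ a) s

  refinePath : ∀ {x w y} → Path S Adj x w → Path S Adj w y → Path (Path S Adj x) Adj w y
  refinePath acc (here _)     = here acc
  refinePath acc (step _ a p) = step acc a (refinePath (snoc acc a (path-start p)) p)

  -- Narrows the carrier set to the component of the start. Separation needs two disjoint sets, and
  -- components that cannot reach one another are disjoint.
  reachable : ∀ {x y} → Path S Adj x y → Path (Path S Adj x) Adj x y
  reachable p = refinePath (here (path-start p)) p

  -- A discrete line integral of an oriented edge weight; all signed crossing numbers are instances.
  tot : (∀ {x y} → Adj x y → ℤ) → ∀ {x y} → Path S Adj x y → ℤ
  tot w (here _)     = 0ℤ
  tot w (step _ a p) = w a ℤ.+ tot w p

  tot-⊕ : (w : ∀ {x y} → Adj x y → ℤ) → ∀ {x y z} (p : Path S Adj x y) (q : Path S Adj y z) →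
          tot w (p ⊕ q) ≡ tot w p ℤ.+ tot w q
  tot-⊕ w (here _)     q = sym (ℤₚ.+-identityˡ _)
  tot-⊕ w (step _ a p) q = trans (cong (λ z → w a ℤ.+ z) (tot-⊕ w p q)) (sym (ℤₚ.+-assoc (w a) _ _))

  tot-zero : (w : ∀ {x y} → Adj x y → ℤ) → (∀ {x y} (a : Adj x y) → S x → S y → w a ≡ 0ℤ) →
             ∀ {x y} (p : Path S Adj x y) → tot w p ≡ 0ℤ
  tot-zero w h (here _)     = refl
  tot-zero w h (step s a p) = trans (cong₂ ℤ._+_ (h a s (path-start p)) (tot-zero w h p)) refl

  tot-cong : (w w' : ∀ {x y} → Adj x y → ℤ) → (∀ {x y} (a : Adj x y) → S x → S y → w a ≡ w' a) →
             ∀ {x y} (p : Path S Adj x y) → tot w p ≡ tot w' p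
  tot-cong w w' h (here _)     = refl
  tot-cong w w' h (step s a p) = cong₂ ℤ._+_ (h a s (path-start p)) (tot-cong w w' h p)

  tot-+ : (w w' : ∀ {x y} → Adj x y → ℤ) → ∀ {x y} (p : Path S Adj x y) →
          tot (λ a → w a ℤ.+ w' a) p ≡ tot w p ℤ.+ tot w' p
  tot-+ w w' (here _)     = refl
  tot-+ w w' (step _ a p) =
    trans (cong (λ z → w a ℤ.+ w' a ℤ.+ z) (tot-+ w w' p)) (interchange (w a) (w' a) (tot w p) (tot w' p))
    where
    interchange : ∀ a b c d → a ℤ.+ b ℤ.+ (c ℤ.+ d) ≡ a ℤ.+ c ℤ.+ (b ℤ.+ d)
    interchange = solve-∀

  tot-telescope : (G : A → ℤ) → ∀ {x y} (p : Path S Adj x y) →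
                  tot (λ {x} {y} _ → G y ℤ.- G x) p ≡ G y ℤ.- G x
  tot-telescope G {x} (here _) = sym (ℤₚ.+-inverseʳ (G x))
  tot-telescope G {x} {z} (step {y = y} _ _ p) =
    trans (cong (λ u → G y ℤ.- G x ℤ.+ u) (tot-telescope G p)) (collapse (G x) (G y) (G z))
    where
    collapse : ∀ a b c → b ℤ.- a ℤ.+ (c ℤ.- b) ≡ c ℤ.- a
    collapse = solve-∀

mapPath : ∀ {A : Set} {S T : A → Set} {Adj : A → A → Set} → (∀ {x} → S x → T x) →
          ∀ {x y} → Path S Adj x y → Path T Adj x y
mapPath f (here s)     = here (f s)
mapPath f (step s a p) = step (f s) a (mapPath f p)

tot-map : ∀ {A : Set} {S T : A → Set} {Adj : A → A → Set} (w : ∀ {x y} → Adj x y → ℤ) (f : ∀ {x} → S x → T x) →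
          ∀ {x y} (p : Path S Adj x y) → tot w (mapPath {T = T} f p) ≡ tot w p
tot-map w f (here _)     = refl
tot-map w f (step _ a p) = cong (λ z → w a ℤ.+ z) (tot-map w f p)

-- Parity of counts

-- The parity of `count` in a form that is additive under `xor` of predicates and telescopes along
-- the closed cycle.
par : ℕ → (ℕ → Bool) → Bool
par zero    p = false
par (suc N) p = par N p xor p N

odd-count : ∀ N p → odd (count N p) ≡ par N p
odd-count zero    p = refl
odd-count (suc N) p with p N
... | false = trans (cong odd (ℕₚ.+-identityʳ (count N p)))
                (trans (odd-count N p) (sym (Boolₚ.xor-identityʳ _)))
... | true  = trans (cong odd (ℕₚ.+-comm (count N p) 1))
                (trans (cong not (odd-count N p)) (sym (xor-true (par N p))))
  where
  xor-true : ∀ x → x xor true ≡ not x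
  xor-true true  = refl
  xor-true false = refl

xor-interchange : ∀ a b c d → (a xor b) xor (c xor d) ≡ (a xor c) xor (b xor d)
xor-interchange true  true  true  d = sym (Boolₚ.xor-identityˡ (not d))
xor-interchange true  true  false d = sym (Boolₚ.not-involutive d)
xor-interchange true  false c d = Boolₚ.not-distribˡ-xor c d
xor-interchange false true  c d = Boolₚ.not-distribʳ-xor c d
xor-interchange false false c d = refl

par-xor : ∀ N p q → par N (λ t → p t xor q t) ≡ par N p xor par N q
par-xor zero    p q = refl
par-xor (suc N) p q = trans (cong (_xor (p N xor q N)) (par-xor N p q))
                            (xor-interchange (par N p) (par N q) (p N) (q N))

par-cong : ∀ N {p q} → (∀ t → t < N → p t ≡ q t) → par N p ≡ par N q
par-cong zero    h = refl
par-cong (suc N) h = cong₂ _xor_ (par-cong N (λ t l → h t (ℕₚ.m<n⇒m<1+n l))) (h N (ℕₚ.n<1+n N))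

par-telescope : ∀ N (G : ℕ → Bool) → par N (λ t → G t xor G (suc t)) ≡ G 0 xor G N
par-telescope zero    G = sym (Boolₚ.xor-same (G 0))
par-telescope (suc N) G = trans (cong (_xor (G N xor G (suc N))) (par-telescope N G))
                                (collapse (G 0) (G N) (G (suc N)))
  where
  collapse : ∀ a b c → (a xor b) xor (b xor c) ≡ a xor c
  collapse true  true  c = refl
  collapse true  false c = refl
  collapse false true  c = Boolₚ.not-involutive c
  collapse false false c = refl

par-false : ∀ N p → (∀ t → t < N → p t ≡ false) → par N p ≡ false
par-false zero    p h = refl
par-false (suc N) p h = trans (cong₂ _xor_ (par-false N p (λ t l → h t (ℕₚ.m<n⇒m<1+n l))) (h N (ℕₚ.n<1+n N))) refl

par-witness : ∀ N p → par N p ≡ true → ∃[ t ] (t < N × p t ≡ true)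
par-witness (suc N) p e with p N in eN
... | true  = N , ℕₚ.n<1+n N , eN
... | false with par-witness N p (trans (sym (Boolₚ.xor-identityʳ _)) e)
...   | t , l , pt = t , ℕₚ.m<n⇒m<1+n l , pt

par-unique : ∀ N p t → t < N → p t ≡ true → (∀ s → s < N → p s ≡ true → s ≡ t) → par N p ≡ true
par-unique (suc N) p t l pt u with t ℕₚ.≟ N
... | yes refl = cong₂ _xor_ (par-false N p off) pt
  where
  off : ∀ s → s < N → p s ≡ false
  off s k with p s in es
  ... | false = refl
  ... | true  = ⊥-elim (ℕₚ.<⇒≢ k (u s (ℕₚ.m<n⇒m<1+n k) es))
... | no t≢N = cong₂ _xor_ (par-unique N p t (ℕₚ.≤∧≢⇒< (ℕₚ.≤-pred l) t≢N) pt
                             (λ s k → u s (ℕₚ.m<n⇒m<1+n k))) off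
  where
  off : p N ≡ false
  off with p N in eN
  ... | false = refl
  ... | true  = ⊥-elim (t≢N (sym (u N (ℕₚ.n<1+n N) eN)))

-- Boolean comparisons and cyclic column arithmetic

≡ᵇ-refl : ∀ k → (k ≡ᵇ k) ≡ true
≡ᵇ-refl zero    = refl
≡ᵇ-refl (suc k) = ≡ᵇ-refl k

≡ᵇ-sound : ∀ k l → (k ≡ᵇ l) ≡ true → k ≡ l
≡ᵇ-sound zero    zero    e = refl
≡ᵇ-sound (suc k) (suc l) e = cong suc (≡ᵇ-sound k l e)

≡ᵇ-≢ : ∀ k l → k ≢ l → (k ≡ᵇ l) ≡ false
≡ᵇ-≢ k l ne with k ≡ᵇ l in e
... | true  = ⊥-elim (ne (≡ᵇ-sound k l e))
... | false = refl

≡ᵇ-⇔ : ∀ k l k' l' → (k ≡ l → k' ≡ l') → (k' ≡ l' → k ≡ l) → (k ≡ᵇ l) ≡ (k' ≡ᵇ l')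
≡ᵇ-⇔ k l k' l' f g with k ≡ᵇ l in e
... | true  = sym (trans (cong (k' ≡ᵇ_) (sym (f (≡ᵇ-sound k l e)))) (≡ᵇ-refl k'))
... | false with k' ≡ᵇ l' in e'
...   | false = refl
...   | true  = ⊥-elim (contra (trans (sym e) (trans (cong (k ≡ᵇ_) (sym (g (≡ᵇ-sound k' l' e')))) (≡ᵇ-refl k))))
  where
  contra : false ≢ true
  contra ()

<ᵇ-true : ∀ {k l} → k < l → (k <ᵇ l) ≡ true
<ᵇ-true {zero}  (s≤s _) = refl
<ᵇ-true {suc k} (s≤s p) = <ᵇ-true p

<ᵇ-irrefl : ∀ k → (k <ᵇ k) ≡ false
<ᵇ-irrefl zero    = refl
<ᵇ-irrefl (suc k) = <ᵇ-irrefl k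

<ᵇ-suc : ∀ k i → (k <ᵇ suc i) ≡ (k <ᵇ i) xor (k ≡ᵇ i)
<ᵇ-suc zero    zero    = refl
<ᵇ-suc zero    (suc i) = refl
<ᵇ-suc (suc k) zero    = refl
<ᵇ-suc (suc k) (suc i) = <ᵇ-suc k i

<-split : ∀ {c n} → c < n → suc c < n ⊎ suc c ≡ n
<-split l = ℕₚ.m≤n⇒m<n∨m≡n l

sucMod-< : ∀ {n c} → suc c < n → sucMod n c ≡ suc c
sucMod-< l rewrite <ᵇ-true l = refl

sucMod-≡ : ∀ c → sucMod (suc c) c ≡ 0
sucMod-≡ c rewrite <ᵇ-irrefl c = refl

sucMod-valid : ∀ {n c} → c < n → sucMod n c < n
sucMod-valid {n} {c} l with <-split l
... | inj₁ l'   = subst (_< n) (sym (sucMod-< l')) l'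
... | inj₂ refl = subst (_< n) (sym (sucMod-≡ c)) (s≤s z≤n)

predMod-valid : ∀ {n c} → c < n → predMod n c < n
predMod-valid {suc n} {zero}  _ = ℕₚ.n<1+n n
predMod-valid {n}     {suc c} l = ℕₚ.<-trans (ℕₚ.n<1+n c) l

pred-sucMod : ∀ {n c} → c < n → predMod n (sucMod n c) ≡ c
pred-sucMod {n} {c} l with <-split l
... | inj₁ l'   = cong (predMod n) (sucMod-< l')
... | inj₂ refl = cong (predMod n) (sucMod-≡ c)

suc-predMod : ∀ {n c} → c < n → sucMod n (predMod n c) ≡ c
suc-predMod {suc n} {zero}  _ = sucMod-≡ n
suc-predMod {n}     {suc c} l = sucMod-< l

pv-∸1 : ∀ n c → pv n (suc c) ∸ 1 ≡ predMod n c
pv-∸1 n zero    = refl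
pv-∸1 n (suc c) = refl

suc-predMod-pv : ∀ {n c} → c < n → suc (predMod n c) ≡ pv n (suc c)
suc-predMod-pv {suc n} {zero}  _ = refl
suc-predMod-pv {n}     {suc c} _ = refl

pv-suc-sucMod : ∀ {n c} → c < n → pv n (suc (sucMod n c)) ≡ suc c
pv-suc-sucMod {n} l = trans (sym (suc-predMod-pv (sucMod-valid l))) (cong suc (pred-sucMod l))

true≢false : true ≢ false
true≢false ()

∧-true : ∀ {x y} → x ∧ y ≡ true → x ≡ true × y ≡ true
∧-true {true} {true} _ = refl , refl

-- Which edges belong to the cycle

opp : Move → Move
opp U = D
opp D = U
opp L = R
opp R = L

-- The test of `crosses` with vertex and move as arguments, so that case analysis on a `Step`
-- reduces it.
cr : ℕ → ℕ → ℕ → ℕ × ℕ → Move → Bool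
cr n i j (ρ , c) mv = (ρ <ᵇ i) ∧ ((isR mv ∧ (c ≡ᵇ (j ∸ 1))) ∨ (isL mv ∧ (c ≡ᵇ sucMod n (j ∸ 1))))

-- Does a move out of the vertex (ρ' , c') traverse the edge leaving (ρ , c) in the given direction?
edge : ℕ → Move → ℕ × ℕ → ℕ × ℕ → Move → Bool
edge n R (ρ , c) (ρ' , c') mv = (ρ' ≡ᵇ ρ) ∧ ((isR mv ∧ (c' ≡ᵇ c)) ∨ (isL mv ∧ (c' ≡ᵇ sucMod n c)))
edge n L (ρ , c) (ρ' , c') mv = (ρ' ≡ᵇ ρ) ∧ ((isR mv ∧ (c' ≡ᵇ predMod n c)) ∨ (isL mv ∧ (c' ≡ᵇ c)))
edge n D (ρ , c) (ρ' , c') D = (c' ≡ᵇ c) ∧ (ρ' ≡ᵇ ρ)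
edge n D (ρ , c) (ρ' , c') U = (c' ≡ᵇ c) ∧ (ρ' ≡ᵇ suc ρ)
edge n D _ _ L = false
edge n D _ _ R = false
edge n U (zero , c) _ _ = false
edge n U (suc ρ , c) v mv = edge n D (ρ , c) v mv

above : ℕ → ℕ → ℕ × ℕ → Bool
above i c (ρ , c') = (ρ <ᵇ i) ∧ (c' ≡ᵇ c)

cr-vertical : ∀ n i j v mv → cr n i (suc j) v mv xor cr n (suc i) (suc j) v mv ≡ edge n R (i , j) v mv
cr-vertical n i j (ρ , c) mv rewrite <ᵇ-suc ρ i = lem (ρ <ᵇ i) (ρ ≡ᵇ i) _
  where
  lem : ∀ x y z → (x ∧ z) xor ((x xor y) ∧ z) ≡ y ∧ z
  lem true  true  true  = refl
  lem true  true  false = refl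
  lem true  false true  = refl
  lem true  false false = refl
  lem false true  true  = refl
  lem false true  false = refl
  lem false false z     = refl

cr-left : ∀ {n c} i v mv → c < n →
  cr n i (pv n (suc c)) v mv ≡ (proj₁ v <ᵇ i) ∧ ((isR mv ∧ (proj₂ v ≡ᵇ predMod n c)) ∨ (isL mv ∧ (proj₂ v ≡ᵇ c)))
cr-left {n} {c} i (ρ , c') mv l rewrite pv-∸1 n c | suc-predMod l = refl

-- The vertices of column `c` in rows up to `i` form a segment. It can be left only by the edges
-- that the two neighbouring rays cross and by the edge below `(i , c)`. A step uses an odd number
-- of these iff it changes membership in the segment, so the sum telescopes along the cycle.
cr-horizontal : ∀ {m n v mv v'} i c → Step m n v mv v' → proj₂ v < n → c < n →
  (cr n (suc i) (pv n (suc c)) v mv xor cr n (suc i) (suc c) v mv) xor edge n D (i , c) v mv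
    ≡ above (suc i) c v xor above (suc i) c v'
cr-horizontal {n = n} {v} {mv} {v'} i c s lv l
  rewrite cr-left {n} {c} (suc i) v mv l with s
... | stepU {ρ} {c'} rewrite <ᵇ-suc ρ i = lem (ρ <ᵇ i) (ρ ≡ᵇ i) (c' ≡ᵇ c)
  where
  lem : ∀ x y z → ((x ∧ false) xor (x ∧ false)) xor (z ∧ y) ≡ (x ∧ z) xor ((x xor y) ∧ z)
  lem true  true  true  = refl
  lem true  true  false = refl
  lem true  false true  = refl
  lem true  false false = refl
  lem false true  true  = refl
  lem false true  false = refl
  lem false false true  = refl
  lem false false false = refl
... | stepD {ρ} {c'} _ rewrite <ᵇ-suc ρ i = lem (ρ <ᵇ i) (ρ ≡ᵇ i) (c' ≡ᵇ c)
  where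
  lem : ∀ x y z → (((x xor y) ∧ false) xor ((x xor y) ∧ false)) xor (z ∧ y) ≡ ((x xor y) ∧ z) xor (x ∧ z)
  lem true  true  true  = refl
  lem true  true  false = refl
  lem true  false true  = refl
  lem true  false false = refl
  lem false true  true  = refl
  lem false true  false = refl
  lem false false true  = refl
  lem false false false = refl
... | stepR {ρ} {c'} = lem (ρ <ᵇ suc i) (c' ≡ᵇ predMod n c) (c' ≡ᵇ c) (sucMod n c' ≡ᵇ c)
        (≡ᵇ-⇔ c' (predMod n c) (sucMod n c') c
          (λ e → trans (cong (sucMod n) e) (suc-predMod l))
          (λ e → trans (sym (pred-sucMod lv)) (cong (predMod n) e)))
  where
  lem : ∀ x y z w → y ≡ w → ((x ∧ (y ∨ false)) xor (x ∧ (z ∨ false))) xor false ≡ (x ∧ z) xor (x ∧ w)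
  lem false y     z     .y    refl = refl
  lem true  true  true  .true refl = refl
  lem true  true  false .true refl = refl
  lem true  false true  .false refl = refl
  lem true  false false .false refl = refl
... | stepL {ρ} {c'} = lem (ρ <ᵇ suc i) (c' ≡ᵇ c) (c' ≡ᵇ sucMod n c) (predMod n c' ≡ᵇ c)
        (≡ᵇ-⇔ c' (sucMod n c) (predMod n c') c
          (λ e → trans (cong (predMod n) e) (pred-sucMod l))
          (λ e → trans (sym (suc-predMod lv)) (cong (sucMod n) e)))
  where
  lem : ∀ x y z w → z ≡ w → ((x ∧ y) xor (x ∧ z)) xor false ≡ (x ∧ y) xor (x ∧ w)
  lem x y z .z refl = Boolₚ.xor-identityʳ _

edge-uses : ∀ {m n v' mv v''} X v → proj₂ v < n → proj₂ v' < n → Step m n v' mv v'' → edge n X v v' mv ≡ true →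
            (v' ≡ v × mv ≡ X) ⊎ (v'' ≡ v × mv ≡ opp X)
edge-uses {n = n} R (ρ , c) lv lv' (stepR {ρ'} {c'}) e with ∧-true {ρ' ≡ᵇ ρ} e
... | e₁ , e₂ = inj₁ (cong₂ _,_ (≡ᵇ-sound _ _ e₁) (≡ᵇ-sound c' c (trans (sym (Boolₚ.∨-identityʳ _)) e₂)) , refl)
edge-uses {n = n} R (ρ , c) lv lv' (stepL {ρ'} {c'}) e with ∧-true {ρ' ≡ᵇ ρ} e
... | e₁ , e₂ = inj₂ (cong₂ _,_ (≡ᵇ-sound _ _ e₁)
                        (trans (cong (predMod n) (≡ᵇ-sound c' (sucMod n c) e₂)) (pred-sucMod lv)) , refl)
edge-uses R (ρ , c) lv lv' (stepU {ρ'}) e with ∧-true {suc ρ' ≡ᵇ ρ} e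
... | _ , ()
edge-uses R (ρ , c) lv lv' (stepD {ρ'} _) e with ∧-true {ρ' ≡ᵇ ρ} e
... | _ , ()
edge-uses {n = n} L (ρ , c) lv lv' (stepR {ρ'} {c'}) e with ∧-true {ρ' ≡ᵇ ρ} e
... | e₁ , e₂ = inj₂ (cong₂ _,_ (≡ᵇ-sound _ _ e₁)
                        (trans (cong (sucMod n) (≡ᵇ-sound c' (predMod n c) (trans (sym (Boolₚ.∨-identityʳ _)) e₂)))
                               (suc-predMod lv)) , refl)
edge-uses L (ρ , c) lv lv' (stepL {ρ'} {c'}) e with ∧-true {ρ' ≡ᵇ ρ} e
... | e₁ , e₂ = inj₁ (cong₂ _,_ (≡ᵇ-sound _ _ e₁) (≡ᵇ-sound c' c e₂) , refl)
edge-uses L (ρ , c) lv lv' (stepU {ρ'}) e with ∧-true {suc ρ' ≡ᵇ ρ} e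
... | _ , ()
edge-uses L (ρ , c) lv lv' (stepD {ρ'} _) e with ∧-true {ρ' ≡ᵇ ρ} e
... | _ , ()
edge-uses D (ρ , c) lv lv' (stepD {ρ'} {c'} _) e with ∧-true {c' ≡ᵇ c} e
... | e₁ , e₂ = inj₁ (cong₂ _,_ (≡ᵇ-sound _ _ e₂) (≡ᵇ-sound _ _ e₁) , refl)
edge-uses D (ρ , c) lv lv' (stepU {ρ'} {c'}) e with ∧-true {c' ≡ᵇ c} e
... | e₁ , e₂ = inj₂ (cong₂ _,_ (≡ᵇ-sound ρ' ρ e₂) (≡ᵇ-sound _ _ e₁) , refl)
edge-uses U (suc ρ , c) lv lv' (stepD {ρ'} {c'} _) e with ∧-true {c' ≡ᵇ c} e
... | e₁ , e₂ = inj₂ (cong₂ _,_ (cong suc (≡ᵇ-sound _ _ e₂)) (≡ᵇ-sound _ _ e₁) , refl)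
edge-uses U (suc ρ , c) lv lv' (stepU {ρ'} {c'}) e with ∧-true {c' ≡ᵇ c} e
... | e₁ , e₂ = inj₁ (cong₂ _,_ (cong suc (≡ᵇ-sound ρ' ρ e₂)) (≡ᵇ-sound _ _ e₁) , refl)

edge-self : ∀ {m n v mv v'} → Step m n v mv v' → edge n mv v v mv ≡ true
edge-self (stepU {ρ} {c})   rewrite ≡ᵇ-refl ρ | ≡ᵇ-refl c = refl
edge-self (stepD {ρ} {c} _) rewrite ≡ᵇ-refl ρ | ≡ᵇ-refl c = refl
edge-self (stepR {ρ} {c})   rewrite ≡ᵇ-refl ρ | ≡ᵇ-refl c = refl
edge-self (stepL {ρ} {c})   rewrite ≡ᵇ-refl ρ | ≡ᵇ-refl c = refl

step-back : ∀ {m n u v w} X → proj₂ u < n → Step m n u (opp X) v → Step m n v X w → u ≡ w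
step-back U l (stepD _) stepU = refl
step-back D l stepU (stepD _) = refl
step-back L l stepR stepL = cong (_ ,_) (sym (pred-sucMod l))
step-back R l stepL stepR = cong (_ ,_) (sym (suc-predMod l))

-- Winding number of the cycle

-- Signed passage through the seam between the last column and column 0. The column 0 is written
-- `sucMod n (n ∸ 1)` as in `cr` for window column `n`, which is thus the same count without signs.
wrap : ℕ → ℕ × ℕ → Move → ℤ
wrap n (_ , c) R = if c ≡ᵇ (n ∸ 1) then 1ℤ else 0ℤ
wrap n (_ , c) L = if c ≡ᵇ sucMod n (n ∸ 1) then -[1+ 0 ] else 0ℤ
wrap n _ U = 0ℤ
wrap n _ D = 0ℤ

hdisp-wrap : ∀ {m n v mv v'} → Step m n v mv v' → proj₂ v < n →
             hdisp mv ≡ (+ proj₂ v' ℤ.- + proj₂ v) ℤ.+ + n ℤ.* wrap n v mv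
hdisp-wrap {n = n} (stepU {i} {c}) l = lem (+ c) (+ n)
  where
  lem : ∀ x y → 0ℤ ≡ (x ℤ.- x) ℤ.+ y ℤ.* 0ℤ
  lem = solve-∀
hdisp-wrap {n = n} (stepD {i} {c} _) l = lem (+ c) (+ n)
  where
  lem : ∀ x y → 0ℤ ≡ (x ℤ.- x) ℤ.+ y ℤ.* 0ℤ
  lem = solve-∀
hdisp-wrap {n = suc n'} (stepR {i} {c}) l with <-split l
... | inj₁ l' rewrite sucMod-< l' | ≡ᵇ-≢ c n' (ℕₚ.<⇒≢ (ℕₚ.≤-pred l')) = lem (+ c) (+ suc n')
  where
  lem : ∀ x y → 1ℤ ≡ (1ℤ ℤ.+ x ℤ.- x) ℤ.+ y ℤ.* 0ℤ
  lem = solve-∀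
... | inj₂ refl rewrite sucMod-≡ c | ≡ᵇ-refl c = lem (+ c)
  where
  lem : ∀ x → 1ℤ ≡ (0ℤ ℤ.- x) ℤ.+ (1ℤ ℤ.+ x) ℤ.* 1ℤ
  lem = solve-∀
hdisp-wrap {n = suc n'} (stepL {i} {zero}) l rewrite sucMod-≡ n' = lem (+ n')
  where
  lem : ∀ x → -[1+ 0 ] ≡ (x ℤ.- 0ℤ) ℤ.+ (1ℤ ℤ.+ x) ℤ.* -[1+ 0 ]
  lem = solve-∀
hdisp-wrap {n = suc n'} (stepL {i} {suc c}) l rewrite sucMod-≡ n' = lem (+ c) (+ suc n')
  where
  lem : ∀ x y → -[1+ 0 ] ≡ (x ℤ.- (1ℤ ℤ.+ x)) ℤ.+ y ℤ.* 0ℤ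
  lem = solve-∀

sumℤ-telescope : ∀ N (f w g : ℕ → ℤ) z → (∀ t → t < N → f t ≡ (g (suc t) ℤ.- g t) ℤ.+ z ℤ.* w t) →
                 sumℤ N f ≡ (g N ℤ.- g 0) ℤ.+ z ℤ.* sumℤ N w
sumℤ-telescope zero    f w g z h = lem (g 0) z
  where
  lem : ∀ x y → 0ℤ ≡ (x ℤ.- x) ℤ.+ y ℤ.* 0ℤ
  lem = solve-∀
sumℤ-telescope (suc N) f w g z h =
  trans (cong₂ ℤ._+_ (sumℤ-telescope N f w g z (λ t l → h t (ℕₚ.m<n⇒m<1+n l))) (h N (ℕₚ.n<1+n N)))
        (lem (g N) (g 0) (g (suc N)) z (sumℤ N w) (w N))
  where
  lem : ∀ a b c z s w → (a ℤ.- b) ℤ.+ z ℤ.* s ℤ.+ ((c ℤ.- a) ℤ.+ z ℤ.* w) ≡ (c ℤ.- b) ℤ.+ z ℤ.* (s ℤ.+ w)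
  lem = solve-∀

-- Relates an unsigned test to a signed count, so that `sumℤ-parity` can pass from the winding
-- number to a crossing parity.
SignOf : Bool → ℤ → Set
SignOf true  z = z ≡ 1ℤ ⊎ z ≡ -[1+ 0 ]
SignOf false z = z ≡ 0ℤ

bit : Bool → ℤ
bit b = if b then 1ℤ else 0ℤ

sumℤ-parity : ∀ N p w → (∀ t → t < N → SignOf (p t) (w t)) →
              ∃[ k ] sumℤ N w ≡ (k ℤ.+ k) ℤ.+ bit (par N p)
sumℤ-parity zero    p w h = 0ℤ , refl
sumℤ-parity (suc N) p w h with sumℤ-parity N p w (λ t l → h t (ℕₚ.m<n⇒m<1+n l)) | h N (ℕₚ.n<1+n N)
... | k , e | s with par N p | p N
...   | true  | true  with s
...     | inj₁ e' = k ℤ.+ 1ℤ , trans (cong₂ ℤ._+_ e e') (lem k)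
  where
  lem : ∀ k → (k ℤ.+ k) ℤ.+ 1ℤ ℤ.+ 1ℤ ≡ ((k ℤ.+ 1ℤ) ℤ.+ (k ℤ.+ 1ℤ)) ℤ.+ 0ℤ
  lem = solve-∀
...     | inj₂ e' = k , trans (cong₂ ℤ._+_ e e') (lem k)
  where
  lem : ∀ k → (k ℤ.+ k) ℤ.+ 1ℤ ℤ.+ -[1+ 0 ] ≡ (k ℤ.+ k) ℤ.+ 0ℤ
  lem = solve-∀
sumℤ-parity (suc N) p w h | k , e | s | true  | false = k , trans (cong₂ ℤ._+_ e s) (ℤₚ.+-identityʳ _)
sumℤ-parity (suc N) p w h | k , e | s | false | false = k , trans (cong₂ ℤ._+_ e s) (ℤₚ.+-identityʳ _)
sumℤ-parity (suc N) p w h | k , e | inj₁ e' | false | true =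
  k , trans (cong₂ ℤ._+_ e e') (cong (λ z → z ℤ.+ 1ℤ) (ℤₚ.+-identityʳ (k ℤ.+ k)))
sumℤ-parity (suc N) p w h | k , e | inj₂ e' | false | true = k ℤ.- 1ℤ , trans (cong₂ ℤ._+_ e e') (lem k)
  where
  lem : ∀ k → (k ℤ.+ k) ℤ.+ 0ℤ ℤ.+ -[1+ 0 ] ≡ ((k ℤ.- 1ℤ) ℤ.+ (k ℤ.- 1ℤ)) ℤ.+ 1ℤ
  lem = solve-∀

double≢-1 : ∀ k → (k ℤ.+ k) ℤ.+ 1ℤ ≢ 0ℤ
double≢-1 (+ k) e rewrite ℕₚ.+-comm (k + k) 1 with () ← e
double≢-1 -[1+ k ] ()

xor≡false : ∀ a b → a xor b ≡ false → a ≡ b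
xor≡false true  true  _ = refl
xor≡false false false _ = refl

-- The cycle separates windows

module CycleEdges {m n : ℕ} (1≤m : 1 ≤ m) (2≤n : 2 ≤ n) (C : HamCycle m n) where

  N : ℕ
  N = suc m * n

  3≤N : 3 ≤ N
  3≤N = ℕₚ.≤-trans (ℕₚ.n≤1+n 3) (ℕₚ.*-mono-≤ {2} {suc m} {2} {n} (s≤s 1≤m) 2≤n)

  0<N : 0 < N
  0<N = ℕₚ.≤-trans (s≤s z≤n) 3≤N

  col-valid : ∀ {t} → t < N → proj₂ (vert C t) < n
  col-valid l = proj₂ (valid C _ l)

  inside-par : ∀ i j → inside C i j ≡ par N (λ t → cr n i j (vert C t) (move C t))
  inside-par i j = trans (odd-count N (crosses C i j)) (par-cong N (λ t _ → crosses≡cr t))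
    where
    crosses≡cr : ∀ t → crosses C i j t ≡ cr n i j (vert C t) (move C t)
    crosses≡cr t with vert C t
    ... | _ = refl

  onEdge : Move → ℕ × ℕ → ℕ → Bool
  onEdge X v t = edge n X v (vert C t) (move C t)

  -- Do the two windows on either side of the edge leaving the vertex in the given direction differ?
  diff : Move → ℕ × ℕ → Bool
  diff R (ρ , c) = inside C ρ (suc c) xor inside C (suc ρ) (suc c)
  diff L (ρ , c) = inside C ρ (pv n (suc c)) xor inside C (suc ρ) (pv n (suc c))
  diff D (ρ , c) = inside C (suc ρ) (pv n (suc c)) xor inside C (suc ρ) (suc c)
  diff U (ρ , c) = inside C ρ (pv n (suc c)) xor inside C ρ (suc c)

  inside-0 : ∀ j → inside C 0 j ≡ false
  inside-0 j = trans (inside-par 0 j) (par-false N _ (λ _ _ → refl))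

  diff-R : ∀ ρ c → inside C ρ (suc c) xor inside C (suc ρ) (suc c) ≡ par N (onEdge R (ρ , c))
  diff-R ρ c = trans (cong₂ _xor_ (inside-par ρ (suc c)) (inside-par (suc ρ) (suc c)))
    (trans (sym (par-xor N _ _)) (par-cong N (λ t _ → cr-vertical n ρ c (vert C t) (move C t))))

  diff-D : ∀ ρ c → c < n → diff D (ρ , c) ≡ par N (onEdge D (ρ , c))
  diff-D ρ c l = xor≡false _ _ (begin
    diff D (ρ , c) xor par N (onEdge D (ρ , c))
      ≡⟨ cong (_xor par N (onEdge D (ρ , c))) (cong₂ _xor_ (inside-par (suc ρ) (pv n (suc c))) (inside-par (suc ρ) (suc c))) ⟩
    (par N _ xor par N _) xor par N (onEdge D (ρ , c))
      ≡⟨ cong (_xor par N (onEdge D (ρ , c))) (sym (par-xor N _ _)) ⟩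
    par N _ xor par N (onEdge D (ρ , c))
      ≡⟨ sym (par-xor N _ _) ⟩
    par N _
      ≡⟨ par-cong N (λ t lt → cr-horizontal ρ c (steps C t lt) (col-valid lt) l) ⟩
    par N (λ t → above (suc ρ) c (vert C t) xor above (suc ρ) c (vert C (suc t)))
      ≡⟨ par-telescope N (λ t → above (suc ρ) c (vert C t)) ⟩
    above (suc ρ) c (vert C 0) xor above (suc ρ) c (vert C N)
      ≡⟨ cong (λ v → above (suc ρ) c (vert C 0) xor above (suc ρ) c v) (closed C) ⟩
    above (suc ρ) c (vert C 0) xor above (suc ρ) c (vert C 0)
      ≡⟨ Boolₚ.xor-same (above (suc ρ) c (vert C 0)) ⟩
    false ∎)
    where open ≡-Reasoning

  diff-par : ∀ X v → proj₂ v < n → diff X v ≡ par N (onEdge X v)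
  diff-par R (ρ , c) l = diff-R ρ c
  diff-par L (ρ , c) l rewrite sym (suc-predMod-pv l) = trans (diff-R ρ (predMod n c)) (par-cong N (λ t _ → same t))
    where
    same : ∀ t → onEdge R (ρ , predMod n c) t ≡ onEdge L (ρ , c) t
    same t rewrite suc-predMod l = refl
  diff-par D (ρ , c) l = diff-D ρ c l
  diff-par U (suc ρ , c) l = diff-D ρ c l
  diff-par U (zero , c) l =
    trans (cong₂ _xor_ (inside-0 (pv n (suc c))) (inside-0 (suc c))) (sym (par-false N _ (λ _ _ → refl)))

  Uses : Move → ℕ × ℕ → ℕ → Set
  Uses X v s = (vert C s ≡ v × move C s ≡ X) ⊎ (vert C (suc s) ≡ v × move C s ≡ opp X)

  onEdge-uses : ∀ X v s → proj₂ v < n → s < N → onEdge X v s ≡ true → Uses X v s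
  onEdge-uses X v s l ls e = edge-uses X v l (col-valid ls) (steps C s ls) e

  injective-suc : ∀ s t → s < N → t < N → vert C (suc s) ≡ vert C (suc t) → s ≡ t
  injective-suc s t ls lt e with <-split ls | <-split lt
  ... | inj₁ a | inj₁ b = ℕₚ.suc-injective (injective C (suc s) (suc t) a b e)
  ... | inj₂ a | inj₂ b = ℕₚ.suc-injective (trans a (sym b))
  ... | inj₁ a | inj₂ b
    with () ← injective C (suc s) 0 a 0<N (trans e (trans (cong (vert C) b) (closed C)))
  ... | inj₂ a | inj₁ b
    with () ← injective C (suc t) 0 b 0<N (trans (sym e) (trans (cong (vert C) a) (closed C)))

  -- Injectivity would put `t` one step after `s` and `s` one step after `t`, closing the cycle
  -- after two steps, while `3 ≤ N`.
  no-backtrack : ∀ s t → s < N → t < N → vert C (suc s) ≡ vert C t → vert C s ≡ vert C (suc t) → ⊥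
  no-backtrack s t ls lt e₁ e₂ with <-split ls | <-split lt
  ... | inj₁ a | inj₁ b =
    ℕₚ.m≢1+n+m s {1} (trans (injective C s (suc t) ls b e₂) (cong suc (sym (injective C (suc s) t a lt e₁))))
  ... | inj₂ a | _ with injective C 0 t 0<N lt (trans (sym (closed C)) (trans (cong (vert C) (sym a)) e₁))
  ...   | refl with injective C s 1 ls (ℕₚ.≤-trans (s≤s (s≤s z≤n)) 3≤N) e₂
  ...     | refl = ℕₚ.<⇒≢ 3≤N a
  no-backtrack s t ls lt e₁ e₂ | inj₁ _ | inj₂ b
    with injective C s 0 ls 0<N (trans e₂ (trans (cong (vert C) b) (closed C)))
  ... | refl with injective C 1 t (ℕₚ.≤-trans (s≤s (s≤s z≤n)) 3≤N) lt e₁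
  ...   | refl = ℕₚ.<⇒≢ 3≤N b

  -- Only step `t` traverses this edge: a step in the same direction starts at the same vertex, and
  -- one in the opposite direction would backtrack. So the parity in `diff-par` is odd.
  diff-move : ∀ t → t < N → diff (move C t) (vert C t) ≡ true
  diff-move t lt = trans (diff-par (move C t) (vert C t) (col-valid lt))
    (par-unique N _ t lt (edge-self (steps C t lt)) unique)
    where
    unique : ∀ s → s < N → onEdge (move C t) (vert C t) s ≡ true → s ≡ t
    unique s ls e with onEdge-uses (move C t) (vert C t) s (col-valid lt) ls e
    ... | inj₁ (e₁ , _)  = injective C s t ls lt e₁
    ... | inj₂ (e₁ , e₂) = ⊥-elim (no-backtrack s t ls lt e₁
      (step-back (move C t) (col-valid ls)
        (subst₂ (Step m n (vert C s)) e₂ e₁ (steps C s ls)) (steps C t lt)))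

  diff-uses : ∀ X v → proj₂ v < n → diff X v ≡ true → ∃[ s ] (s < N × Uses X v s)
  diff-uses X v l e with par-witness N (onEdge X v) (trans (sym (diff-par X v l)) e)
  ... | s , ls , es = s , ls , onEdge-uses X v s l ls es

  -- A vertex has degree two on the cycle.
  no-three : ∀ v → proj₂ v < n → diff U v ≡ true → diff R v ≡ true → diff D v ≡ true → ⊥
  no-three v l u r d with diff-uses U v l u | diff-uses R v l r | diff-uses D v l d
  ... | s₁ , l₁ , inj₁ (a , x) | s₂ , l₂ , inj₁ (b , y) | _
    with refl ← injective C s₁ s₂ l₁ l₂ (trans a (sym b)) with () ← trans (sym x) y
  ... | s₁ , l₁ , inj₂ (a , x) | s₂ , l₂ , inj₂ (b , y) | _
    with refl ← injective-suc s₁ s₂ l₁ l₂ (trans a (sym b)) with () ← trans (sym x) y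
  ... | s₁ , l₁ , inj₁ (a , x) | _ | s₂ , l₂ , inj₁ (b , y)
    with refl ← injective C s₁ s₂ l₁ l₂ (trans a (sym b)) with () ← trans (sym x) y
  ... | s₁ , l₁ , inj₂ (a , x) | _ | s₂ , l₂ , inj₂ (b , y)
    with refl ← injective-suc s₁ s₂ l₁ l₂ (trans a (sym b)) with () ← trans (sym x) y
  ... | _ | s₁ , l₁ , inj₁ (a , x) | s₂ , l₂ , inj₁ (b , y)
    with refl ← injective C s₁ s₂ l₁ l₂ (trans a (sym b)) with () ← trans (sym x) y
  ... | _ | s₁ , l₁ , inj₂ (a , x) | s₂ , l₂ , inj₂ (b , y)
    with refl ← injective-suc s₁ s₂ l₁ l₂ (trans a (sym b)) with () ← trans (sym x) y

  module _ (contractible : Contractible C) where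

    winding : sumℤ N (λ t → wrap n (vert C t) (move C t)) ≡ 0ℤ
    winding = n*w≡0 2≤n (trans (sym zeroSum) contractible)
      where
      w = sumℤ N (λ t → wrap n (vert C t) (move C t))
      zeroSum : sumℤ N (λ t → hdisp (move C t)) ≡ + n ℤ.* w
      zeroSum = trans
        (sumℤ-telescope N _ _ (λ t → + proj₂ (vert C t)) (+ n) (λ t l → hdisp-wrap (steps C t l) (col-valid l)))
        (trans (cong (λ v → (+ proj₂ v ℤ.- + proj₂ (vert C 0)) ℤ.+ + n ℤ.* w) (closed C))
               (lem (+ proj₂ (vert C 0)) (+ n ℤ.* w)))
        where
        lem : ∀ x y → (x ℤ.- x) ℤ.+ y ≡ y
        lem = solve-∀
      n*w≡0 : ∀ {n} → 2 ≤ n → + n ℤ.* w ≡ 0ℤ → w ≡ 0ℤ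
      n*w≡0 {suc n} _ e with ℤₚ.i*j≡0⇒i≡0∨j≡0 (+ suc n) e
      ... | inj₂ z = z

    -- This is where contractibility enters. The ray of the fictitious window below row `m` in
    -- column `n` runs along the whole seam, so its crossing parity is that of the winding number.
    inside-bottom-n : inside C (suc m) n ≡ false
    inside-bottom-n with sumℤ-parity N (λ t → cr n (suc m) n (vert C t) (move C t))
                           (λ t → wrap n (vert C t) (move C t)) (λ t l → sign t l)
      where
      signCase : ∀ v mv → proj₁ v < suc m → SignOf (cr n (suc m) n v mv) (wrap n v mv)
      signCase (ρ , c) U l rewrite <ᵇ-true l = refl
      signCase (ρ , c) D l rewrite <ᵇ-true l = refl
      signCase (ρ , c) R l rewrite <ᵇ-true l with c ≡ᵇ (n ∸ 1)
      ... | true  = inj₁ refl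
      ... | false = refl
      signCase (ρ , c) L l rewrite <ᵇ-true l with c ≡ᵇ sucMod n (n ∸ 1)
      ... | true  = inj₂ refl
      ... | false = refl
      sign : ∀ t → t < N → SignOf (cr n (suc m) n (vert C t) (move C t)) (wrap n (vert C t) (move C t))
      sign t l = signCase (vert C t) (move C t) (s≤s (proj₁ (valid C t l)))
    ... | k , e rewrite inside-par (suc m) n
      with par N (λ t → cr n (suc m) n (vert C t) (move C t))
    ...   | false = refl
    ...   | true  = ⊥-elim (double≢-1 k (trans (sym e) winding))

    -- No edge leads down from row `m`, hence nothing separates neighbouring windows of the
    -- fictitious row `suc m`, and the value spreads from column `n`.
    inside-bottom : ∀ c → c < n → inside C (suc m) (suc c) ≡ false
    inside-bottom c l = trans (sym (xor≡false _ _ same)) (left c l)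
      where
      same : diff D (m , c) ≡ false
      same = trans (diff-D m c l) (par-false N _ (λ t lt → off t lt))
        where
        off : ∀ t → t < N → onEdge D (m , c) t ≡ false
        off t lt with onEdge D (m , c) t in e
        ... | false = refl
        ... | true with vert C t | move C t | vert C (suc t) | steps C t lt | valid C t lt
        ...   | _ | _ | _ | stepD {ρ} {c'} lρ | _ =
          ⊥-elim (ℕₚ.<-irrefl (≡ᵇ-sound ρ m (proj₂ (∧-true {c' ≡ᵇ c} e))) lρ)
        ...   | _ | _ | _ | stepU {ρ} {c'} | (lρ , _) =
          ⊥-elim (ℕₚ.<-irrefl (≡ᵇ-sound ρ m (proj₂ (∧-true {c' ≡ᵇ c} e))) lρ)
      left : ∀ c → c < n → inside C (suc m) (pv n (suc c)) ≡ false
      left zero    l = inside-bottom-n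
      left (suc c) l = inside-bottom c (ℕₚ.<-trans (ℕₚ.n<1+n c) l)

-- Connectedness of the interior

shift-SAdj : ∀ {m n} l {i j k i' j' k'} → SAdj m n (i , j , k) (i' , j' , k') →
             SAdj m n (i , j , k ℤ.+ l) (i' , j' , k' ℤ.+ l)
shift-SAdj l vdown      = vdown
shift-SAdj l vup        = vup
shift-SAdj l (hright p) = hright p
shift-SAdj l (hleft p)  = hleft p
shift-SAdj l (wrapR {k = k} refl) = wrapR (lem k l)
  where
  lem : ∀ k l → k ℤ.+ 1ℤ ℤ.+ l ≡ k ℤ.+ l ℤ.+ 1ℤ
  lem = solve-∀
shift-SAdj l (wrapL {k = k} refl) = wrapL (lem k l)
  where
  lem : ∀ k l → k ℤ.+ 1ℤ ℤ.+ l ≡ k ℤ.+ l ℤ.+ 1ℤ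
  lem = solve-∀

flip-SAdj : ∀ {m n x y} → SAdj m n x y → SAdj m n y x
flip-SAdj vdown      = vup
flip-SAdj vup        = vdown
flip-SAdj (hright p) = hleft p
flip-SAdj (hleft p)  = hright p
flip-SAdj (wrapR e)  = wrapL e
flip-SAdj (wrapL e)  = wrapR e

-- Preimage of a set of windows under the covering. It ignores the level, so translates of cells
-- stay in it definitionally.
Over : (ℕ × ℕ → Set) → Cell → Set
Over W (i , j , _) = W (i , j)

shiftPath : ∀ {m n} {W : ℕ × ℕ → Set} l {i j k i' j' k'} → Path (Over W) (SAdj m n) (i , j , k) (i' , j' , k') →
            Path (Over W) (SAdj m n) (i , j , k ℤ.+ l) (i' , j' , k' ℤ.+ l)
shiftPath l (here s)     = here s
shiftPath l (step s a p) = step s (shift-SAdj l a) (shiftPath l p)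

shift-cancel : ∀ k l → k ℤ.+ (l ℤ.- k) ≡ l
shift-cancel = solve-∀

pv-suc-InR : ∀ {n c} → c < n → InR n (pv n (suc c))
pv-suc-InR {n} {zero}  l = l , ℕₚ.≤-refl
pv-suc-InR {n} {suc c} l = s≤s z≤n , ℕₚ.<⇒≤ l

suc-InR : ∀ {n c} → c < n → InR n (suc c)
suc-InR l = s≤s z≤n , l

xor-true : ∀ a b → a xor b ≡ true → a ≡ true ⊎ b ≡ true
xor-true true  b _ = inj₁ refl
xor-true false b e = inj₂ e

data Corner : Set where
  lu ru ld rd : Corner

window : ℕ → ℕ × ℕ → Corner → ℕ × ℕ
window n (ρ , c) lu = ρ , pv n (suc c)
window n (ρ , c) ru = ρ , suc c
window n (ρ , c) ld = suc ρ , pv n (suc c)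
window n (ρ , c) rd = suc ρ , suc c

module Interior {m n : ℕ} (1≤m : 1 ≤ m) (2≤n : 2 ≤ n) (C : HamCycle m n) (contractible : Contractible C) where
  open CycleEdges 1≤m 2≤n C public

  InW : ℕ × ℕ → Set
  InW (i , j) = InR m i × InR n j × inside C i j ≡ true

  -- The move with which the cycle leaves this vertex separates two of the four windows around it.
  not-all-equal : ∀ i c x → i ≤ m → c < n → (∀ k → inside C (proj₁ (window n (i , c) k)) (proj₂ (window n (i , c) k)) ≡ x) → ⊥
  not-all-equal i c x li lc h with covering C (i , c) (li , lc)
  ... | t , lt , e with diff-move t lt
  ...   | d rewrite e = contra (move C t) d
    where
    x⊕x : ∀ {a b} → a ≡ x → b ≡ x → a xor b ≡ false
    x⊕x refl refl = Boolₚ.xor-same x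
    contra : ∀ X → diff X (i , c) ≡ true → ⊥
    contra U d = true≢false (trans (sym d) (x⊕x (h lu) (h ru)))
    contra D d = true≢false (trans (sym d) (x⊕x (h ld) (h rd)))
    contra L d = true≢false (trans (sym d) (x⊕x (h lu) (h ld)))
    contra R d = true≢false (trans (sym d) (x⊕x (h ru) (h rd)))

  -- In an alternating pattern the edges up, right and down from the vertex would all be cycle
  -- edges.
  not-checker : ∀ i c x → c < n →
    inside C i (pv n (suc c)) ≡ x → inside C i (suc c) ≡ not x →
    inside C (suc i) (pv n (suc c)) ≡ not x → inside C (suc i) (suc c) ≡ x → ⊥
  not-checker i c x l e₁ e₂ e₃ e₄ = no-three (i , c) l
    (trans (cong₂ _xor_ e₁ e₂) (x⊕¬x x)) (trans (cong₂ _xor_ e₂ e₄) (¬x⊕x x)) (trans (cong₂ _xor_ e₃ e₄) (¬x⊕x x))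
    where
    x⊕¬x : ∀ x → x xor not x ≡ true
    x⊕¬x true  = refl
    x⊕¬x false = refl
    ¬x⊕x : ∀ x → not x xor x ≡ true
    ¬x⊕x true  = refl
    ¬x⊕x false = refl

  inside-bottom′ : ∀ j → InR n j → inside C (suc m) j ≡ false
  inside-bottom′ (suc c) (_ , l) = inside-bottom contractible c l

  inside-InR : ∀ {i j} → i ≤ suc m → InR n j → inside C i j ≡ true → InR m i
  inside-InR {zero} {j} _ _ e = ⊥-elim (true≢false (trans (sym e) (inside-0 j)))
  inside-InR {suc i} l rj e with ℕₚ.m≤n⇒m<n∨m≡n l
  ... | inj₁ l'   = s≤s z≤n , ℕₚ.≤-pred l'
  ... | inj₂ refl = ⊥-elim (true≢false (trans (sym e) (inside-bottom′ _ rj)))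

  -- The end level stays open: going along the cycle shows only that the windows are connected, and
  -- `sheet` settles later which level is reached.
  ConnW : ℕ × ℕ → ℕ × ℕ → Set
  ConnW (i , j) (i' , j') = ∀ k → ∃[ k' ] Path (InL C) (SAdj m n) (i , j , k) (i' , j' , k')

  ConnW-refl : ∀ {w} → InW w → ConnW w w
  ConnW-refl s k = k , here s

  ConnW-trans : ∀ {u v w} → ConnW u v → ConnW v w → ConnW u w
  ConnW-trans p q k with p k
  ... | k' , p' with q k'
  ...   | k'' , q' = k'' , p' ⊕ q'

  ConnW-sym : ∀ {u v} → ConnW u v → ConnW v u
  ConnW-sym {i , j} {i' , j'} p k with p k
  -- The reversed path starts at level `k'`; translation by `k - k'` moves this start to `k`.
  ... | k' , p' = k ℤ.+ (k ℤ.- k') ,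
    subst (λ l → Path (InL C) (SAdj m n) (i' , j' , l) (i , j , k ℤ.+ (k ℤ.- k'))) (shift-cancel k' k)
      (shiftPath {W = InW} (k ℤ.- k') (reversePath flip-SAdj p'))

  ConnW-vertical : ∀ {i j} → InW (i , j) → InW (suc i , j) → ConnW (i , j) (suc i , j)
  ConnW-vertical s s' k = k , step s vdown (here s')

  ConnW-horizontal : ∀ {i c} → c < n → InW (i , pv n (suc c)) → InW (i , suc c) →
                     ConnW (i , pv n (suc c)) (i , suc c)
  ConnW-horizontal {c = zero}  l s s' k = k ℤ.+ 1ℤ , step s (wrapR refl) (here s')
  ConnW-horizontal {c = suc c} l s s' k = k , step s (hright l) (here s')

  private
    ins : ℕ × ℕ → Bool
    ins w = inside C (proj₁ w) (proj₂ w)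

  window-InW : ∀ {v} → ValidV m n v → ∀ k → ins (window n v k) ≡ true → InW (window n v k)
  window-InW (lρ , lc) lu e = inside-InR (ℕₚ.m≤n⇒m≤1+n lρ) (pv-suc-InR lc) e , pv-suc-InR lc , e
  window-InW (lρ , lc) ru e = inside-InR (ℕₚ.m≤n⇒m≤1+n lρ) (suc-InR lc) e , suc-InR lc , e
  window-InW (lρ , lc) ld e = inside-InR (s≤s lρ) (pv-suc-InR lc) e , pv-suc-InR lc , e
  window-InW (lρ , lc) rd e = inside-InR (s≤s lρ) (suc-InR lc) e , suc-InR lc , e

  -- Only diagonal pairs are difficult; there `not-checker` provides an inside window adjacent to
  -- both.
  around-connected : ∀ v → ValidV m n v → ∀ a b → InW (window n v a) → InW (window n v b) →
                     ConnW (window n v a) (window n v b)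
  around-connected v vv = go
    where
    at : ∀ k → ins (window n v k) ≡ true → InW (window n v k)
    at = window-InW {v} vv

    top : InW (window n v lu) → InW (window n v ru) → ConnW (window n v lu) (window n v ru)
    top = ConnW-horizontal (proj₂ vv)

    bottom : InW (window n v ld) → InW (window n v rd) → ConnW (window n v ld) (window n v rd)
    bottom = ConnW-horizontal (proj₂ vv)

    left : InW (window n v lu) → InW (window n v ld) → ConnW (window n v lu) (window n v ld)
    left = ConnW-vertical

    right : InW (window n v ru) → InW (window n v rd) → ConnW (window n v ru) (window n v rd)
    right = ConnW-vertical

    falling : InW (window n v lu) → InW (window n v rd) → ConnW (window n v lu) (window n v rd)
    falling s s' with ins (window n v ru) in e | ins (window n v ld) in e'
    ... | true  | _     = ConnW-trans (top s (at ru e)) (right (at ru e) s')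
    ... | false | true  = ConnW-trans (left s (at ld e')) (bottom (at ld e') s')
    ... | false | false =
      ⊥-elim (not-checker (proj₁ v) (proj₂ v) true (proj₂ vv) (proj₂ (proj₂ s)) e e' (proj₂ (proj₂ s')))

    rising : InW (window n v ru) → InW (window n v ld) → ConnW (window n v ru) (window n v ld)
    rising s s' with ins (window n v lu) in e | ins (window n v rd) in e'
    ... | true  | _     = ConnW-trans (ConnW-sym (top (at lu e) s)) (left (at lu e) s')
    ... | false | true  = ConnW-trans (right s (at rd e')) (ConnW-sym (bottom s' (at rd e')))
    ... | false | false =
      ⊥-elim (not-checker (proj₁ v) (proj₂ v) false (proj₂ vv) e (proj₂ (proj₂ s)) (proj₂ (proj₂ s')) e')

    go : ∀ a b → InW (window n v a) → InW (window n v b) → ConnW (window n v a) (window n v b)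
    go lu lu s s' = ConnW-refl s
    go ru ru s s' = ConnW-refl s
    go ld ld s s' = ConnW-refl s
    go rd rd s s' = ConnW-refl s
    go lu ru s s' = top s s'
    go ld rd s s' = bottom s s'
    go lu ld s s' = left s s'
    go ru rd s s' = right s s'
    go lu rd s s' = falling s s'
    go ru ld s s' = rising s s'
    go ru lu s s' = ConnW-sym (top s' s)
    go rd ld s s' = ConnW-sym (bottom s' s)
    go ld lu s s' = ConnW-sym (left s' s)
    go rd ru s s' = ConnW-sym (right s' s)
    go rd lu s s' = ConnW-sym (falling s' s)
    go ld ru s s' = ConnW-sym (rising s' s)

  Shared : ℕ × ℕ → ℕ × ℕ → Set
  Shared v v' = ∃[ a ] ∃[ b ] (window n v a ≡ window n v' b × ins (window n v a) ≡ true)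

  -- A cycle edge has an inside window on one of its sides, and both ends of the edge touch that
  -- window. This chains the neighbourhoods of successive vertices.
  shared-window : ∀ {v X v'} → Step m n v X v' → ValidV m n v → diff X v ≡ true → Shared v v'
  shared-window stepU vv d with xor-true _ _ d
  ... | inj₁ e = lu , ld , refl , e
  ... | inj₂ e = ru , rd , refl , e
  shared-window (stepD _) vv d with xor-true _ _ d
  ... | inj₁ e = ld , lu , refl , e
  ... | inj₂ e = rd , ru , refl , e
  shared-window stepR vv d with xor-true _ _ d
  ... | inj₁ e = ru , lu , cong (_ ,_) (sym (pv-suc-sucMod (proj₂ vv))) , e
  ... | inj₂ e = rd , ld , cong (_ ,_) (sym (pv-suc-sucMod (proj₂ vv))) , e
  shared-window stepL vv d with xor-true _ _ d
  ... | inj₁ e = lu , ru , cong (_ ,_) (sym (suc-predMod-pv (proj₂ vv))) , e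
  ... | inj₂ e = ld , rd , cong (_ ,_) (sym (suc-predMod-pv (proj₂ vv))) , e

  private
    base : Shared (vert C 0) (vert C 1)
    base = shared-window (steps C 0 0<N) (valid C 0 0<N) (diff-move 0 0<N)

    base-corner : Corner
    base-corner = proj₁ base

    base-window : ℕ × ℕ
    base-window = window n (vert C 0) base-corner

    base-InW : InW base-window
    base-InW = window-InW {vert C 0} (valid C 0 0<N) base-corner (proj₂ (proj₂ (proj₂ base)))

    base-connected : ∀ t → t < N → ∀ b → InW (window n (vert C t) b) → ConnW base-window (window n (vert C t) b)
    base-connected zero    l b s = around-connected (vert C 0) (valid C 0 0<N) base-corner b base-InW s
    base-connected (suc t) l b s with ℕₚ.<-trans (ℕₚ.n<1+n t) l
    ... | l' with shared-window (steps C t l') (valid C t l') (diff-move t l')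
    ...   | a , b' , e , ea = ConnW-trans
      (base-connected t l' a (window-InW {vert C t} (valid C t l') a ea))
      (subst (λ w → ConnW w (window n (vert C (suc t)) b)) (sym e)
        (around-connected (vert C (suc t)) (valid C (suc t) l) b' b
          (window-InW {vert C (suc t)} (valid C (suc t) l) b' (trans (cong ins (sym e)) ea)) s))

  -- Every window has a corner on the cycle, since the cycle is Hamiltonian.
  connected : ∀ {w w'} → InW w → InW w' → ConnW w w'
  connected s s' = ConnW-trans (ConnW-sym (from-base s)) (from-base s')
    where
    from-base : ∀ {w} → InW w → ConnW base-window w
    from-base {i , suc c} s@((_ , li) , (_ , lc) , _) with covering C (i , c) (li , lc)
    ... | t , lt , e with base-connected t lt ru
    ...   | f rewrite e = f s

-- Linear coordinate of the columns of the strip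

i<j⇒i+1≤j : ∀ {i j} → i ℤ.< j → i ℤ.+ 1ℤ ℤ.≤ j
i<j⇒i+1≤j {i} {j} l = subst (ℤ._≤ j) (ℤₚ.+-comm 1ℤ i) (ℤₚ.i<j⇒suc[i]≤j l)

abstract
  -- Serves for cell columns and for grid lines: line `X n c k` is the right edge of column
  -- `X n c k` and carries a lift of vertex column `c`. For this reason the first index may also be
  -- 0.
  X : ℕ → ℕ → ℤ → ℤ
  X n j k = + j ℤ.+ + n ℤ.* k

  X-suc : ∀ n j k → X n (suc j) k ≡ ℤ.suc (X n j k)
  X-suc n j k = lem (+ j) (+ n) k
    where
    lem : ∀ a b k → 1ℤ ℤ.+ a ℤ.+ b ℤ.* k ≡ 1ℤ ℤ.+ (a ℤ.+ b ℤ.* k)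
    lem = solve-∀

  X-wrap : ∀ n k → X n 1 (k ℤ.+ 1ℤ) ≡ ℤ.suc (X n n k)
  X-wrap n k = lem (+ n) k
    where
    lem : ∀ a k → 1ℤ ℤ.+ a ℤ.* (k ℤ.+ 1ℤ) ≡ 1ℤ ℤ.+ (a ℤ.+ a ℤ.* k)
    lem = solve-∀

  X-mono-roll : ∀ n {j j' k k'} → j ≤ n → 1 ≤ j' → k ℤ.< k' → X n j k ℤ.< X n j' k'
  X-mono-roll n {j} {j'} {k} {k'} lj lj' lk = begin-strict
    + j ℤ.+ + n ℤ.* k          ≤⟨ ℤₚ.+-monoˡ-≤ (+ n ℤ.* k) (ℤ.+≤+ lj) ⟩
    + n ℤ.+ + n ℤ.* k ≡⟨ lem (+ n) k ⟩
    + n ℤ.* (k ℤ.+ 1ℤ)         ≤⟨ ℤₚ.*-monoˡ-≤-nonNeg (+ n) (i<j⇒i+1≤j lk) ⟩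
    + n ℤ.* k' ≡⟨ sym (ℤₚ.+-identityˡ _) ⟩
    0ℤ ℤ.+ + n ℤ.* k'          <⟨ ℤₚ.+-monoˡ-< (+ n ℤ.* k') (ℤ.+<+ lj') ⟩
    + j' ℤ.+ + n ℤ.* k' ∎
    where
    open ℤₚ.≤-Reasoning
    lem : ∀ a k → a ℤ.+ a ℤ.* k ≡ a ℤ.* (k ℤ.+ 1ℤ)
    lem = solve-∀

  X-mono-col : ∀ n {j j'} k → j < j' → X n j k ℤ.< X n j' k
  X-mono-col n k l = ℤₚ.+-monoˡ-< (+ n ℤ.* k) (ℤ.+<+ l)

  X-sucMod : ∀ {n c} → c < n → ∀ k → ∃[ k' ] ℤ.suc (X n c k) ≡ X n (sucMod n c) k'
  X-sucMod {n} {c} l k with <-split l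
  ... | inj₁ l'   rewrite sucMod-< l' = k , sym (X-suc n c k)
  ... | inj₂ refl rewrite sucMod-≡ c  = k ℤ.+ 1ℤ , lem (+ c) k
    where
    lem : ∀ c k → 1ℤ ℤ.+ (c ℤ.+ (1ℤ ℤ.+ c) ℤ.* k) ≡ 0ℤ ℤ.+ (1ℤ ℤ.+ c) ℤ.* (k ℤ.+ 1ℤ)
    lem = solve-∀

  X-sucMod⁻¹ : ∀ {n c} → c < n → ∀ k' → ∃[ k ] X n (sucMod n c) k' ≡ ℤ.suc (X n c k)
  X-sucMod⁻¹ {n} {c} l k' with <-split l
  ... | inj₁ l'   rewrite sucMod-< l' = k' , X-suc n c k'
  ... | inj₂ refl rewrite sucMod-≡ c  = k' ℤ.- 1ℤ , lem (+ c) k'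
    where
    lem : ∀ c k → 0ℤ ℤ.+ (1ℤ ℤ.+ c) ℤ.* k ≡ 1ℤ ℤ.+ (c ℤ.+ (1ℤ ℤ.+ c) ℤ.* (k ℤ.- 1ℤ))
    lem = solve-∀

  X-last : ∀ n k → X n n k ≡ X n 0 (k ℤ.+ 1ℤ)
  X-last n k = lem (+ n) k
    where
    lem : ∀ a k → a ℤ.+ a ℤ.* k ≡ 0ℤ ℤ.+ a ℤ.* (k ℤ.+ 1ℤ)
    lem = solve-∀

X-injective : ∀ {n j k j' k'} → InR n j → InR n j' → X n j k ≡ X n j' k' → j ≡ j' × k ≡ k'
X-injective {n} {j} {k} {j'} {k'} (a , b) (c , d) e with ℤₚ.<-cmp k k'
... | tri< l _ _ = ⊥-elim (ℤₚ.<-irrefl e (X-mono-roll n b c l))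
... | tri> _ _ l = ⊥-elim (ℤₚ.<-irrefl (sym e) (X-mono-roll n d a l))
... | tri≈ _ refl _ with ℕₚ.<-cmp j j'
...   | tri< l _ _ = ⊥-elim (ℤₚ.<-irrefl e (X-mono-col n k l))
...   | tri> _ _ l = ⊥-elim (ℤₚ.<-irrefl (sym e) (X-mono-col n k l))
...   | tri≈ _ refl _ = refl , refl

X<⇒ : ∀ {n j k j' k'} → InR n j → InR n j' → X n j k ℤ.< X n j' k' → k ℤ.< k' ⊎ (k ≡ k' × j < j')
X<⇒ {n} {j} {k} {j'} {k'} (a , b) (c , d) lx with ℤₚ.<-cmp k k'
... | tri< l _ _ = inj₁ l
... | tri> _ _ l = ⊥-elim (ℤₚ.<-asym lx (X-mono-roll n d a l))
... | tri≈ _ refl _ with ℕₚ.<-cmp j j'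
...   | tri< l _ _ = inj₂ (refl , l)
...   | tri> _ _ l = ⊥-elim (ℤₚ.<-asym lx (X-mono-col n k l))
...   | tri≈ _ refl _ = ⊥-elim (ℤₚ.<-irrefl refl lx)

-- Roll numbers

castPath : ∀ {m n S x i j k k'} → k ≡ k' → Path S (SAdj m n) x (i , j , k) → Path S (SAdj m n) x (i , j , k')
castPath refl p = p

module Rolls {m n : ℕ} (1≤m : 1 ≤ m) (2≤n : 2 ≤ n) (C : HamCycle m n) (contractible : Contractible C)
  (r : ℕ → ℕ → ℤ)
  (inRoll : ∀ i j → InR m i → InR n j → inside C i j ≡ true → IsRoll C i j (r i j)) where
  open Interior 1≤m 2≤n C contractible public

  IPath : Cell → Cell → Set
  IPath = Path (InL C) (SAdj m n)

  shiftI : ∀ l {i j k i' j' k'} → IPath (i , j , k) (i' , j' , k') → IPath (i , j , k ℤ.+ l) (i' , j' , k' ℤ.+ l)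
  shiftI = shiftPath {W = InW}

  reverseI : ∀ {x y} → IPath x y → IPath y x
  reverseI = reversePath flip-SAdj

  roll-transport : ∀ {i j ρ i' j' ρ'} → IPath (i , j , ρ) (i' , j' , ρ') → IsRoll C i j ρ → IsRoll C i' j' ρ'
  roll-transport p (q0 , v , p0 , least) = q0 , v , p0 ⊕ p , λ q' k' p' → least q' k' (p' ⊕ reverseI p)

  -- Translation by `ρ' - ρ` carries the copy belonging to `ρ` onto the one belonging to `ρ'`. It
  -- moves a top window from level 0 to level `ρ' - ρ`, which cannot be negative because the second
  -- copy has no top window at a negative level.
  roll-≤ : ∀ {i j ρ ρ'} → IsRoll C i j ρ → IsRoll C i j ρ' → ρ ℤ.≤ ρ'
  roll-≤ {i} {j} {ρ} {ρ'} (q , v , p , _) (_ , _ , _ , least)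
    with least q (0ℤ ℤ.+ (ρ' ℤ.- ρ)) (castPath (shift-cancel ρ ρ') (shiftI (ρ' ℤ.- ρ) p))
  ... | inj₁ l       = ℤₚ.0≤i-j⇒j≤i (ℤₚ.<⇒≤ (subst (0ℤ ℤ.<_) (ℤₚ.+-identityˡ _) l))
  ... | inj₂ (e , _) = ℤₚ.0≤i-j⇒j≤i (ℤₚ.≤-reflexive (sym (trans (sym (ℤₚ.+-identityˡ _)) e)))

  roll-unique : ∀ {i j ρ ρ'} → IsRoll C i j ρ → IsRoll C i j ρ' → ρ ≡ ρ'
  roll-unique a b = ℤₚ.≤-antisym (roll-≤ a b) (roll-≤ b a)

  cell : ℕ → ℕ → Cell
  cell i j = i , j , r i j

  -- By `roll-unique` the copy of the interior in the basis meets each window at one level only, so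
  -- a path that starts in this copy has no choice of levels.
  sheet : ∀ {i j i' j' k'} → IPath (cell i j) (i' , j' , k') → k' ≡ r i' j'
  sheet {i} {j} {i'} {j'} p with path-start p | path-end p
  ... | (ri , rj , e) | (ri' , rj' , e') =
    roll-unique (roll-transport p (inRoll i j ri rj e)) (inRoll i' j' ri' rj' e')

  lift : ∀ {i j i' j'} → InW (i , j) → InW (i' , j') → IPath (cell i j) (cell i' j')
  lift {i} {j} s s' with connected s s' (r i j)
  ... | k' , p = castPath (sheet p) p

  roll-vertical : ∀ {i j} → InW (i , j) → InW (suc i , j) → r i j ≡ r (suc i) j
  roll-vertical s s' = sheet (step s vdown (here s'))

  roll-right : ∀ {i j} → suc j ≤ n → InW (i , j) → InW (i , suc j) → r i j ≡ r i (suc j)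
  roll-right l s s' = sheet (step s (hright l) (here s'))

  roll-wrap : ∀ {i} → InW (i , n) → InW (i , 1) → r i n ℤ.+ 1ℤ ≡ r i 1
  roll-wrap s s' = sheet (step s (wrapR refl) (here s'))

-- Signed crossing numbers of paths in the strip

le : ℕ → ℕ → ℤ
le ρ i = bit (i <ᵇ suc ρ)

row : ℕ → ℕ → ℤ
row ρ i = bit (i ≡ᵇ ρ)

le-suc : ∀ ρ i → le (suc ρ) i ≡ le ρ i ℤ.+ row (suc ρ) i
le-suc ρ       zero          = refl
le-suc zero    (suc zero)    = refl
le-suc zero    (suc (suc i)) = refl
le-suc (suc ρ) (suc i)       = le-suc ρ i

le-difference : ∀ ρ i → le ρ (suc i) ℤ.- le ρ i ≡ ℤ.- row ρ i
le-difference zero    zero    = refl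
le-difference zero    (suc i) = refl
le-difference (suc ρ) zero    = refl
le-difference (suc ρ) (suc i) = le-difference ρ i

le-true : ∀ {ρ i} → i ≤ ρ → le ρ i ≡ 1ℤ
le-true l rewrite <ᵇ-true (s≤s l) = refl

le-false : ∀ {ρ i} → ρ < i → le ρ i ≡ 0ℤ
le-false {zero}  {suc i} l       = refl
le-false {suc ρ} {suc i} (s≤s l) = le-false l

row-≢ : ∀ ρ i → i ≢ ρ → row ρ i ≡ 0ℤ
row-≢ ρ i ne rewrite ≡ᵇ-≢ i ρ ne = refl

row-refl : ∀ ρ → row ρ ρ ≡ 1ℤ
row-refl ρ rewrite ≡ᵇ-refl ρ = refl

suc-injectiveℤ : ∀ {i j} → ℤ.suc i ≡ ℤ.suc j → i ≡ j
suc-injectiveℤ {i} {j} e = trans (sym (lem i)) (trans (cong (λ z → z ℤ.- 1ℤ) e) (lem j))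
  where
  lem : ∀ i → 1ℤ ℤ.+ i ℤ.- 1ℤ ≡ i
  lem = solve-∀

abstract
  δ : ℤ → ℤ → ℤ
  δ s x with x ℤₚ.≟ s
  ... | yes _ = 1ℤ
  ... | no  _ = 0ℤ

  δ-refl : ∀ s → δ s s ≡ 1ℤ
  δ-refl s with s ℤₚ.≟ s
  ... | yes _ = refl
  ... | no  n = ⊥-elim (n refl)

  δ-≢ : ∀ {s x} → x ≢ s → δ s x ≡ 0ℤ
  δ-≢ {s} {x} ne with x ℤₚ.≟ s
  ... | yes e = ⊥-elim (ne e)
  ... | no  _ = refl

  δ-suc : ∀ s x → δ (ℤ.suc s) (ℤ.suc x) ≡ δ s x
  δ-suc s x with x ℤₚ.≟ s
  ... | yes refl = δ-refl (ℤ.suc s)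
  ... | no  ne   = δ-≢ (λ e → ne (suc-injectiveℤ e))

-- Unites `hright` and `wrapR`, so that arguments about a step to the right need no separate case at
-- the seam.
data Next (n : ℕ) : ℕ → ℤ → ℕ → ℤ → Set where
  nright : ∀ {j k} → suc j ≤ n → Next n j k (suc j) k
  nwrap  : ∀ {k} → Next n n k 1 (k ℤ.+ 1ℤ)

X-next : ∀ {n j k j' k'} → Next n j k j' k' → X n j' k' ≡ ℤ.suc (X n j k)
X-next {n} {j} {k} (nright _)  = X-suc n j k
X-next {n} {k = k} nwrap       = X-wrap n k

module _ {m n : ℕ} where

  -- An edge weight supported on horizontal steps: `g` is evaluated at the grid line that is
  -- crossed, which has the coordinate of the column to its left, and leftward steps count
  -- negatively. `ver` is the analogue with the upper of the two rows.
  hor : (ℕ → ℤ) → (ℤ → ℤ) → ∀ {x y} → SAdj m n x y → ℤ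
  hor f g vdown                  = 0ℤ
  hor f g vup                    = 0ℤ
  hor f g (hright {i} {j} {k} _) = f i ℤ.* g (X n j k)
  hor f g (hleft {i} {j} {k} _)  = ℤ.- (f i ℤ.* g (X n j k))
  hor f g (wrapR {i} {k} _)      = f i ℤ.* g (X n n k)
  hor f g (wrapL {i} {k} _)      = ℤ.- (f i ℤ.* g (X n n k))

  ver : (ℕ → ℤ) → (ℤ → ℤ) → ∀ {x y} → SAdj m n x y → ℤ
  ver f g (vdown {i} {j} {k}) = f i ℤ.* g (X n j k)
  ver f g (vup {i} {j} {k})   = ℤ.- (f i ℤ.* g (X n j k))
  ver f g (hright _)          = 0ℤ
  ver f g (hleft _)           = 0ℤ
  ver f g (wrapR _)           = 0ℤ
  ver f g (wrapL _)           = 0ℤ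

  potential : (ℕ → ℤ) → (ℤ → ℤ) → Cell → ℤ
  potential f g (i , j , k) = f i ℤ.* g (X n j k)

  -- A discrete Stokes formula: moving the line by one column changes the weight of an edge by the
  -- difference of a potential, minus a vertical weight with the derivative of `f`.
  flux-step : ∀ f g {x y} (a : SAdj m n x y) → hor f (λ z → g (ℤ.suc z)) a
    ≡ hor f g a ℤ.+ (potential f g y ℤ.- potential f g x) ℤ.- ver (λ i → f (suc i) ℤ.- f i) g a
  flux-step f g (vdown {i} {j} {k}) = lem (f i) (f (suc i)) (g (X n j k))
    where
    lem : ∀ a b c → 0ℤ ≡ 0ℤ ℤ.+ (b ℤ.* c ℤ.- a ℤ.* c) ℤ.- (b ℤ.- a) ℤ.* c
    lem = solve-∀
  flux-step f g (vup {i} {j} {k}) = lem (f i) (f (suc i)) (g (X n j k))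
    where
    lem : ∀ a b c → 0ℤ ≡ 0ℤ ℤ.+ (a ℤ.* c ℤ.- b ℤ.* c) ℤ.- ℤ.- ((b ℤ.- a) ℤ.* c)
    lem = solve-∀
  flux-step f g (hright {i} {j} {k} _) rewrite X-suc n j k = lem (f i) (g (X n j k)) (g (ℤ.suc (X n j k)))
    where
    lem : ∀ a b c → a ℤ.* c ≡ a ℤ.* b ℤ.+ (a ℤ.* c ℤ.- a ℤ.* b) ℤ.- 0ℤ
    lem = solve-∀
  flux-step f g (hleft {i} {j} {k} _) rewrite X-suc n j k = lem (f i) (g (X n j k)) (g (ℤ.suc (X n j k)))
    where
    lem : ∀ a b c → ℤ.- (a ℤ.* c) ≡ ℤ.- (a ℤ.* b) ℤ.+ (a ℤ.* b ℤ.- a ℤ.* c) ℤ.- 0ℤ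
    lem = solve-∀
  flux-step f g (wrapR {i} {k} refl) rewrite X-wrap n k = lem (f i) (g (X n n k)) (g (ℤ.suc (X n n k)))
    where
    lem : ∀ a b c → a ℤ.* c ≡ a ℤ.* b ℤ.+ (a ℤ.* c ℤ.- a ℤ.* b) ℤ.- 0ℤ
    lem = solve-∀
  flux-step f g (wrapL {i} {k} refl) rewrite X-wrap n k = lem (f i) (g (X n n k)) (g (ℤ.suc (X n n k)))
    where
    lem : ∀ a b c → ℤ.- (a ℤ.* c) ≡ ℤ.- (a ℤ.* b) ℤ.+ (a ℤ.* b ℤ.- a ℤ.* c) ℤ.- 0ℤ
    lem = solve-∀

  hor-le-suc : ∀ ρ g {x y} (a : SAdj m n x y) → hor (le (suc ρ)) g a ≡ hor (le ρ) g a ℤ.+ hor (row (suc ρ)) g a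
  hor-le-suc ρ g vdown = refl
  hor-le-suc ρ g vup   = refl
  hor-le-suc ρ g (hright {i} {j} {k} _) rewrite le-suc ρ i = ℤₚ.*-distribʳ-+ (g (X n j k)) (le ρ i) _
  hor-le-suc ρ g (wrapR {i} {k} _)      rewrite le-suc ρ i = ℤₚ.*-distribʳ-+ (g (X n n k)) (le ρ i) _
  hor-le-suc ρ g (hleft {i} {j} {k} _)  rewrite le-suc ρ i = lem (le ρ i) (row (suc ρ) i) (g (X n j k))
    where
    lem : ∀ a b c → ℤ.- ((a ℤ.+ b) ℤ.* c) ≡ ℤ.- (a ℤ.* c) ℤ.+ ℤ.- (b ℤ.* c)
    lem = solve-∀
  hor-le-suc ρ g (wrapL {i} {k} _)      rewrite le-suc ρ i = lem (le ρ i) (row (suc ρ) i) (g (X n n k))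
    where
    lem : ∀ a b c → ℤ.- ((a ℤ.+ b) ℤ.* c) ≡ ℤ.- (a ℤ.* c) ℤ.+ ℤ.- (b ℤ.* c)
    lem = solve-∀

  module _ {S : Cell → Set} where

    -- Net number of rightward crossings, in rows at most ρ, of the line to the right of column s
    κ : ℕ → ℤ → ∀ {x y} → Path S (SAdj m n) x y → ℤ
    κ ρ s = tot (hor (le ρ) (δ s))

    crossing : ℕ → ℤ → ∀ {x y} → Path S (SAdj m n) x y → ℤ
    crossing ρ s = tot (hor (row ρ) (δ s))

    crossing-down : ℕ → ℤ → ∀ {x y} → Path S (SAdj m n) x y → ℤ
    crossing-down ρ s = tot (ver (row ρ) (δ s))

    κ-row : ∀ ρ s {x y} (p : Path S (SAdj m n) x y) → κ (suc ρ) s p ≡ κ ρ s p ℤ.+ crossing (suc ρ) s p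
    κ-row ρ s p = trans (tot-cong _ (λ a → hor (le ρ) (δ s) a ℤ.+ hor (row (suc ρ)) (δ s) a)
                          (λ a _ _ → hor-le-suc ρ (δ s) a) p)
                        (tot-+ (hor (le ρ) (δ s)) (hor (row (suc ρ)) (δ s)) p)

    -- Conservation in the part of column `suc s` from the top to row `ρ`: the net flow in from the
    -- left equals the net flow out to the right, plus what ends there minus what starts there, plus
    -- the net flow down through its bottom.
    κ-column : ∀ ρ s {x y} (p : Path S (SAdj m n) x y) → κ ρ s p ≡
      κ ρ (ℤ.suc s) p ℤ.+ (potential (le ρ) (δ (ℤ.suc s)) y ℤ.- potential (le ρ) (δ (ℤ.suc s)) x)
        ℤ.+ crossing-down ρ (ℤ.suc s) p
    κ-column ρ s {x} {y} p = begin
      tot (hor (le ρ) (δ s)) p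
        ≡⟨ tot-cong _ _ (λ a _ _ → perStep a) p ⟩
      tot (λ {x} {y} a → hor (le ρ) g a ℤ.+ (potential (le ρ) g y ℤ.- potential (le ρ) g x) ℤ.+ ver (row ρ) g a) p
        ≡⟨ tot-+ (λ {x} {y} a → hor (le ρ) g a ℤ.+ (potential (le ρ) g y ℤ.- potential (le ρ) g x)) (ver (row ρ) g) p ⟩
      tot (λ {x} {y} a → hor (le ρ) g a ℤ.+ (potential (le ρ) g y ℤ.- potential (le ρ) g x)) p ℤ.+ crossing-down ρ (ℤ.suc s) p
        ≡⟨ cong (λ z → z ℤ.+ crossing-down ρ (ℤ.suc s) p)
             (trans (tot-+ (hor (le ρ) g) (λ {x} {y} _ → potential (le ρ) g y ℤ.- potential (le ρ) g x) p)
                    (cong (λ z → κ ρ (ℤ.suc s) p ℤ.+ z) (tot-telescope (potential (le ρ) g) p))) ⟩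
      κ ρ (ℤ.suc s) p ℤ.+ (potential (le ρ) g y ℤ.- potential (le ρ) g x) ℤ.+ crossing-down ρ (ℤ.suc s) p ∎
      where
      open ≡-Reasoning
      g : ℤ → ℤ
      g = δ (ℤ.suc s)
      hor-δ : ∀ {x y} (a : SAdj m n x y) → hor (le ρ) (δ s) a ≡ hor (le ρ) (λ z → g (ℤ.suc z)) a
      hor-δ vdown = refl
      hor-δ vup = refl
      hor-δ (hright {i} {j} {k} _) = cong (λ z → le ρ i ℤ.* z) (sym (δ-suc s (X n j k)))
      hor-δ (hleft {i} {j} {k} _)  = cong (λ z → ℤ.- (le ρ i ℤ.* z)) (sym (δ-suc s (X n j k)))
      hor-δ (wrapR {i} {k} _)      = cong (λ z → le ρ i ℤ.* z) (sym (δ-suc s (X n n k)))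
      hor-δ (wrapL {i} {k} _)      = cong (λ z → ℤ.- (le ρ i ℤ.* z)) (sym (δ-suc s (X n n k)))
      ver-Δ : ∀ {x y} (a : SAdj m n x y) → ℤ.- ver (λ i → le ρ (suc i) ℤ.- le ρ i) g a ≡ ver (row ρ) g a
      ver-Δ (vdown {i} {j} {k}) rewrite le-difference ρ i = lem (row ρ i) (g (X n j k))
        where
        lem : ∀ a b → ℤ.- (ℤ.- a ℤ.* b) ≡ a ℤ.* b
        lem = solve-∀
      ver-Δ (vup {i} {j} {k}) rewrite le-difference ρ i = lem (row ρ i) (g (X n j k))
        where
        lem : ∀ a b → ℤ.- ℤ.- (ℤ.- a ℤ.* b) ≡ ℤ.- (a ℤ.* b)
        lem = solve-∀
      ver-Δ (hright _) = refl
      ver-Δ (hleft _)  = refl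
      ver-Δ (wrapR _)  = refl
      ver-Δ (wrapL _)  = refl
      perStep : ∀ {x y} (a : SAdj m n x y) → hor (le ρ) (δ s) a ≡
        hor (le ρ) g a ℤ.+ (potential (le ρ) g y ℤ.- potential (le ρ) g x) ℤ.+ ver (row ρ) g a
      perStep {x} {y} a = trans (hor-δ a) (trans (flux-step (le ρ) g a)
        (cong (λ z → hor (le ρ) g a ℤ.+ (potential (le ρ) g y ℤ.- potential (le ρ) g x) ℤ.+ z) (ver-Δ a)))

    vanish : ∀ ρ s i {j k} → (i ≡ ρ → X n j k ≡ s → ⊥) → row ρ i ℤ.* δ s (X n j k) ≡ 0ℤ
    vanish ρ s i {j} {k} h with i ℕₚ.≟ ρ
    ... | no  ne = trans (cong (λ z → z ℤ.* δ s (X n j k)) (row-≢ ρ i ne)) refl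
    ... | yes e  = trans (cong (λ z → row ρ i ℤ.* z) (δ-≢ (h e))) (ℤₚ.*-zeroʳ (row ρ i))

    crossing-zero : ∀ ρ s → (∀ {j k j' k'} → Next n j k j' k' → S (ρ , j , k) → S (ρ , j' , k') → X n j k ≢ s) →
                    ∀ {x y} (p : Path S (SAdj m n) x y) → crossing ρ s p ≡ 0ℤ
    crossing-zero ρ s h = tot-zero _ perStep
      where
      perStep : ∀ {x y} (a : SAdj m n x y) → S x → S y → hor (row ρ) (δ s) a ≡ 0ℤ
      perStep vdown a b = refl
      perStep vup   a b = refl
      perStep (hright {i} {j} {k} l) a b = vanish ρ s i {j} {k} (λ { refl → h (nright l) a b })
      perStep (hleft {i} {j} {k} l)  a b = cong ℤ.-_ (vanish ρ s i {j} {k} (λ { refl → h (nright l) b a }))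
      perStep (wrapR {i} {k} refl)   a b = vanish ρ s i {n} {k} (λ { refl → h nwrap a b })
      perStep (wrapL {i} {k} refl)   a b = cong ℤ.-_ (vanish ρ s i {n} {k} (λ { refl → h nwrap b a }))

    crossing-down-zero : ∀ ρ s → (∀ {j k} → S (ρ , j , k) → S (suc ρ , j , k) → X n j k ≢ s) →
                         ∀ {x y} (p : Path S (SAdj m n) x y) → crossing-down ρ s p ≡ 0ℤ
    crossing-down-zero ρ s h = tot-zero _ perStep
      where
      perStep : ∀ {x y} (a : SAdj m n x y) → S x → S y → ver (row ρ) (δ s) a ≡ 0ℤ
      perStep (vdown {i} {j} {k}) a b = vanish ρ s i {j} {k} (λ { refl → h a b })
      perStep (vup {i} {j} {k})   a b = cong ℤ.-_ (vanish ρ s i {j} {k} (λ { refl → h b a }))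
      perStep (hright _) a b = refl
      perStep (hleft _)  a b = refl
      perStep (wrapR _)  a b = refl
      perStep (wrapL _)  a b = refl

    κ-0 : (∀ {j k} → ¬ S (0 , j , k)) → ∀ s {x y} (p : Path S (SAdj m n) x y) → κ 0 s p ≡ 0ℤ
    κ-0 h s = tot-zero _ perStep
      where
      perStep : ∀ {x y} (a : SAdj m n x y) → S x → S y → hor (le 0) (δ s) a ≡ 0ℤ
      perStep vdown a b = refl
      perStep vup   a b = refl
      perStep (hright {zero}  _) a b = ⊥-elim (h a)
      perStep (hright {suc i} _) a b = refl
      perStep (hleft {zero}   _) a b = ⊥-elim (h a)
      perStep (hleft {suc i}  _) a b = refl
      perStep (wrapR {zero}   _) a b = ⊥-elim (h a)
      perStep (wrapR {suc i}  _) a b = refl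
      perStep (wrapL {zero}   _) a b = ⊥-elim (h a)
      perStep (wrapL {suc i}  _) a b = refl

-- Closed paths in the interior

pv-next : ∀ {n j k j' k'} → InR n j → Next n j k j' k' → pv n j' ≡ j
pv-next {j = suc j} _ (nright l) = refl
pv-next _ nwrap = refl

module Bridges {m n : ℕ} (1≤m : 1 ≤ m) (2≤n : 2 ≤ n) (C : HamCycle m n) (contractible : Contractible C) where
  open Interior 1≤m 2≤n C contractible

  module _ {x : Cell} (W : Path (InL C) (SAdj m n) x x) where

    private
      -- All lifts of the vertex at once, since a horizontal move of the cycle may change the level.
      Inv : ℕ × ℕ → Set
      Inv v = ∀ k → κ (proj₁ v) (X n (proj₂ v) k) W ≡ 0ℤ

      -- The windows above and below a cycle edge are not both inside, so `W` makes no vertical step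
      -- there; the end terms of `κ-column` cancel because `W` is closed.
      horizontal : ∀ {ρ c} → c < n → diff R (ρ , c) ≡ true → ∀ k →
                   κ ρ (X n c k) W ≡ κ ρ (ℤ.suc (X n c k)) W
      horizontal {ρ} {c} l d k = trans (κ-column ρ s W)
        (trans (cong (λ z → κ ρ (ℤ.suc s) W ℤ.+ (p ℤ.- p) ℤ.+ z) none) (lem (κ ρ (ℤ.suc s) W) p))
        where
        s : ℤ
        s = X n c k
        p : ℤ
        p = potential {m} {n} (le ρ) (δ (ℤ.suc s)) x
        lem : ∀ a b → a ℤ.+ (b ℤ.- b) ℤ.+ 0ℤ ≡ a
        lem = solve-∀
        none : crossing-down ρ (ℤ.suc s) W ≡ 0ℤ
        none = crossing-down-zero ρ (ℤ.suc s) avoid W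
          where
          avoid : ∀ {j k'} → InL C (ρ , j , k') → InL C (suc ρ , j , k') → X n j k' ≢ ℤ.suc s
          avoid (_ , rj , e) (_ , _ , e') q
            with refl ← proj₁ (X-injective rj (suc-InR l) (trans q (sym (X-suc n c k)))) =
            true≢false (trans (sym d) (cong₂ _xor_ e e'))

      vertical : ∀ {ρ c} → c < n → diff D (ρ , c) ≡ true → ∀ k → κ (suc ρ) (X n c k) W ≡ κ ρ (X n c k) W
      vertical {ρ} {c} l d k = trans (κ-row ρ (X n c k) W)
        (trans (cong (λ z → κ ρ (X n c k) W ℤ.+ z) (crossing-zero (suc ρ) (X n c k) avoid W))
               (ℤₚ.+-identityʳ _))
        where
        avoid : ∀ {j k' j' k''} → Next n j k' j' k'' → InL C (suc ρ , j , k') → InL C (suc ρ , j' , k'') →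
                X n j k' ≢ X n c k
        avoid {j} nx (_ , rj , e) (_ , rj' , e') q
          with refl ← proj₁ (X-injective rj' (suc-InR l) (trans (X-next nx) (trans (cong ℤ.suc q) (sym (X-suc n c k))))) =
          true≢false (trans (sym d) (cong₂ _xor_ (trans (cong (inside C (suc ρ)) (pv-next rj nx)) e) e'))

      advance : ∀ {v Y v'} → Step m n v Y v' → proj₂ v < n → diff Y v ≡ true → Inv v → Inv v'
      advance stepU l d h k = trans (sym (vertical l d k)) (h k)
      advance (stepD _) l d h k = trans (vertical l d k) (h k)
      advance {ρ , c} stepR l d h k with X-sucMod⁻¹ l k
      ... | k₀ , e = trans (cong (λ s → κ ρ s W) e) (trans (sym (horizontal l d k₀)) (h k₀))
      advance {ρ , c} stepL l d h k with X-sucMod (predMod-valid l) k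
      ... | k₁ , e = trans (horizontal (predMod-valid l) d' k)
                       (trans (cong (λ s → κ ρ s W) (trans e (cong (λ z → X n z k₁) (suc-predMod l)))) (h k₁))
        where
        d' : diff R (ρ , predMod n c) ≡ true
        d' = subst (λ j → inside C ρ j xor inside C (suc ρ) j ≡ true) (sym (suc-predMod-pv l)) d

      advance* : ∀ d t → t + d ≤ N → Inv (vert C t) → Inv (vert C (t + d))
      advance* zero    t l h = subst (λ s → Inv (vert C s)) (sym (ℕₚ.+-identityʳ t)) h
      advance* (suc d) t l h = subst (λ s → Inv (vert C s)) (sym (ℕₚ.+-suc t d))
        (advance (steps C (t + d) l') (col-valid l') (diff-move (t + d) l') (advance* d t (ℕₚ.<⇒≤ l') h))
        where
        l' : t + d < N
        l' = subst (_≤ N) (ℕₚ.+-suc t d) l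

      at-0 : Inv (vert C 0)
      -- The value zero is evident only in row 0. So start when the cycle visits `(0 , 0)` and
      -- follow it to its end, which is vertex number 0 again.
      at-0 with covering C (0 , 0) (z≤n , ℕₚ.≤-trans (s≤s z≤n) 2≤n)
      ... | t , lt , e = subst Inv (closed C)
        (subst (λ s → Inv (vert C s)) (ℕₚ.m+[n∸m]≡n (ℕₚ.<⇒≤ lt))
          (advance* (N ∸ t) t (ℕₚ.≤-reflexive (ℕₚ.m+[n∸m]≡n (ℕₚ.<⇒≤ lt)))
            (subst Inv (sym e) (λ k → κ-0 (λ { ((() , _) , _) }) (X n 0 k) W))))

    -- The crossing number of W above a vertex is constant along the Hamiltonian cycle, which W never crosses.
    κ-closed : ∀ {ρ c} → ρ ≤ m → c < n → ∀ k → κ ρ (X n c k) W ≡ 0ℤ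
    κ-closed {ρ} {c} lρ lc with covering C (ρ , c) (lρ , lc)
    ... | t , lt , e = subst Inv e (advance* t 0 (ℕₚ.<⇒≤ lt) at-0)

    -- The crossing number of an edge is the difference of the values of `κ` above its two ends.
    crossing-closed : ∀ {i j} k → InR m i → InR n j → crossing i (X n j k) W ≡ 0ℤ
    crossing-closed {suc ρ} {j} k (_ , li) (_ , lj) =
      trans (lem (κ ρ (X n j k) W) (crossing (suc ρ) (X n j k) W))
        (trans (cong₂ ℤ._-_ (trans (sym (κ-row ρ (X n j k) W)) (zero-at (suc ρ) li))
                            (zero-at ρ (ℕₚ.<⇒≤ li))) refl)
      where
      lem : ∀ a b → b ≡ a ℤ.+ b ℤ.- a
      lem = solve-∀
      zero-at : ∀ ρ → ρ ≤ m → κ ρ (X n j k) W ≡ 0ℤ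
      zero-at ρ lρ with ℕₚ.m≤n⇒m<n∨m≡n lj
      ... | inj₁ l    = κ-closed lρ l k
      -- The line to the right of column `n` carries vertex column 0 of the next level.
      ... | inj₂ refl = trans (cong (λ s → κ ρ s W) (X-last n k))
                              (κ-closed lρ (ℕₚ.≤-trans (s≤s z≤n) 2≤n) (k ℤ.+ 1ℤ))

  -- One path there and the other one back form a closed path. This is acyclicity of the interior in
  -- the form in which it yields potentials.
  crossing-unique : ∀ {i j x y} k → InR m i → InR n j → (p q : Path (InL C) (SAdj m n) x y) →
                    crossing i (X n j k) p ≡ crossing i (X n j k) q
  crossing-unique {i} {j} k ri rj p q =
    trans (lem (cr' p) (cr' q⁻¹)) (trans (cong (λ z → z ℤ.- cr' q⁻¹) (trans (sum p) (sym (sum q)))) (sym (lem (cr' q) (cr' q⁻¹))))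
    where
    cr' : ∀ {x y} → Path (InL C) (SAdj m n) x y → ℤ
    cr' = crossing i (X n j k)
    q⁻¹ = reversePath flip-SAdj q
    lem : ∀ a b → a ≡ a ℤ.+ b ℤ.- b
    lem = solve-∀
    sum : ∀ p → cr' p ℤ.+ cr' q⁻¹ ≡ 0ℤ
    sum p = trans (sym (tot-⊕ _ p q⁻¹)) (crossing-closed (p ⊕ q⁻¹) k ri rj)

-- Disjoint paths in the strip

Disjoint : ℕ → (Cell → Set) → (Cell → Set) → Set
Disjoint n S T = ∀ {i j k j' k'} → S (i , j , k) → T (i , j' , k') → X n j k ≡ X n j' k' → ⊥

abstract
  gt : ℤ → ℤ → ℤ
  gt s x with s ℤₚ.<? x
  ... | yes _ = 1ℤ
  ... | no  _ = 0ℤ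

  gt-true : ∀ {s x} → s ℤ.< x → gt s x ≡ 1ℤ
  gt-true {s} {x} l with s ℤₚ.<? x
  ... | yes _ = refl
  ... | no  n = ⊥-elim (n l)

  gt-false : ∀ {s x} → x ℤ.≤ s → gt s x ≡ 0ℤ
  gt-false {s} {x} l with s ℤₚ.<? x
  ... | yes p = ⊥-elim (ℤₚ.≤⇒≯ l p)
  ... | no  _ = refl

  gt-sound : ∀ {s x} → gt s x ≡ 1ℤ → s ℤ.< x
  gt-sound {s} {x} e with s ℤₚ.<? x
  ... | yes p = p

  gt-suc : ∀ s x → gt s (ℤ.suc x) ≡ gt s x ℤ.+ δ x s
  gt-suc s x with ℤₚ.<-cmp s x
  ... | tri< l ne _ rewrite gt-true l | δ-≢ ne = gt-true (ℤₚ.<-≤-trans l (ℤₚ.i≤suc[i] x))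
  ... | tri≈ _ refl _ rewrite gt-false (ℤₚ.≤-refl {s}) | δ-refl s = gt-true (ℤₚ.suc[i]≤j⇒i<j ℤₚ.≤-refl)
  ... | tri> _ ne l rewrite gt-false (ℤₚ.<⇒≤ l) | δ-≢ ne = gt-false (ℤₚ.i<j⇒suc[i]≤j l)

module Separation {m n : ℕ} {S T : Cell → Set} (disjoint : Disjoint n S T)
  {i₁ i₂ j₁ j₂ : ℕ} {k₁ k₂ : ℤ} (P : Path S (SAdj m n) (i₁ , j₁ , k₁) (i₂ , j₂ , k₂)) where

  -- Crossings of the left edge of column `x` in rows up to `i`. The terms `source` and `target`
  -- account for an end of `P` in this column at or above row `i`.
  left : ℕ → ℤ → ℤ
  left i x = κ i (ℤ.pred x) P

  source : ℕ → ℤ → ℤ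
  source i x = le i i₁ ℤ.* δ x (X n j₁ k₁)

  target : ℕ → ℤ → ℤ
  target i x = le i i₂ ℤ.* δ x (X n j₂ k₂)

  -- To cross this line in row `suc i`, the path `P` would have to occupy the cell of `T` itself.
  left-down : ∀ {i j k} → T (suc i , j , k) → left (suc i) (X n j k) ≡ left i (X n j k)
  left-down {i} {j} {k} t = trans (κ-row i _ P)
    (trans (cong (λ z → left i (X n j k) ℤ.+ z) (crossing-zero (suc i) _ avoid P)) (ℤₚ.+-identityʳ _))
    where
    avoid : ∀ {j' k' j'' k''} → Next n j' k' j'' k'' → S (suc i , j' , k') → S (suc i , j'' , k'') →
            X n j' k' ≢ ℤ.pred (X n j k)
    avoid nx _ s e = disjoint s t (trans (X-next nx) (trans (cong ℤ.suc e) (ℤₚ.suc-pred (X n j k))))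

  left-column : ∀ {i j k} → T (i , j , k) →
    left i (X n j k) ≡ κ i (X n j k) P ℤ.+ (target i (X n j k) ℤ.- source i (X n j k))
  left-column {i} {j} {k} t = trans (κ-column i (ℤ.pred x) P)
    (trans (cong₂ ℤ._+_ (cong (λ z → κ i z P ℤ.+ (le i i₂ ℤ.* δ z (X n j₂ k₂) ℤ.- le i i₁ ℤ.* δ z (X n j₁ k₁))) (ℤₚ.suc-pred x))
                        (crossing-down-zero i _ avoid P))
           (ℤₚ.+-identityʳ _))
    where
    x : ℤ
    x = X n j k
    avoid : ∀ {j' k'} → S (i , j' , k') → S (suc i , j' , k') → X n j' k' ≢ ℤ.suc (ℤ.pred x)
    avoid s _ e = disjoint s t (trans e (ℤₚ.suc-pred x))

  module _ (F : ℤ → ℤ)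
    (F-next : ∀ {i j k j' k'} → Next n j k j' k' → T (i , j , k) → T (i , j' , k') →
              F (ℤ.suc (X n j k)) ℤ.- F (X n j k) ≡ source i (X n j k) ℤ.- target i (X n j k)) where

    -- The crossing number of P to the left of a cell, corrected for the ends of P, is constant along paths
    -- disjoint from P: this replaces the Jordan curve theorem.
    side : Cell → ℤ
    side (i , j , k) = left i (X n j k) ℤ.- F (X n j k)

    private
      side-next : ∀ {i j k j' k'} → Next n j k j' k' → T (i , j , k) → T (i , j' , k') → side (i , j' , k') ≡ side (i , j , k)
      side-next {i} {j} {k} nx t t' rewrite X-next nx = begin
        κ i (ℤ.pred (ℤ.suc x)) P ℤ.- F (ℤ.suc x) ≡⟨ cong (λ z → κ i z P ℤ.- F (ℤ.suc x)) (ℤₚ.pred-suc x) ⟩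
        κ i x P ℤ.- F (ℤ.suc x) ≡⟨ lem (κ i x P) (F (ℤ.suc x)) (F x) ⟩
        κ i x P ℤ.- F x ℤ.- (F (ℤ.suc x) ℤ.- F x) ≡⟨ cong (λ z → κ i x P ℤ.- F x ℤ.- z) (F-next nx t t') ⟩
        κ i x P ℤ.- F x ℤ.- (source i x ℤ.- target i x) ≡⟨ lem' (κ i x P) (F x) (source i x) (target i x) ⟩
        κ i x P ℤ.+ (target i x ℤ.- source i x) ℤ.- F x ≡⟨ cong (λ z → z ℤ.- F x) (sym (left-column t)) ⟩
        left i x ℤ.- F x ∎
        where
        open ≡-Reasoning
        x : ℤ
        x = X n j k
        lem : ∀ a b c → a ℤ.- b ≡ a ℤ.- c ℤ.- (b ℤ.- c)
        lem = solve-∀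
        lem' : ∀ a b c d → a ℤ.- b ℤ.- (c ℤ.- d) ≡ a ℤ.+ (d ℤ.- c) ℤ.- b
        lem' = solve-∀

    side-constant : ∀ {x y} → Path T (SAdj m n) x y → side y ≡ side x
    side-constant (here _) = refl
    side-constant (step t a q) = trans (side-constant q) (perStep a t (path-start q))
      where
      perStep : ∀ {x y} → SAdj m n x y → T x → T y → side y ≡ side x
      perStep (vdown {i} {j} {k}) t t' = cong (λ z → z ℤ.- F (X n j k)) (left-down t')
      perStep (vup {i} {j} {k})   t t' = cong (λ z → z ℤ.- F (X n j k)) (sym (left-down t))
      perStep (hright l)   t t' = side-next (nright l) t t'
      perStep (hleft l)    t t' = sym (side-next (nright l) t' t)
      perStep (wrapR refl) t t' = side-next nwrap t t'
      perStep (wrapL refl) t t' = sym (side-next nwrap t' t)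

-- In row 1 nothing of `P` lies above, so `side` reduces to the negative of the correction `gt`.
-- This correction jumps just behind the start of `P`, as it must because the start is at or above
-- every row of `T`. The end of `P` causes no jump.
separate : ∀ {m n S T jp kp je ke j k j' k'} → Disjoint n S T → (∀ {i j k} → S (i , j , k) → 1 ≤ i) →
  (∀ {i j k} → T (i , j , k) → 1 ≤ i × i ≤ m) →
  Path S (SAdj m n) (1 , jp , kp) (m , je , ke) → Path T (SAdj m n) (1 , j , k) (1 , j' , k') →
  gt (X n jp kp) (X n j' k') ≡ gt (X n jp kp) (X n j k)
separate {m} {n} {S} {T} {jp} {kp} {je} {ke} {j} {k} {j'} {k'} disjoint posS rowT P Q =
  ℤₚ.neg-injective (trans (sym (at-top (path-end Q))) (trans (side-constant (gt (X n jp kp)) gt-next Q) (at-top (path-start Q))))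
  where
  open Separation disjoint P
  gt-next : ∀ {i j k j' k'} → Next n j k j' k' → T (i , j , k) → T (i , j' , k') →
            gt (X n jp kp) (ℤ.suc (X n j k)) ℤ.- gt (X n jp kp) (X n j k) ≡ source i (X n j k) ℤ.- target i (X n j k)
  gt-next {i} {j} {k} nx t t' with rowT t
  ... | 1≤i , i≤m = begin
    gt xp (ℤ.suc x) ℤ.- gt xp x ≡⟨ cong (λ z → z ℤ.- gt xp x) (gt-suc xp x) ⟩
    gt xp x ℤ.+ δ x xp ℤ.- gt xp x ≡⟨ lem (gt xp x) (δ x xp) ⟩
    1ℤ ℤ.* δ x xp ℤ.- 0ℤ ≡⟨ sym (cong₂ (λ a b → a ℤ.* δ x xp ℤ.- b) (le-true 1≤i) (no-target i≤m t)) ⟩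
    source i x ℤ.- target i x ∎
    where
    open ≡-Reasoning
    x xp : ℤ
    x  = X n j k
    xp = X n jp kp
    lem : ∀ a b → a ℤ.+ b ℤ.- a ≡ 1ℤ ℤ.* b ℤ.- 0ℤ
    lem = solve-∀
    -- Above row `m` the end of `P` is not yet counted, and in row `m` it would share its cell with
    -- `T`.
    no-target : ∀ {i} → i ≤ m → T (i , j , k) → target i x ≡ 0ℤ
    no-target {i} i≤m t with ℕₚ.m≤n⇒m<n∨m≡n i≤m
    ... | inj₁ l    = cong (λ z → z ℤ.* δ x (X n je ke)) (le-false l)
    ... | inj₂ refl = trans (cong (λ z → le m m ℤ.* z) (δ-≢ (disjoint (path-end P) t))) (ℤₚ.*-zeroʳ (le m m))
  at-top : ∀ {j k} → T (1 , j , k) → side (gt (X n jp kp)) gt-next (1 , j , k) ≡ ℤ.- gt (X n jp kp) (X n j k)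
  at-top {j} {k} t = trans (cong (λ z → z ℤ.- gt (X n jp kp) (X n j k))
    (trans (left-down t) (κ-0 (λ s → ℕₚ.n≮0 (posS s)) _ P))) (ℤₚ.+-identityˡ _)

-- Both paths stay in a half strip and have their ends in its last column, whose right edge `P`
-- cannot cross. For a cell of that column, `side` thus counts whether `i₂` lies at or above it,
-- minus the same for `i₁`: this gives -1 at `j₁` and 0 at `j₂`.
interlace : ∀ {m n S T i₁ i₂ j₁ j₂ j k} → Disjoint n S T →
  (∀ {i j' k'} → S (i , j' , k') → X n j' k' ℤ.≤ X n j k) →
  (∀ {i j' k'} → T (i , j' , k') → X n j' k' ℤ.≤ X n j k) →
  Path S (SAdj m n) (i₁ , j , k) (i₂ , j , k) → Path T (SAdj m n) (j₁ , j , k) (j₂ , j , k) →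
  i₁ < j₁ → j₁ < i₂ → i₂ < j₂ → ⊥
interlace {m} {n} {S} {T} {i₁} {i₂} {j₁} {j₂} {j} {k} disjoint boundS boundT P Q l₁ l₂ l₃ =
  0≢-1 (trans (sym (at j₂ (path-end Q) (le-true (ℕₚ.<⇒≤ (ℕₚ.<-trans l₁ (ℕₚ.<-trans l₂ l₃)))) (le-true (ℕₚ.<⇒≤ l₃))))
       (trans (side-constant (λ _ → 0ℤ) no-end Q)
              (at j₁ (path-start Q) (le-true (ℕₚ.<⇒≤ l₁)) (le-false l₂))))
  where
  open Separation disjoint P
  x : ℤ
  x = X n j k
  0≢-1 : 0ℤ ≢ -[1+ 0 ]
  0≢-1 ()
  strict : ∀ {i j' k' j'' k''} → Next n j' k' j'' k'' → T (i , j'' , k'') → x ≢ X n j' k'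
  strict nx t e = ℤₚ.<-irrefl (sym e) (ℤₚ.suc[i]≤j⇒i<j (subst (ℤ._≤ x) (X-next nx) (boundT t)))
  no-end : ∀ {i j' k' j'' k''} → Next n j' k' j'' k'' → T (i , j' , k') → T (i , j'' , k'') →
           0ℤ ℤ.- 0ℤ ≡ source i (X n j' k') ℤ.- target i (X n j' k')
  no-end {i} {j'} {k'} nx t t' rewrite δ-≢ (strict nx t') | ℤₚ.*-zeroʳ (le i i₁) | ℤₚ.*-zeroʳ (le i i₂) = refl
  last-line : ∀ i → κ i x P ≡ 0ℤ
  last-line i = tot-zero _ perStep P
    where
    beyond : ∀ {i' j' k' j'' k''} → Next n j' k' j'' k'' → S (i' , j'' , k'') → le i i' ℤ.* δ x (X n j' k') ≡ 0ℤ
    beyond {i'} nx s = trans (cong (λ z → le i i' ℤ.* z) (δ-≢ (λ e → ℤₚ.<-irrefl e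
      (ℤₚ.suc[i]≤j⇒i<j (subst (ℤ._≤ x) (X-next nx) (boundS s)))))) (ℤₚ.*-zeroʳ (le i i'))
    perStep : ∀ {y z} (a : SAdj m n y z) → S y → S z → hor (le i) (δ x) a ≡ 0ℤ
    perStep vdown        a b = refl
    perStep vup          a b = refl
    perStep (hright l)   a b = beyond (nright l) b
    perStep (hleft l)    a b = cong ℤ.-_ (beyond (nright l) a)
    perStep (wrapR refl) a b = beyond nwrap b
    perStep (wrapL refl) a b = cong ℤ.-_ (beyond nwrap a)
  at : ∀ i {b} → T (i , j , k) → le i i₁ ≡ 1ℤ → le i i₂ ≡ b → side (λ _ → 0ℤ) no-end (i , j , k) ≡ b ℤ.- 1ℤ
  at i {b} t e₁ e₂ = trans (cong (λ z → z ℤ.- 0ℤ) (left-column t)) (trans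
    (cong₂ (λ u v → u ℤ.+ v ℤ.- 0ℤ) (last-line i)
      (cong₂ ℤ._-_ (cong₂ ℤ._*_ e₂ (δ-refl x)) (cong₂ ℤ._*_ e₁ (δ-refl x))))
    (lem b))
    where
    lem : ∀ b → 0ℤ ℤ.+ (b ℤ.* 1ℤ ℤ.- 1ℤ ℤ.* 1ℤ) ℤ.- 0ℤ ≡ b ℤ.- 1ℤ
    lem = solve-∀

-- The split tree

liftPath : ∀ {m n W i j i' j'} → Path W (WAdj m n) (i , j) (i' , j') → ∀ k →
           ∃[ k' ] Path (Over W) (SAdj m n) (i , j , k) (i' , j' , k')
liftPath (here s) k = k , here s
liftPath (step s vdown p) k with liftPath p k
... | k' , q = k' , step s vdown q
liftPath (step s vup p) k with liftPath p k
... | k' , q = k' , step s vup q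
liftPath (step s (hright l) p) k with liftPath p k
... | k' , q = k' , step s (hright l) q
liftPath (step s (hleft l) p) k with liftPath p k
... | k' , q = k' , step s (hleft l) q
liftPath (step s wrapR p) k with liftPath p (k ℤ.+ 1ℤ)
... | k' , q = k' , step s (wrapR refl) q
liftPath (step s wrapL p) k with liftPath p (k ℤ.- 1ℤ)
... | k' , q = k' , step s (wrapL (lem k)) q
  where
  lem : ∀ k → k ≡ k ℤ.- 1ℤ ℤ.+ 1ℤ
  lem = solve-∀

columnPath : ∀ {m n S j k} u d → (∀ t → u ≤ t → t ≤ d + u → S (t , j , k)) →
             Path S (SAdj m n) (u , j , k) (d + u , j , k)
columnPath u zero    h = here (h u ℕₚ.≤-refl ℕₚ.≤-refl)
columnPath u (suc d) h = snoc (columnPath u d (λ t a b → h t a (ℕₚ.m≤n⇒m≤1+n b))) vdown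
                              (h (suc d + u) (ℕₚ.m≤n+m u (suc d)) ℕₚ.≤-refl)

columnPath-≤ : ∀ {m n S j k u v} → u ≤ v → (∀ t → u ≤ t → t ≤ v → S (t , j , k)) →
               Path S (SAdj m n) (u , j , k) (v , j , k)
columnPath-≤ {m} {n} {S} {j} {k} {u} {v} l h =
  subst (λ z → Path S (SAdj m n) (u , j , k) (z , j , k)) (ℕₚ.m∸n+n≡m l)
    (columnPath u (v ∸ u) (λ t a b → h t a (subst (t ≤_) (ℕₚ.m∸n+n≡m l) b)))

nx-< : ∀ {n j} → j < n → nx n j ≡ suc j
nx-< l rewrite <ᵇ-true l = refl

nx-n : ∀ n → nx n n ≡ 1
nx-n n rewrite <ᵇ-irrefl n = refl

nx-vertex : ∀ {n j} → InR n j → ∃[ c ] (c < n × nx n j ≡ suc c × pv n (suc c) ≡ j)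
nx-vertex {n} {suc j} (_ , l) with ℕₚ.m≤n⇒m<n∨m≡n l
... | inj₁ l'   = suc j , l' , nx-< l' , refl
... | inj₂ refl = 0 , s≤s z≤n , nx-n (suc j) , refl

inside-cases : ∀ b → b ≡ true ⊎ b ≡ false
inside-cases true  = inj₁ refl
inside-cases false = inj₂ refl

abs-≤1 : ∀ x y → x ℤ.≤ y ℤ.+ 1ℤ → y ℤ.≤ x ℤ.+ 1ℤ → ∣ x ℤ.- y ∣ ≤ 1
abs-≤1 x y l₁ l₂ = small (x ℤ.- y)
  (subst₂ ℤ._≤_ refl (lem₁ x y) (ℤₚ.+-monoˡ-≤ (ℤ.- y) l₁))
  (subst₂ ℤ._≤_ (lem₂ x y) (lem₃ x y) (ℤₚ.+-monoˡ-≤ (ℤ.- x) l₂))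
  where
  lem₁ : ∀ x y → y ℤ.+ 1ℤ ℤ.- y ≡ 1ℤ
  lem₁ = solve-∀
  lem₂ : ∀ x y → y ℤ.- x ≡ ℤ.- (x ℤ.- y)
  lem₂ = solve-∀
  lem₃ : ∀ x y → x ℤ.+ 1ℤ ℤ.- x ≡ 1ℤ
  lem₃ = solve-∀
  small : ∀ d → d ℤ.≤ 1ℤ → ℤ.- d ℤ.≤ 1ℤ → ∣ d ∣ ≤ 1
  small (+ d)    (ℤ.+≤+ l) _ = l
  small -[1+ d ] _ (ℤ.+≤+ l) = l

module SplitTree {m n : ℕ} (1≤m : 1 ≤ m) (2≤n : 2 ≤ n) (C : HamCycle m n) (contractible : Contractible C)
  (upRoot : STUpRoot11 C)
  (r : ℕ → ℕ → ℤ)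
  (inRoll : ∀ i j → InR m i → InR n j → inside C i j ≡ true → IsRoll C i j (r i j)) where
  open Rolls 1≤m 2≤n C contractible r inRoll public

  OPath : Cell → Cell → Set
  OPath = Path (Over (OutW C)) (SAdj m n)

  reverseO : ∀ {x y} → OPath x y → OPath y x
  reverseO = reversePath flip-SAdj

  1-InR : InR n 1
  1-InR = s≤s z≤n , ℕₚ.≤-trans (s≤s z≤n) 2≤n

  n-InR : InR n n
  n-InR = ℕₚ.≤-trans (s≤s z≤n) 2≤n , ℕₚ.≤-refl

  top-InR : InR m 1
  top-InR = s≤s z≤n , 1≤m

  bottom-InR : InR m m
  bottom-InR = 1≤m , ℕₚ.≤-refl

  -- The boundary vertex between the two windows would have only outside windows around it, since
  -- those of the fictitious row 0 are outside too.
  top-row : ∀ {j} → InR n j → inside C 1 j ≡ false → inside C 1 (nx n j) ≡ false → ⊥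
  top-row rj e e' with nx-vertex rj
  ... | c , lc , p , q = not-all-equal 0 c false z≤n lc λ where
    lu → inside-0 (pv n (suc c))
    ru → inside-0 (suc c)
    ld → trans (cong (inside C 1) q) e
    rd → trans (cong (inside C 1) (sym p)) e'

  bottom-row : ∀ {j} → InR n j → inside C m j ≡ false → inside C m (nx n j) ≡ false → ⊥
  bottom-row rj e e' with nx-vertex rj
  ... | c , lc , p , q = not-all-equal m c false ℕₚ.≤-refl lc λ where
    lu → trans (cong (inside C m) q) e
    ru → trans (cong (inside C m) (sym p)) e'
    ld → inside-bottom′ (pv n (suc c)) (pv-suc-InR lc)
    rd → inside-bottom′ (suc c) (suc-InR lc)

  out-11 : inside C 1 1 ≡ false
  out-11 = proj₁ upRoot

  inside-1n : inside C 1 n ≡ true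
  inside-1n with inside-cases (inside C 1 n)
  ... | inj₁ e = e
  ... | inj₂ e = ⊥-elim (top-row n-InR e (trans (cong (inside C 1) (nx-n n)) out-11))

  root-InW : InW (1 , n)
  root-InW = top-InR , n-InR , inside-1n

  -- Gives a lower end to interior paths that are to cut the strip from top to bottom.
  bottom-inside : ∃[ y ] InW (m , y)
  bottom-inside with inside-cases (inside C m 1)
  ... | inj₁ e = 1 , bottom-InR , 1-InR , e
  ... | inj₂ e with inside-cases (inside C m 2)
  ...   | inj₁ e' = 2 , bottom-InR , (s≤s z≤n , 2≤n) , e'
  ...   | inj₂ e' = ⊥-elim (bottom-row 1-InR e (trans (cong (inside C m) (nx-< 2≤n)) e'))

  neighbours : ∀ {j} → 2 ≤ j → j ≤ n → inside C 1 j ≡ false → InW (1 , j ∸ 1) × InW (1 , suc j)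
  neighbours {suc j} (s≤s 1≤j) l e = (top-InR , (1≤j , ℕₚ.<⇒≤ l) , leftIn) , right
    where
    leftIn : inside C 1 j ≡ true
    leftIn with inside-cases (inside C 1 j)
    ... | inj₁ e' = e'
    ... | inj₂ e' = ⊥-elim (top-row (1≤j , ℕₚ.<⇒≤ l) e' (trans (cong (inside C 1) (nx-< l)) e))
    right : InW (1 , suc (suc j))
    right with ℕₚ.m≤n⇒m<n∨m≡n l
    -- Column `n` is next to the up root, hence inside; so the right neighbour of an outside window
    -- stays in the same block.
    ... | inj₂ refl = ⊥-elim (top-row n-InR e (trans (cong (inside C 1) (nx-n (suc j))) out-11))
    ... | inj₁ l' with inside-cases (inside C 1 (suc (suc j)))
    ...   | inj₁ e' = top-InR , (s≤s z≤n , l') , e'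
    ...   | inj₂ e' = ⊥-elim (top-row (s≤s z≤n , l) e (trans (cong (inside C 1) (nx-< l')) e'))

  splitTree : ∀ l → ∃[ j ] ∃[ k ] OPath (1 , 1 , l) (m , j , k)
  splitTree l with proj₂ upRoot
  ... | j , p with liftPath p l
  ...   | k , q = j , k , q

  private
    in-row : ∀ i j k → InL C (i , j , k) → 1 ≤ i × i ≤ m
    in-row i j k (ri , _) = ri

    out-row : ∀ i j k → Over (OutW C) (i , j , k) → 1 ≤ i × i ≤ m
    out-row i j k (ri , _) = ri

  in-out-disjoint : ∀ i j k j' k' → InL C (i , j , k) → Over (OutW C) (i , j' , k') → X n j k ≡ X n j' k' → ⊥
  in-out-disjoint i j k j' k' (_ , rj , e) (_ , rj' , e') q
    with X-injective {n} {j} {k} {j'} {k'} rj rj' q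
  ... | refl , _ = true≢false (trans (sym e) e')

  -- Everything off one lift of the split tree, including its other lifts and the other exterior
  -- trees, so that a path may also run through gaps of a column.
  Avoid : ℤ → Cell → Set
  Avoid l (i , j , k) = InR m i × InR n j × ¬ OPath (1 , 1 , l) (i , j , k)

  inside-avoid : ∀ {l c} → InL C c → Avoid l c
  inside-avoid (ri , rj , e) = ri , rj , λ p → true≢false (trans (sym e) (proj₂ (proj₂ (path-end p))))

  splitTree-separates : ∀ l {j k j' k'} → Path (Avoid l) (SAdj m n) (1 , j , k) (1 , j' , k') →
                        gt (X n 1 l) (X n j' k') ≡ gt (X n 1 l) (X n j k)
  splitTree-separates l Q with splitTree l
  ... | j , k , P = separate {S = OPath (1 , 1 , l)} {T = Avoid l} disjoint (λ {i} {j} {k} s → proj₁ (out-row i j k (path-end s))) proj₁ (reachable P) Q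
    where
    disjoint : Disjoint n (OPath (1 , 1 , l)) (Avoid l)
    disjoint s (_ , rj' , missed) e with X-injective (proj₁ (proj₂ (path-end s))) rj' e
    ... | refl , refl = missed s

  interior-separates : ∀ c → InW (1 , c) → ∀ l {j k j' k'} → OPath (1 , j , k) (1 , j' , k') →
                       gt (X n c l) (X n j' k') ≡ gt (X n c l) (X n j k)
  interior-separates c s l Q with connected {1 , c} {m , proj₁ bottom-inside} s (proj₂ bottom-inside) l
  ... | k , P = separate {S = InL C} {T = Over (OutW C)} (λ {i} {j} {k} {j'} {k'} → in-out-disjoint i j k j' k')
    (λ {i} {j} {k} s → proj₁ (in-row i j k s)) (λ {i} {j} {k} → out-row i j k) P Q

  top-after-root : ∀ {j} → InW (1 , j) → 1 < j
  top-after-root (_ , (1≤j , _) , e) = ℕₚ.≤∧≢⇒< 1≤j λ { refl → true≢false (trans (sym e) out-11) }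

  X-root-≤ : ∀ {j l k} → InR n j → X n 1 l ℤ.< X n j k → l ℤ.≤ k
  X-root-≤ rj lt with X<⇒ 1-InR rj lt
  ... | inj₁ l         = ℤₚ.<⇒≤ l
  ... | inj₂ (refl , _) = ℤₚ.≤-refl

  X-root-< : ∀ {j l k} → InR n j → 1 < j → l ℤ.≤ k → X n 1 l ℤ.< X n j k
  X-root-< {j} {l} {k} (1≤j , _) 1<j le with ℤₚ.<-cmp l k
  ... | tri< lt _ _   = X-mono-roll n (proj₂ 1-InR) 1≤j lt
  ... | tri≈ _ refl _ = X-mono-col n l 1<j
  ... | tri> _ _ g    = ⊥-elim (ℤₚ.≤⇒≯ le g)

  X-1-> : ∀ {j l k} → InR n j → X n j k ℤ.< X n 1 l → k ℤ.< l
  X-1-> rj lt with X<⇒ rj 1-InR lt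
  ... | inj₁ l       = l
  ... | inj₂ (_ , l) = ⊥-elim (ℕₚ.<⇒≱ l (proj₁ rj))

  gt-transfer : ∀ {s x y} → gt s x ≡ gt s y → s ℤ.< y → s ℤ.< x
  gt-transfer e l = gt-sound (trans e (gt-true l))

  -- The lift of the split tree at level `k'` has its up root to the left of `(1 , j' , k')`, hence
  -- also to the left of `(1 , j , k)`. The reversed path gives the other inequality, so all top
  -- windows of a copy have the same level.
  top-roll-≤ : ∀ {j k j' k'} → IPath (1 , j , k) (1 , j' , k') → k' ℤ.≤ k
  top-roll-≤ {k' = k'} p with path-start p | path-end p
  ... | (_ , rj , _) | s'@(_ , rj' , _) =
    X-root-≤ rj (gt-transfer (sym (splitTree-separates k' (mapPath inside-avoid p)))
                             (X-root-< rj' (top-after-root s') ℤₚ.≤-refl))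

  top-roll : ∀ {j} → InW (1 , j) → r 1 j ≡ 0ℤ
  top-roll (ri , rj , e) with inRoll _ _ ri rj e
  ... | q , _ , p , _ = ℤₚ.≤-antisym (top-roll-≤ p) (top-roll-≤ (reverseI p))

  root-roll : r 1 n ≡ 0ℤ
  root-roll = top-roll {n} root-InW

  -- Reads a roll number as a position: the copy of the interior through `(i , j , k)` has its
  -- window `(1 , n)` at level `k - r i j`, and there it can be compared with the up roots.
  root : ∀ {i j} → InW (i , j) → ∀ k → IPath (1 , n , k ℤ.- r i j) (i , j , k)
  root {i} {j} s k = subst₂ (λ a b → IPath (1 , n , a) (i , j , b))
    (trans (cong (λ z → z ℤ.+ (k ℤ.- r i j)) root-roll) (ℤₚ.+-identityˡ _))
    (shift-cancel (r i j) k) (shiftI (k ℤ.- r i j) (lift {1} {n} {i} {j} root-InW s))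

  X-before-n : ∀ {k} → X n n k ℤ.< X n 1 k → ⊥
  X-before-n {k} l = ℤₚ.<-asym l (X-mono-col n k 2≤n)

  -- An interior path from `(1 , n , k)` to the bottom starts between the up roots of levels `k` and
  -- `k + 1`, and no outside path gets past it.
  out-monodromy-≤ : ∀ k k' → OPath (1 , 1 , k) (1 , 1 , k') → k' ℤ.≤ k
  out-monodromy-≤ k k' p = ℤₚ.≮⇒≥ λ l → X-before-n (gt-transfer (sym same) (X-mono-roll n ℕₚ.≤-refl ℕₚ.≤-refl l))
    where
    same : gt (X n n k) (X n 1 k') ≡ gt (X n n k) (X n 1 k)
    same = interior-separates n root-InW k p

  out-monodromy : ∀ {k k'} → OPath (1 , 1 , k) (1 , 1 , k') → k ≡ k'
  out-monodromy p = ℤₚ.≤-antisym (out-monodromy-≤ _ _ (reverseO p)) (out-monodromy-≤ _ _ p)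

  -- Both neighbours of the window are inside, and interior paths from them to the bottom are walls.
  -- The left wall forces the up root to a later level, where the right wall hides it.
  single-up-root : ∀ {j k l} → 2 ≤ j → OPath (1 , j , k) (1 , 1 , l) → ⊥
  single-up-root {suc j} {k} {l} 2≤j p = between (neighbours 2≤j (proj₂ (proj₁ (proj₂ (path-start p)))) (proj₂ (proj₂ (path-start p))))
    where
    between : InW (1 , j) × InW (1 , suc (suc j)) → ⊥
    between (s₁ , s₂) = ℤₚ.<-asym (X-mono-col n k (ℕₚ.n<1+n (suc j)))
      (gt-transfer (sym after) (X-mono-roll n (proj₂ (proj₁ (proj₂ s₂))) ℕₚ.≤-refl k<l))
      where
      before : gt (X n j k) (X n 1 l) ≡ gt (X n j k) (X n (suc j) k)
      before = interior-separates j s₁ k p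
      after : gt (X n (suc (suc j)) k) (X n 1 l) ≡ gt (X n (suc (suc j)) k) (X n (suc j) k)
      after = interior-separates (suc (suc j)) s₂ k p
      k<l : k ℤ.< l
      k<l = X-1-> (proj₁ (proj₂ s₁)) (gt-transfer before (X-mono-col n k (ℕₚ.n<1+n j)))

  module _ {k : ℕ} (rk : InR n k) where

    out-column : ∀ {u v} → 1 ≤ u → v ≤ m → u ≤ v → (∀ t → u ≤ t → t ≤ v → inside C t k ≡ false) →
                 OPath (u , k , 0ℤ) (v , k , 0ℤ)
    out-column 1≤u v≤m l h = columnPath-≤ l λ t a b → (ℕₚ.≤-trans 1≤u a , ℕₚ.≤-trans b v≤m) , rk , h t a b

    -- An outside column would be a wall between the top windows on its two sides, which have roll 0
    -- and are joined in the basis copy.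
    column-meets : 2 ≤ k → (∀ t → InR m t → inside C t k ≡ false) → ⊥
    column-meets 2≤k h = between (neighbours 2≤k (proj₂ rk) (h 1 top-InR))
      where
      k-1<k : ∀ {k} → 2 ≤ k → k ∸ 1 < k
      k-1<k (s≤s _) = ℕₚ.≤-refl
      P : OPath (1 , k , 0ℤ) (m , k , 0ℤ)
      P = out-column ℕₚ.≤-refl ℕₚ.≤-refl 1≤m (λ t a b → h t (a , b))
      between : InW (1 , k ∸ 1) × InW (1 , suc k) → ⊥
      between (s₁ , s₂) = ℤₚ.<-asym (X-mono-col n 0ℤ (k-1<k 2≤k)) (gt-transfer (sym same) (X-mono-col n 0ℤ (ℕₚ.n<1+n k)))
        where
        Q : IPath (1 , k ∸ 1 , 0ℤ) (1 , suc k , 0ℤ)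
        Q = subst₂ (λ a b → IPath (1 , k ∸ 1 , a) (1 , suc k , b)) (top-roll s₁) (top-roll s₂) (lift s₁ s₂)
        same : gt (X n k 0ℤ) (X n (suc k) 0ℤ) ≡ gt (X n k 0ℤ) (X n (k ∸ 1) 0ℤ)
        same = separate {S = Over (OutW C)} {T = InL C} (λ {i} {j} {k} {j'} {k'} a b e → in-out-disjoint i j' k' j k b a (sym e))
          (λ {i} {j} {k} s → proj₁ (out-row i j k s)) (λ {i} {j} {k} → in-row i j k) P Q

    module _ {p : ℕ} (sp : InW (p , k)) where

      -- The test path descends column `k` to row `p` and then runs through the interior to the
      -- window `(1 , n)` of that copy, at level `- r p k`. Only a lift of the split tree met above
      -- row `p` could stop it.
      first-avoid : ∀ l → (∀ t → 1 ≤ t → t < p → ¬ OPath (1 , 1 , l) (t , k , 0ℤ)) →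
                    gt (X n 1 l) (X n n (0ℤ ℤ.- r p k)) ≡ gt (X n 1 l) (X n k 0ℤ)
      first-avoid l h = splitTree-separates l
        (columnPath-≤ (proj₁ (proj₁ sp)) col ⊕ mapPath inside-avoid (reverseI (root sp 0ℤ)))
        where
        col : ∀ t → 1 ≤ t → t ≤ p → Avoid l (t , k , 0ℤ)
        col t a b with ℕₚ.m≤n⇒m<n∨m≡n b
        ... | inj₁ b'   = (a , ℕₚ.≤-trans b (proj₂ (proj₁ sp))) , rk , h t a b'
        ... | inj₂ refl = inside-avoid sp

      module _ (above-out : ∀ t → 1 ≤ t → t < p → inside C t k ≡ false) where

        to-top : ∀ t → 1 ≤ t → t < p → OPath (1 , k , 0ℤ) (t , k , 0ℤ)
        to-top t a b = out-column ℕₚ.≤-refl (ℕₚ.≤-trans (ℕₚ.<⇒≤ b) (proj₂ (proj₁ sp))) a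
                         (λ s c d → above-out s c (ℕₚ.≤-<-trans d b))

        -- The outside run above `p` belongs to no lift of the split tree, as these have no second
        -- window in row 1. The lifts of levels 0 and `- r p k` then bound the level of the root
        -- from both sides.
        first-roll : 2 ≤ k → r p k ≡ 0ℤ
        first-roll 2≤k = trans (sym (ℤₚ.neg-involutive (r p k))) (cong ℤ.-_ (trans (sym (ℤₚ.+-identityˡ _)) zero-shift))
          where
          avoid : ∀ l → gt (X n 1 l) (X n n (0ℤ ℤ.- r p k)) ≡ gt (X n 1 l) (X n k 0ℤ)
          avoid l = first-avoid l (λ t a b o → single-up-root 2≤k (to-top t a b ⊕ reverseO o))
          zero-shift : 0ℤ ℤ.- r p k ≡ 0ℤ
          zero-shift = ℤₚ.≤-antisym
            (X-root-≤ rk (gt-transfer (sym (avoid (0ℤ ℤ.- r p k))) (X-root-< n-InR 2≤n ℤₚ.≤-refl)))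
            (X-root-≤ n-InR (gt-transfer (avoid 0ℤ) (X-root-< rk 2≤k ℤₚ.≤-refl)))

        -- In column 1 the outside run hangs on the up root of level 0, so this lift alone may be
        -- passed. The lifts of levels -1 and 1 leave the levels -1 and 0 for the root.
        first-roll-1 : k ≡ 1 → r p k ≡ 0ℤ ⊎ r p k ≡ 1ℤ
        first-roll-1 refl = cases (r p 1) lower upper
          where
          avoid : ∀ l → l ≢ 0ℤ → gt (X n 1 l) (X n n (0ℤ ℤ.- r p 1)) ≡ gt (X n 1 l) (X n 1 0ℤ)
          avoid l ne = first-avoid l (λ t a b o → ne (out-monodromy (o ⊕ reverseO (to-top t a b))))
          lower : -[1+ 0 ] ℤ.≤ 0ℤ ℤ.- r p 1
          lower = X-root-≤ n-InR (gt-transfer (avoid -[1+ 0 ] (λ ())) (X-mono-roll n (proj₂ 1-InR) ℕₚ.≤-refl ℤ.-<+))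
          upper : ¬ 1ℤ ℤ.≤ 0ℤ ℤ.- r p 1
          upper l = ℤₚ.<-asym {X n 1 0ℤ} {X n 1 1ℤ} (X-mono-roll n (proj₂ 1-InR) ℕₚ.≤-refl (ℤ.+<+ (s≤s z≤n)))
            (gt-transfer (sym (avoid 1ℤ (λ ()))) (X-root-< n-InR 2≤n l))
          cases : ∀ z → -[1+ 0 ] ℤ.≤ 0ℤ ℤ.- z → ¬ 1ℤ ℤ.≤ 0ℤ ℤ.- z → z ≡ 0ℤ ⊎ z ≡ 1ℤ
          cases (+ 0) _ _ = inj₁ refl
          cases (+ 1) _ _ = inj₂ refl
          cases (+ suc (suc z)) (ℤ.-≤- ()) _
          cases -[1+ z ] _ u = ⊥-elim (u (ℤ.+≤+ (s≤s z≤n)))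

    module _ {e p : ℕ} (se : InW (e , k)) (sp : InW (p , k)) (e<p : e < p)
      (between : ∀ t → e < t → t < p → inside C t k ≡ false) where

      private
        Missed : ℤ → Set
        Missed l = ∀ t → e < t → t < p → ¬ OPath (1 , 1 , l) (t , k , 0ℤ)

        gap-avoid : ∀ l → Missed l → gt (X n 1 l) (X n n (0ℤ ℤ.- r p k)) ≡ gt (X n 1 l) (X n n (0ℤ ℤ.- r e k))
        gap-avoid l h = splitTree-separates l
          (mapPath inside-avoid (root se 0ℤ) ⊕ columnPath-≤ (ℕₚ.<⇒≤ e<p) col
            ⊕ mapPath inside-avoid (reverseI (root sp 0ℤ)))
          where
          col : ∀ t → e ≤ t → t ≤ p → Avoid l (t , k , 0ℤ)
          col t a b with ℕₚ.m≤n⇒m<n∨m≡n a | ℕₚ.m≤n⇒m<n∨m≡n b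
          ... | inj₂ refl | _         = inside-avoid se
          ... | inj₁ _    | inj₂ refl = inside-avoid sp
          ... | inj₁ a'   | inj₁ b'   =
            (ℕₚ.≤-trans (proj₁ (proj₁ se)) a , ℕₚ.≤-trans b (proj₂ (proj₁ sp))) , rk , h t a' b'

        gap-path : ∀ {t t'} → e < t → t < p → e < t' → t' < p → OPath (t , k , 0ℤ) (t' , k , 0ℤ)
        gap-path {t} {t'} a b a' b' with ℕₚ.≤-total t t'
        ... | inj₁ l = out-column (ℕₚ.≤-trans (s≤s z≤n) a) (ℕₚ.≤-trans (ℕₚ.<⇒≤ b') (proj₂ (proj₁ sp))) l
                         (λ s c d → between s (ℕₚ.≤-trans a c) (ℕₚ.≤-<-trans d b'))
        ... | inj₂ l = reverseO (out-column (ℕₚ.≤-trans (s≤s z≤n) a') (ℕₚ.≤-trans (ℕₚ.<⇒≤ b) (proj₂ (proj₁ sp))) l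
                         (λ s c d → between s (ℕₚ.≤-trans a' c) (ℕₚ.≤-<-trans d b)))

        -- The windows between e and p lie in a single exterior tree, which meets at most one copy of the split tree.
        one-missed : ∀ l l' → l ≢ l' → ¬ Missed l → ¬ Missed l' → ⊥
        one-missed l l' ne h h' = h λ t a b o → h' λ t' a' b' o' →
          ne (out-monodromy (o ⊕ gap-path a b a' b' ⊕ reverseO o'))

        -- If `y` exceeded `x + 1`, the up roots of levels `- x` and `- x - 1` would both lie
        -- between the windows `(1 , n)` of levels `- y` and `- x`. Both lifts would then meet the
        -- gap, against `one-missed`.
        close : ∀ x y → (∀ l → Missed l → gt (X n 1 l) (X n n (0ℤ ℤ.- y)) ≡ gt (X n 1 l) (X n n (0ℤ ℤ.- x))) →
                y ℤ.≤ x ℤ.+ 1ℤ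
        close x y f with y ℤₚ.≤? x ℤ.+ 1ℤ
        ... | yes l = l
        ... | no ¬l = ⊥-elim (one-missed (ℤ.- x) (ℤ.- x ℤ.- 1ℤ) (λ q → ℤₚ.i≢suc[i] (trans (lem₄ x) (trans (cong (λ z → z ℤ.+ 1ℤ) (sym q)) (ℤₚ.+-comm (ℤ.- x) 1ℤ))))
            (λ h → not-≤ (ℤ.- x) (lem₁ x) (X-root-≤ n-InR (gt-transfer (f (ℤ.- x) h)
              (X-root-< n-InR 2≤n (ℤₚ.≤-reflexive (sym (ℤₚ.+-identityˡ _)))))))
            (λ h → not-≤ (ℤ.- x ℤ.- 1ℤ) ℤₚ.≤-refl (X-root-≤ n-InR (gt-transfer (f (ℤ.- x ℤ.- 1ℤ) h)
              (X-root-< n-InR 2≤n (ℤₚ.≤-trans (lem₁ x) (ℤₚ.≤-reflexive (sym (ℤₚ.+-identityˡ _)))))))))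
          where
          lem₁ : ∀ x → ℤ.- x ℤ.- 1ℤ ℤ.≤ ℤ.- x
          lem₁ x = ℤₚ.i-j≤i (ℤ.- x) 1ℤ
          lem₂ : ∀ x → ℤ.- (x ℤ.+ 1ℤ) ≡ ℤ.- x ℤ.- 1ℤ
          lem₂ = solve-∀
          lem₄ : ∀ x → ℤ.- x ≡ ℤ.- x ℤ.- 1ℤ ℤ.+ 1ℤ
          lem₄ = solve-∀
          not-≤ : ∀ l → ℤ.- x ℤ.- 1ℤ ℤ.≤ l → l ℤ.≤ 0ℤ ℤ.- y → ⊥
          not-≤ l a b = ℤₚ.≤⇒≯ (ℤₚ.≤-trans (ℤₚ.≤-reflexive (lem₂ x)) (ℤₚ.≤-trans a (ℤₚ.≤-trans b (ℤₚ.≤-reflexive (ℤₚ.+-identityˡ _)))))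
                                (ℤₚ.neg-mono-< (ℤₚ.≰⇒> ¬l))

      gap : ∣ r e k ℤ.- r p k ∣ ≤ 1
      gap = abs-≤1 (r e k) (r p k) (close (r p k) (r e k) (λ l h → sym (gap-avoid l h))) (close (r e k) (r p k) gap-avoid)

-- The matrix of a contractible Hamiltonian cycle

searchUpTo : (P : ℕ → Set) → (∀ i → Dec (P i)) → ∀ m → (∃[ i ] (i < m × P i)) ⊎ (∀ i → i < m → ¬ P i)
searchUpTo P P? zero = inj₂ λ _ ()
searchUpTo P P? (suc m) with P? m | searchUpTo P P? m
... | yes p | _                  = inj₁ (m , ℕₚ.n<1+n m , p)
... | no _  | inj₁ (i , l , p)   = inj₁ (i , ℕₚ.m<n⇒m<1+n l , p)
... | no ¬p | inj₂ none          = inj₂ below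
  where
  below : ∀ i → i < suc m → ¬ P i
  below i l with ℕₚ.m<1+n⇒m<n∨m≡n l
  ... | inj₁ l'   = none i l'
  ... | inj₂ refl = ¬p

least : (P : ℕ → Set) → (∀ i → Dec (P i)) → ∀ i → P i → ∃[ i₀ ] (i₀ ≤ i × P i₀ × (∀ j → j < i₀ → ¬ P j))
least P P? i p = go i (ℕₚ.≤-refl) p
  where
  go : ∀ d {i} → i ≤ d → P i → ∃[ i₀ ] (i₀ ≤ i × P i₀ × (∀ j → j < i₀ → ¬ P j))
  go d {i} l p with searchUpTo P P? i
  ... | inj₂ none = i , ℕₚ.≤-refl , p , none
  go zero    {zero} l p | inj₁ (j , () , q)
  go (suc d) {i} l p | inj₁ (j , j<i , q) with go d (ℕₚ.≤-pred (ℕₚ.≤-trans j<i l)) q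
  ... | i₀ , l₀ , rest = i₀ , ℕₚ.≤-trans l₀ (ℕₚ.<⇒≤ j<i) , rest

next-adj : ∀ {m n i j k j' k'} → Next n j k j' k' → SAdj m n (i , j , k) (i , j' , k')
next-adj (nright l) = hright l
next-adj nwrap      = wrapR refl

Next-unique : ∀ {n j k j' k' k''} → Next n j k j' k' → Next n j k j' k'' → k' ≡ k''
Next-unique (nright _) (nright _) = refl
Next-unique (nright l) nwrap      = ⊥-elim (ℕₚ.<-irrefl refl l)
Next-unique nwrap      (nright l) = ⊥-elim (ℕₚ.<-irrefl refl l)
Next-unique nwrap      nwrap      = refl

Next-nx : ∀ {n j k j' k'} → Next n j k j' k' → j' ≡ nx n j
Next-nx (nright l)      = sym (nx-< l)
Next-nx {n} nwrap       = sym (nx-n n)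

Next-prev : ∀ {n j z k ρ} → 2 ≤ k → Next n j z k ρ → j ≡ k ∸ 1 × z ≡ ρ
Next-prev _ (nright _)   = refl , refl
Next-prev (s≤s ()) nwrap

Next-prev-1 : ∀ {n j z ρ} → InR n j → Next n j z 1 ρ → j ≡ n × z ≡ ρ ℤ.- 1ℤ
Next-prev-1 (() , _) (nright _)
Next-prev-1 {z = z} _ nwrap = refl , lem z
  where
  lem : ∀ z → z ≡ z ℤ.+ 1ℤ ℤ.- 1ℤ
  lem = solve-∀

nx-InR : ∀ {n j} → InR n j → InR n (nx n j)
nx-InR rj with nx-vertex rj
... | c , lc , e , _ = subst (InR _) (sym e) (suc-InR lc)

pv-InR : ∀ {n k} → InR n k → InR n (pv n k)
pv-InR {k = suc c} (_ , l) = pv-suc-InR l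

module Matrix {m n : ℕ} (1≤m : 1 ≤ m) (2≤n : 2 ≤ n) (C : HamCycle m n) (contractible : Contractible C)
  (upRoot : STUpRoot11 C) (b : ℕ → ℕ → ℕ) (r : ℕ → ℕ → ℤ) (isB : IsB C b r) where
  open IsB isB public
  open SplitTree 1≤m 2≤n C contractible upRoot r inRoll public
  open Conclusions m n b r public

  ins-a : ∀ {i j} → InR m i → InR n j → a i j ≡ 1 → inside C i j ≡ true
  ins-a {i} {j} ri rj e with inside-cases (inside C i j)
  ... | inj₁ t = t
  ... | inj₂ f with () ← trans (sym e) (cong (λ z → if z ≡ᵇ 0 then 0 else 1) (proj₁ (outZero i j ri rj f)))

  out-a : ∀ {i j} → InR m i → InR n j → a i j ≡ 0 → inside C i j ≡ false
  out-a {i} {j} ri rj e with inside-cases (inside C i j)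
  ... | inj₂ f = f
  ... | inj₁ t = ⊥-elim (two (b i j) (inLabel i j ri rj t) e)
    where
    two : ∀ x → 2 ≤ x → (if x ≡ᵇ 0 then 0 else 1) ≢ 0
    two (suc x) _ ()

  in-a : ∀ i j → InW (i , j) → a i j ≡ 1
  in-a i j (ri , rj , t) = two (b i j) (inLabel i j ri rj t)
    where
    two : ∀ x → 2 ≤ x → (if x ≡ᵇ 0 then 0 else 1) ≡ 1
    two (suc x) _ = refl

  a-InW : ∀ i j → InR m i → InR n j → a i j ≡ 1 → InW (i , j)
  a-InW i j ri rj e = ri , rj , ins-a ri rj e

  b-InW : ∀ i j → InR m i → InR n j → b i j ≢ 0 → InW (i , j)
  b-InW i j ri rj ne with inside-cases (inside C i j)
  ... | inj₁ t = ri , rj , t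
  ... | inj₂ f = ⊥-elim (ne (proj₁ (outZero i j ri rj f)))

  in-b : ∀ i j → InW (i , j) → b i j ≢ 0
  in-b i j (ri , rj , t) e = ℕₚ.n≮0 (subst (2 ≤_) e (inLabel i j ri rj t))

  b-out : ∀ i j → InR m i → InR n j → b i j ≡ 0 → inside C i j ≡ false
  b-out i j ri rj e with inside-cases (inside C i j)
  ... | inj₂ f = f
  ... | inj₁ t = ⊥-elim (in-b i j (ri , rj , t) e)

  a-01 : ∀ i j → a i j ≡ 0 ⊎ a i j ≡ 1
  a-01 i j with b i j
  ... | zero  = inj₁ refl
  ... | suc _ = inj₂ refl

  JSet : ℕ → ℤ → Cell → Set
  JSet = JoinSet C r

  JPath : ℕ → ℤ → Cell → Cell → Set
  JPath k ρ = Path (JSet k ρ) (SAdj m n)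

  -- Together with `bound-J`: the lexicographic condition of `JoinSet` describes a half strip, so
  -- joined classes are components of the basis copy cut off behind one column.
  J-bound : ∀ {k ρ x y z} → InR n k → JSet k ρ (x , y , z) → X n y z ℤ.≤ X n k ρ
  J-bound (1≤k , _) ((_ , (_ , y≤n) , _) , _ , inj₁ l) = ℤₚ.<⇒≤ (X-mono-roll n y≤n 1≤k l)
  J-bound {k} {ρ} {x} {y} _ (_ , _ , inj₂ (refl , l)) with ℕₚ.m≤n⇒m<n∨m≡n l
  ... | inj₁ l'   = ℤₚ.<⇒≤ (X-mono-col n ρ l')
  ... | inj₂ refl = ℤₚ.≤-refl

  bound-J : ∀ {k ρ x y z} → InR n k → InL C (x , y , z) → z ≡ r x y → X n y z ℤ.≤ X n k ρ → JSet k ρ (x , y , z)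
  bound-J {k} {ρ} {x} {y} {z} rk s e l = s , e , cases
    where
    ry : InR n y
    ry = proj₁ (proj₂ s)
    cases : z ℤ.< ρ ⊎ (z ≡ ρ × y ≤ k)
    cases with ℤₚ.<-cmp (X n y z) (X n k ρ)
    ... | tri> _ _ g = ⊥-elim (ℤₚ.≤⇒≯ l g)
    ... | tri< l' _ _ with X<⇒ ry rk l'
    ...   | inj₁ q       = inj₁ q
    ...   | inj₂ (q , t) = inj₂ (q , ℕₚ.<⇒≤ t)
    cases | tri≈ _ q _ with X-injective ry rk q
    ...   | refl , refl = inj₂ (refl , ℕₚ.≤-refl)

  column-J : ∀ i k → InW (i , k) → JSet k (r i k) (cell i k)
  column-J i k s = s , refl , inj₂ (refl , ℕₚ.≤-refl)

  same-label : ∀ i i' k → InW (i , k) → InW (i' , k) → r i k ≡ r i' k →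
               JPath k (r i k) (cell i k) (cell i' k) → b i k ≡ b i' k
  same-label i i' k (ri , rk , t) (ri' , _ , t') e = Equivalence.from (classes k i i' rk ri ri' t t' e)

  same-class : ∀ i i' k → InW (i , k) → InW (i' , k) → r i k ≡ r i' k → b i k ≡ b i' k →
               JPath k (r i k) (cell i k) (cell i' k)
  same-class i i' k (ri , rk , t) (ri' , _ , t') e = Equivalence.to (classes k i i' rk ri ri' t t' e)

  label-vertical : ∀ i k → InW (i , k) → InW (suc i , k) → b i k ≡ b (suc i) k
  label-vertical i k s s' = same-label i (suc i) k s s' e
    (step (column-J i k s) (subst (λ z → SAdj m n (i , k , r i k) (suc i , k , z)) e vdown)
      (here (subst (λ z → JSet k z (cell (suc i) k)) (sym e) (column-J (suc i) k s'))))
    where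
    e : r i k ≡ r (suc i) k
    e = roll-vertical s s'

  roll-next : ∀ i k → InW (i , pv n k) → InW (i , k) → Next n (pv n k) (r i (pv n k)) k (r i k)
  roll-next i (suc zero) s s' = subst (Next n n (r i n) 1) (roll-wrap s s') nwrap
  roll-next i (suc (suc k)) s s' = subst (Next n (suc k) (r i (suc k)) (suc (suc k)))
    (roll-right (proj₂ (proj₁ (proj₂ s'))) s s') (nright (proj₂ (proj₁ (proj₂ s'))))

  -- The copy of the interior tree that lies in the basis.
  Basic : Cell → Set
  Basic (i , j , k) = InL C (i , j , k) × k ≡ r i j

  basicPath : ∀ {i j d} → IPath (cell i j) d → Path Basic (SAdj m n) (cell i j) d
  basicPath p = mapPath (λ {c} q → path-end q , sheet q) (reachable p)

  J-weaken : ∀ {j ρ k ρ' c} → InR n j → InR n k → Next n j ρ k ρ' → JSet j ρ c → JSet k ρ' c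
  J-weaken {j} {ρ} {k} {ρ'} {x , y , z} rj rk nx s@(t , e , _) = bound-J rk t e
    (ℤₚ.≤-trans (J-bound rj s) (ℤₚ.≤-trans (ℤₚ.i≤suc[i] _) (ℤₚ.≤-reflexive (sym (X-next nx)))))

  J-next : ∀ {j ρ k ρ' x} → InR n j → Next n j ρ k ρ' → JSet j ρ (x , k , ρ') → ⊥
  J-next {j} {ρ} rj nx s = ℤₚ.≤⇒≯ (J-bound rj s)
    (ℤₚ.suc[i]≤j⇒i<j (ℤₚ.≤-reflexive (sym (X-next nx))))

  FL : FLcInt m n a
  FL = a-zero , top , bottom
    where
    a-zero : a 1 1 ≡ 0
    a-zero = cong (λ z → if z ≡ᵇ 0 then 0 else 1) (proj₁ (outZero 1 1 top-InR 1-InR out-11))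
    top : ∀ j → InR n j → (a 1 j , a 1 (nx n j)) ≢ (0 , 0)
    top j rj e = top-row rj (out-a top-InR rj (cong proj₁ e)) (out-a top-InR (nx-InR rj) (cong proj₂ e))
    bottom : ∀ j → InR n j → (a m j , a m (nx n j)) ≢ (0 , 0)
    bottom j rj e = bottom-row rj (out-a bottom-InR rj (cong proj₁ e)) (out-a bottom-InR (nx-InR rj) (cong proj₂ e))

  AC : ACcInt m n a
  AC i j 1≤i i<m rj with nx-vertex rj
  ... | c , lc , p , q = ones , zeros , (λ e → checker false e) , (λ e → checker true e)
    where
    ri : InR m i
    ri = 1≤i , ℕₚ.<⇒≤ i<m
    ri' : InR m (suc i)
    ri' = s≤s z≤n , i<m
    quad : ∀ {x y z w} → (a i j , a (suc i) j , a i (nx n j) , a (suc i) (nx n j)) ≡ (x , y , z , w) →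
           a i j ≡ x × a (suc i) j ≡ y × a i (nx n j) ≡ z × a (suc i) (nx n j) ≡ w
    quad refl = refl , refl , refl , refl
    at-left : ∀ i {x} → inside C i j ≡ x → inside C i (pv n (suc c)) ≡ x
    at-left i e = trans (cong (inside C i) q) e
    at-right : ∀ i {x} → inside C i (nx n j) ≡ x → inside C i (suc c) ≡ x
    at-right i e = trans (cong (inside C i) (sym p)) e
    value : Bool → ℕ
    value x = if x then 1 else 0
    is : ∀ {i j} x → InR m i → InR n j → a i j ≡ value x → inside C i j ≡ x
    is true  = ins-a
    is false = out-a
    all-equal : ∀ x → (a i j , a (suc i) j , a i (nx n j) , a (suc i) (nx n j)) ≢ (value x , value x , value x , value x)
    all-equal x e with quad e
    ... | e₁ , e₂ , e₃ , e₄ = not-all-equal i c x (ℕₚ.<⇒≤ i<m) lc λ where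
      lu → at-left i (is x ri rj e₁)
      ru → at-right i (is x ri (nx-InR rj) e₃)
      ld → at-left (suc i) (is x ri' rj e₂)
      rd → at-right (suc i) (is x ri' (nx-InR rj) e₄)
    ones : _
    ones = all-equal true
    zeros : _
    zeros = all-equal false
    checker : ∀ x → (a i j , a (suc i) j , a i (nx n j) , a (suc i) (nx n j)) ≢
                    (value x , value (not x) , value (not x) , value x)
    checker x e with quad e
    ... | e₁ , e₂ , e₃ , e₄ = not-checker i c x lc (at-left i (is x ri rj e₁))
      (at-right i (is (not x) ri (nx-InR rj) e₃)) (at-left (suc i) (is (not x) ri' rj e₂)) (at-right (suc i) (is x ri' (nx-InR rj) e₄))

  part1 : Part1
  part1 = (FL , AC) , vertical , outside-roll
    where
    vertical : ∀ i k → 2 ≤ i → i ≤ m → InR n k → a (i ∸ 1) k ≡ a i k → BR (i ∸ 1) k ≡ BR i k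
    vertical (suc i) k (s≤s 1≤i) l rk e with a-01 (suc i) k
    ... | inj₁ z = cong₂ _,_ (trans (proj₁ o₁) (sym (proj₁ o₂))) (trans (proj₂ o₁) (sym (proj₂ o₂)))
      where
      ri : InR m i
      ri = 1≤i , ℕₚ.<⇒≤ l
      o₁ = outZero i k ri rk (out-a ri rk (trans e z))
      o₂ = outZero (suc i) k (s≤s z≤n , l) rk (out-a (s≤s z≤n , l) rk z)
    ... | inj₂ o = cong₂ _,_ (label-vertical i k s s') (roll-vertical s s')
      where
      s : InW (i , k)
      s = a-InW i k (1≤i , ℕₚ.<⇒≤ l) rk (trans e o)
      s' : InW (suc i , k)
      s' = a-InW (suc i) k (s≤s z≤n , l) rk o
    outside-roll : ∀ i j → InR m i → InR n j → a i j ≡ 0 → r i j ≡ 0ℤ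
    outside-roll i j ri rj e = proj₂ (outZero i j ri rj (out-a ri rj e))

  descend : ∀ s i k → InW (i , k) → b i k ≡ s → ∀ ℓ → 2 ≤ ℓ → ℓ < s →
            ∃[ i' ] (i' < i × InR m i' × BR i' k ≡ (ℓ , r i k))
  descend (suc s) i k (ri , rk , t) e ℓ 2≤ℓ ℓ<s
    with order k i rk ri t (subst (2 <_) (sym e) (ℕₚ.≤-<-trans 2≤ℓ ℓ<s))
  ... | i' , 1≤i' , i'<i , t' , re , be with ℕₚ.m<1+n⇒m<n∨m≡n ℓ<s
  ...   | inj₂ refl = i' , i'<i , (1≤i' , ℕₚ.≤-trans (ℕₚ.<⇒≤ i'<i) (proj₂ ri)) ,
                      cong₂ _,_ (ℕₚ.suc-injective (trans be e)) re
  ...   | inj₁ ℓ<s' with descend s i' k ((1≤i' , ℕₚ.≤-trans (ℕₚ.<⇒≤ i'<i) (proj₂ ri)) , rk , t')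
                          (ℕₚ.suc-injective (trans be e)) ℓ 2≤ℓ ℓ<s'
  ...     | i″ , l″ , ri″ , e″ = i″ , ℕₚ.<-trans l″ i'<i , ri″ , trans e″ (cong (ℓ ,_) re)

  BR-≟ : ∀ i k p → Dec (BR i k ≡ p)
  BR-≟ i k p = ×ₚ.≡-dec ℕₚ._≟_ ℤₚ._≟_ (BR i k) p

  occ-InW : ∀ i k {β ρ} → β ≢ 0 → InR m i → InR n k → BR i k ≡ (β , ρ) → InW (i , k)
  occ-InW i k ne ri rk e = b-InW i k ri rk (λ z → ne (trans (sym (cong proj₁ e)) z))

  part2a : ∀ k → InR n k → ∀ s ρ → 3 ≤ s → Occ k (s , ρ) → ∀ ℓ → 2 ≤ ℓ → ℓ < s →
           ∃[ i' ] (InR m i' × BR i' k ≡ (ℓ , ρ) × (∀ i → InR m i → BR i k ≡ (s , ρ) → i' < i))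
  part2a k rk s ρ 3≤s (i , ri , e) ℓ 2≤ℓ ℓ<s
    with least (λ i → InR m i × BR i k ≡ (s , ρ)) dec i (ri , e)
    where
    dec : ∀ i → Dec (InR m i × BR i k ≡ (s , ρ))
    dec i with 1 ℕₚ.≤? i | i ℕₚ.≤? m | BR-≟ i k (s , ρ)
    ... | yes p | yes q | yes e = yes ((p , q) , e)
    ... | no ¬p | _     | _     = no λ x → ¬p (proj₁ (proj₁ x))
    ... | yes _ | no ¬q | _     = no λ x → ¬q (proj₂ (proj₁ x))
    ... | yes _ | yes _ | no ¬e = no λ x → ¬e (proj₂ x)
  ... | i₀ , _ , (ri₀ , e₀) , minimal
    with descend s i₀ k (occ-InW i₀ k (λ { refl → ℕₚ.n≮0 3≤s }) ri₀ rk e₀) (cong proj₁ e₀) ℓ 2≤ℓ ℓ<s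
  ...   | i' , l , ri' , e' = i' , ri' , trans e' (cong (ℓ ,_) (cong proj₂ e₀)) ,
    λ j rj ej → ℕₚ.<-≤-trans l (ℕₚ.≮⇒≥ λ j<i₀ → minimal j j<i₀ (rj , ej))

  -- Truncated roll words

  start-b : ∀ k i → startB k i ≡ true → b i k ≢ 0
  start-b k i e z rewrite z with () ← e

  no-start : ∀ k i → 1 ≤ i → startB k (suc i) ≡ false → b (suc i) k ≢ 0 → b i k ≡ b (suc i) k
  no-start k (suc i) _ e ne with b (suc (suc i)) k
  ... | zero  = ⊥-elim (ne refl)
  ... | suc x with b (suc i) k ≡ᵇ suc x in q
  ...   | true = ≡ᵇ-sound _ _ q

  no-start-1 : ∀ k → startB k 1 ≡ false → b 1 k ≡ 0
  no-start-1 k e with b 1 k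
  ... | zero = refl

  -- The roll word with its rows generated by a variable `g`, so that induction on the length can
  -- move the starting row.
  letters : ℕ → (ℕ → ℕ) → ℕ → List ℤ
  letters k g c = concatMap (λ i → if startB k i then r i k ∷ [] else []) (applyUpTo g c)

  rollWord-letters : ∀ k → rollWord k ≡ letters k suc m
  rollWord-letters k = cong (concatMap (λ i → if startB k i then r i k ∷ [] else [])) (map-upTo suc m)

  -- A list of rolls forgets its rows. This invariant recovers the row of the first letter, which is
  -- needed both to compare it with a preceding letter and to evaluate it.
  FirstLetter : ℕ → ℕ → ℕ → List ℤ → Set
  FirstLetter k u c w =
    (w ≡ [] × (∀ t → u ≤ t → t < c + u → startB k t ≡ false))
    ⊎ ∃[ p ] ∃[ w' ] (w ≡ r p k ∷ w' × u ≤ p × p < c + u × startB k p ≡ true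
                      × (∀ t → u ≤ t → t < p → startB k t ≡ false))

  module _ {k : ℕ} (rk : InR n k) where

    -- As long as no factor starts, the inside windows below `u` form one run with constant roll;
    -- from its last row `e` on there is a gap, to which `gap` applies.
    last-inside : ∀ {u} → InW (u , k) → ∀ d → d + u ≤ m → (∀ t → u < t → t ≤ d + u → startB k t ≡ false) →
      ∃[ e ] (u ≤ e × e ≤ d + u × InW (e , k) × r e k ≡ r u k × (∀ t → e < t → t ≤ d + u → inside C t k ≡ false))
    last-inside {u} s zero l h = u , ℕₚ.≤-refl , ℕₚ.≤-refl , s , refl , λ t a b → ⊥-elim (ℕₚ.<⇒≱ a b)
    last-inside {suc u} s (suc d) l h
      with last-inside s d (ℕₚ.<⇒≤ l) (λ t a b → h t a (ℕₚ.m≤n⇒m≤1+n b))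
         | inside-cases (inside C (suc d + suc u) k)
    ... | e , u≤e , e≤ , se , re , out | inj₂ f =
      e , u≤e , ℕₚ.m≤n⇒m≤1+n e≤ , se , re , extend
      where
      extend : ∀ t → e < t → t ≤ suc d + suc u → inside C t k ≡ false
      extend t a b with ℕₚ.m≤n⇒m<n∨m≡n b
      ... | inj₁ b'   = out t a (ℕₚ.≤-pred b')
      ... | inj₂ refl = f
    ... | e , u≤e , e≤ , se , re , out | inj₁ f =
      suc d + suc u , ℕₚ.m≤n+m (suc u) (suc d) , ℕₚ.≤-refl , st , trans (sym (roll-vertical sp st)) rp ,
      λ t a b → ⊥-elim (ℕₚ.<⇒≱ a b)
      where
      st : InW (suc d + suc u , k)
      st = (s≤s z≤n , l) , rk , f
      same : b (d + suc u) k ≡ b (suc d + suc u) k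
      same = no-start k (d + suc u) (ℕₚ.≤-trans (s≤s z≤n) (ℕₚ.m≤n+m (suc u) d))
        (h (suc d + suc u) (s≤s (ℕₚ.m≤n+m (suc u) d)) ℕₚ.≤-refl) (in-b _ k st)
      sp : InW (d + suc u , k)
      sp = b-InW (d + suc u) k (ℕₚ.≤-trans (s≤s z≤n) (ℕₚ.m≤n+m (suc u) d) , ℕₚ.<⇒≤ l) rk
             (λ z → in-b _ k st (trans (sym same) z))
      rp : r (d + suc u) k ≡ r (suc u) k
      rp with ℕₚ.m≤n⇒m<n∨m≡n e≤
      ... | inj₁ e< = ⊥-elim (true≢false (trans (sym (proj₂ (proj₂ sp))) (out (d + suc u) e< ℕₚ.≤-refl)))
      ... | inj₂ e≡ = trans (cong (λ z → r z k) (sym e≡)) re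

    start-gap : ∀ {u p} → InR m u → InR m p → startB k u ≡ true → startB k p ≡ true → u < p →
                (∀ t → u < t → t < p → startB k t ≡ false) → ∣ r u k ℤ.- r p k ∣ ≤ 1
    start-gap {u} {suc p} inU rp su sp (s≤s u≤p) h = finish (last-inside (b-InW u k inU rk (start-b k u su)) (p ∸ u)
        (subst (_≤ m) (sym q) (ℕₚ.<⇒≤ (proj₂ rp))) (λ t a b → h t a (s≤s (subst (t ≤_) q b))))
      where
      q : p ∸ u + u ≡ p
      q = ℕₚ.m∸n+n≡m u≤p
      finish : ∃[ e ] (u ≤ e × e ≤ p ∸ u + u × InW (e , k) × r e k ≡ r u k ×
                 (∀ t → e < t → t ≤ p ∸ u + u → inside C t k ≡ false)) → ∣ r u k ℤ.- r (suc p) k ∣ ≤ 1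
      finish (e , u≤e , e≤ , se , re , out) = subst (λ z → ∣ z ℤ.- r (suc p) k ∣ ≤ 1) re
        (gap rk se (b-InW (suc p) k rp rk (start-b k (suc p) sp)) (s≤s (subst (e ≤_) q e≤))
          (λ t a b → out t a (subst (t ≤_) (sym q) (ℕₚ.≤-pred b))))

    letters-linked : ∀ c u (g : ℕ → ℕ) → (∀ t → g t ≡ t + u) → 1 ≤ u → c + u ≤ suc m →
      Linked (λ x y → ∣ x ℤ.- y ∣ ≤ 1) (letters k g c) × FirstLetter k u c (letters k g c)
    letters-linked zero u g h 1≤u l = [] , inj₁ (refl , λ t a b → ⊥-elim (ℕₚ.<⇒≱ b a))
    letters-linked (suc c) u g h 1≤u l rewrite h 0
      with letters-linked c (suc u) (λ t → g (suc t)) (λ t → trans (h (suc t)) (sym (ℕₚ.+-suc t u)))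
             (s≤s z≤n) (subst (_≤ suc m) (sym (ℕₚ.+-suc c u)) l)
    ... | linked , first with startB k u in su
    ...   | true  = link linked first , inj₂ (u , _ , refl , ℕₚ.≤-refl , s≤s (ℕₚ.m≤n+m u c) , su , λ t a b → ⊥-elim (ℕₚ.<⇒≱ b a))
      where
      inU : InR m u
      inU = 1≤u , ℕₚ.≤-trans (ℕₚ.m≤n+m u c) (ℕₚ.≤-pred l)
      link : ∀ {w} → Linked (λ x y → ∣ x ℤ.- y ∣ ≤ 1) w → FirstLetter k (suc u) c w →
             Linked (λ x y → ∣ x ℤ.- y ∣ ≤ 1) (r u k ∷ w)
      link lw (inj₁ (refl , _)) = [-]
      link lw (inj₂ (p , w' , refl , u<p , p< , sp , none)) = start-gap inU
        (ℕₚ.≤-trans (s≤s z≤n) u<p , ℕₚ.≤-pred (ℕₚ.≤-trans p< (subst (_≤ suc m) (sym (ℕₚ.+-suc c u)) l))) su sp u<p none ∷ lw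
    ...   | false = linked , extend first
      where
      below : ∀ {t} → u ≤ t → suc u ≤ t ⊎ t ≡ u
      below l with ℕₚ.m≤n⇒m<n∨m≡n l
      ... | inj₁ l' = inj₁ l'
      ... | inj₂ e  = inj₂ (sym e)
      extend : ∀ {w} → FirstLetter k (suc u) c w → FirstLetter k u (suc c) w
      extend (inj₁ (e , none)) = inj₁ (e , λ t a b → case (below a) (λ a' → none t a' (subst (t <_) (sym (ℕₚ.+-suc c u)) b)))
        where
        case : ∀ {t} → suc u ≤ t ⊎ t ≡ u → (suc u ≤ t → startB k t ≡ false) → startB k t ≡ false
        case (inj₁ l) f    = f l
        case (inj₂ refl) _ = su
      extend (inj₂ (p , w' , e , u<p , p< , sp , none)) =
        inj₂ (p , w' , e , ℕₚ.<⇒≤ u<p , subst (p <_) (ℕₚ.+-suc c u) p< , sp , λ t a b → case (below a) (λ a' → none t a' b))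
        where
        case : ∀ {t} → suc u ≤ t ⊎ t ≡ u → (suc u ≤ t → startB k t ≡ false) → startB k t ≡ false
        case (inj₁ l) f    = f l
        case (inj₂ refl) _ = su

    rollWord-linked : Linked (λ x y → ∣ x ℤ.- y ∣ ≤ 1) (rollWord k) × FirstLetter k 1 m (rollWord k)
    rollWord-linked rewrite rollWord-letters k =
      letters-linked m 1 suc (λ t → ℕₚ.+-comm 1 t) ℕₚ.≤-refl (ℕₚ.≤-reflexive (ℕₚ.+-comm m 1))

    no-start-out : ∀ t → InR m (suc t) → (∀ s → 1 ≤ s → s ≤ suc t → startB k s ≡ false) → b (suc t) k ≡ 0
    no-start-out zero    rt h = no-start-1 k (h 1 ℕₚ.≤-refl ℕₚ.≤-refl)
    no-start-out (suc t) rt h with b (suc (suc t)) k ℕₚ.≟ 0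
    ... | yes e = e
    ... | no ne = trans (sym (no-start k (suc t) (s≤s z≤n) (h (suc (suc t)) (s≤s z≤n) ℕₚ.≤-refl) ne))
                    (no-start-out t (s≤s z≤n , ℕₚ.<⇒≤ (proj₂ rt)) (λ s a b → h s a (ℕₚ.m≤n⇒m≤1+n b)))

    no-start-out′ : ∀ {t} → InR m t → (∀ s → 1 ≤ s → s ≤ t → startB k s ≡ false) → b t k ≡ 0
    no-start-out′ {suc t} = no-start-out t

    first-letter-roll : ∀ {p} → 1 ≤ p → p < m + 1 → startB k p ≡ true → (∀ t → 1 ≤ t → t < p → startB k t ≡ false) →
                        (2 ≤ k → r p k ≡ 0ℤ) × (k ≡ 1 → r p k ≡ 0ℤ ⊎ r p k ≡ 1ℤ)
    first-letter-roll {p} 1≤p p< sp none = first-roll rk s out , first-roll-1 rk s out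
      where
      p≤m : p ≤ m
      p≤m = ℕₚ.≤-pred (subst (p <_) (ℕₚ.+-comm m 1) p<)
      s : InW (p , k)
      s = b-InW p k (1≤p , p≤m) rk (start-b k p sp)
      out : ∀ t → 1 ≤ t → t < p → inside C t k ≡ false
      out t a b' = b-out t k (a , ℕₚ.≤-trans (ℕₚ.<⇒≤ b') p≤m) rk
        (no-start-out′ (a , ℕₚ.≤-trans (ℕₚ.<⇒≤ b') p≤m) (λ s c d → none s c (ℕₚ.≤-<-trans d b')))

  part2 : Part2
  part2 = part2a , column-1 (proj₂ (rollWord-linked 1-InR)) , λ k 2≤k k≤n → column 2≤k (2≤⇒InR 2≤k k≤n) (proj₂ (rollWord-linked (2≤⇒InR 2≤k k≤n)))
    where
    2≤⇒InR : ∀ {k} → 2 ≤ k → k ≤ n → InR n k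
    2≤⇒InR l l' = ℕₚ.<⇒≤ l , l'
    column-1 : FirstLetter 1 1 m (rollWord 1) → rollWord 1 ≡ [] ⊎ ∃[ ρ ] ∃[ w ] (rollWord 1 ≡ ρ ∷ w × (ρ ≡ 0ℤ ⊎ ρ ≡ 1ℤ))
    column-1 (inj₁ (e , _)) = inj₁ e
    column-1 (inj₂ (p , w , e , 1≤p , p< , sp , none)) =
      inj₂ (r p 1 , w , e , proj₂ (first-letter-roll 1-InR 1≤p p< sp none) refl)
    column : ∀ {k} → 2 ≤ k → InR n k → FirstLetter k 1 m (rollWord k) → ∃[ w ] (rollWord k ≡ 0ℤ ∷ w)
    column {k} 2≤k rk (inj₁ (_ , none)) = ⊥-elim (column-meets rk 2≤k λ t rt → b-out t k rt rk
      (no-start-out′ rk rt (λ s c d → none s c (ℕₚ.≤-<-trans d (subst (t <_) (ℕₚ.+-comm 1 m) (s≤s (proj₂ rt)))))))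
    column {k} 2≤k rk (inj₂ (p , w , e , 1≤p , p< , sp , none)) =
      w , trans e (cong (_∷ w) (proj₁ (first-letter-roll rk 1≤p p< sp none) 2≤k))

  part3a : ∀ i k → InR m i → 2 ≤ k → k ≤ n → a i (k ∸ 1) ≡ 1 → a i k ≡ 1 → r i (k ∸ 1) ≡ r i k
  part3a i (suc k) ri (s≤s 1≤k) k≤n e e' =
    roll-right k≤n (a-InW i k ri (1≤k , ℕₚ.<⇒≤ k≤n) e) (a-InW i (suc k) ri (s≤s z≤n , k≤n) e')

  -- A path leaving the half strip that ends with column (k , ρ) does so through that column.
  J-spread : ∀ k ρ → InR n k → ∀ {c d e} → JPath k ρ c d →
    (∀ x → JPath k ρ c (x , k , ρ) → InW (x , nx n k) → ⊥) →
    Path Basic (SAdj m n) d e → JPath k ρ c e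
  J-spread k ρ rk q stuck (here _) = q
  J-spread k ρ rk {c} q stuck (step {y = y} s a p) = J-spread k ρ rk (snoc q a (inJ a (path-end q) q (path-start p))) stuck p
    where
    go-right : ∀ {x j z j' z'} → Next n j z j' z' → JSet k ρ (x , j , z) → JPath k ρ c (x , j , z) →
               Basic (x , j' , z') → JSet k ρ (x , j' , z')
    go-right {x} {j} {z} {j'} {z'} nx d p (t , e) with ℤₚ.<-cmp (X n j z) (X n k ρ)
    ... | tri< l _ _ = bound-J rk t e (ℤₚ.≤-trans (ℤₚ.≤-reflexive (X-next nx)) (ℤₚ.i<j⇒suc[i]≤j l))
    ... | tri> _ _ g = ⊥-elim (ℤₚ.≤⇒≯ (J-bound rk d) g)
    ... | tri≈ _ q' _ with X-injective (proj₁ (proj₂ (proj₁ d))) rk q'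
    ...   | refl , refl = ⊥-elim (stuck x p (subst (λ j → InW (x , j)) (Next-nx nx) t))
    go-left : ∀ {x j z j' z'} → Next n j z j' z' → JSet k ρ (x , j' , z') → Basic (x , j , z) → JSet k ρ (x , j , z)
    go-left {j = j} {z = z} nx d (t , e) = bound-J rk t e
      (ℤₚ.≤-trans (ℤₚ.i≤suc[i] (X n j z)) (ℤₚ.≤-trans (ℤₚ.≤-reflexive (sym (X-next nx))) (J-bound rk d)))
    inJ : ∀ {d y} → SAdj m n d y → JSet k ρ d → JPath k ρ c d → Basic y → JSet k ρ y
    inJ vdown        d p (t , e) = bound-J rk t e (J-bound rk d)
    inJ vup          d p (t , e) = bound-J rk t e (J-bound rk d)
    inJ (hright l)   d p t = go-right (nright l) d p t
    inJ (hleft l)    d p t = go-left (nright l) d t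
    inJ (wrapR refl) d p t = go-right nwrap d p t
    inJ (wrapL refl) d p t = go-left nwrap d t

  module Confined {i k : ℕ} (s : InW (i , k))
    (stuck : ∀ x → InR m x → BR x k ≡ BR i k → b x (nx n k) ≢ 0 → ⊥) where

    private
      rk : InR n k
      rk = proj₁ (proj₂ s)

    -- A class that does not meet the next column is the whole interior tree.
    all-joined : ∀ {x y} → InW (x , y) → JPath k (r i k) (cell i k) (cell x y)
    all-joined {x} {y} t = J-spread k (r i k) rk (here (column-J i k s)) stop (basicPath (lift {i} {k} {x} {y} s t))
      where
      stop : ∀ x → JPath k (r i k) (cell i k) (x , k , r i k) → InW (x , nx n k) → ⊥
      stop x p t' = stuck x rx (sym (cong₂ _,_ (same-label i x k s sx (proj₁ (proj₂ (path-end p)))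
                      (castPath (proj₁ (proj₂ (path-end p))) p)) (proj₁ (proj₂ (path-end p)))))
                      (in-b x (nx n k) t')
        where
        sx : InW (x , k)
        sx = proj₁ (path-end p)
        rx : InR m x
        rx = proj₁ sx

    bound : ∀ x y → InW (x , y) → r x y ℤ.< r i k ⊎ (r x y ≡ r i k × y ≤ k)
    bound x y t = proj₂ (proj₂ joined)
      where
      joined : JSet k (r i k) (cell x y)
      joined = path-end (all-joined {x} {y} t)

    -- The window `(1 , n)` has roll 0 and must lie in the half strip as well. The two alternatives
    -- are the two exceptional cases.
    root-bound : 0ℤ ℤ.< r i k ⊎ (0ℤ ≡ r i k × n ≤ k)
    root-bound = subst (λ z → z ℤ.< r i k ⊎ (z ≡ r i k × n ≤ k)) root-roll (bound 1 n root-InW)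

    root-≤ : 0ℤ ℤ.≤ r i k
    root-≤ = weaken root-bound
      where
      weaken : 0ℤ ℤ.< r i k ⊎ (0ℤ ≡ r i k × n ≤ k) → 0ℤ ℤ.≤ r i k
      weaken (inj₁ l)       = ℤₚ.<⇒≤ l
      weaken (inj₂ (e , _)) = ℤₚ.≤-reflexive e

    max-roll : MaxRoll k (r i k)
    max-roll x rx = go (inside-cases (inside C x k))
      where
      weaken : r x k ℤ.< r i k ⊎ (r x k ≡ r i k × k ≤ k) → r x k ℤ.≤ r i k
      weaken (inj₁ l)       = ℤₚ.<⇒≤ l
      weaken (inj₂ (e , _)) = ℤₚ.≤-reflexive e
      go : inside C x k ≡ true ⊎ inside C x k ≡ false → r x k ℤ.≤ r i k
      go (inj₁ t) = weaken (bound x k (rx , rk , t))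
      go (inj₂ f) = subst (ℤ._≤ r i k) (sym (proj₂ (outZero x k rx rk f))) root-≤

    one-label : ∀ x → InW (x , k) → r x k ≡ r i k → b x k ≡ b i k
    one-label x t e = sym (same-label i x k s t (sym e) (all-joined {x} {k} t))

    -- A larger label would be preceded by a different class with the same roll, but here everything
    -- is joined.
    label-2 : b i k ≡ 2
    label-2 = go (ℕₚ.m≤n⇒m<n∨m≡n (inLabel i k (proj₁ s) rk (proj₂ (proj₂ s))))
      where
      previous : ∃[ x ] (1 ≤ x × x < i × inside C x k ≡ true × r x k ≡ r i k × suc (b x k) ≡ b i k) → ⊥
      previous (x , 1≤x , x<i , t , re , be) = ℕₚ.1+n≢n (trans be (sym (one-label x sx re)))
        where
        sx : InW (x , k)
        sx = (1≤x , ℕₚ.≤-trans (ℕₚ.<⇒≤ x<i) (proj₂ (proj₁ s))) , rk , t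
      go : 2 < b i k ⊎ 2 ≡ b i k → b i k ≡ 2
      go (inj₁ l) = ⊥-elim (previous (order k i rk (proj₁ s) (proj₂ (proj₂ s)) l))
      go (inj₂ e) = sym e

    no-3 : ¬ Occ k (3 , r i k)
    no-3 (x , rx , e) = three≢two (trans (sym (cong proj₁ e))
      (trans (one-label x (occ-InW x k (λ ()) rx rk e) (cong proj₂ e)) label-2))
      where
      three≢two : 3 ≢ 2
      three≢two ()

  part3b : ∀ k → InR n k → ∀ β ρ → β ≢ 0 → Occ k (β , ρ) → ¬ Exc1 k β ρ → ¬ Exc2 k β ρ →
           ∃[ i ] (InR m i × BR i k ≡ (β , ρ) × b i (nx n k) ≢ 0)
  part3b k rk β ρ β≢0 (i , ri , refl) ¬1 ¬2 = decide (searchUpTo P P? (suc m))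
    where
    P : ℕ → Set
    P x = 1 ≤ x × BR x k ≡ BR i k × b x (nx n k) ≢ 0
    P? : ∀ x → Dec (P x)
    P? x with 1 ℕₚ.≤? x | BR-≟ x k (BR i k) | b x (nx n k) ℕₚ.≟ 0
    ... | yes p | yes q | no t  = yes (p , q , t)
    ... | no ¬p | _     | _     = no λ u → ¬p (proj₁ u)
    ... | yes _ | no ¬q | _     = no λ u → ¬q (proj₁ (proj₂ u))
    ... | yes _ | yes _ | yes e = no λ u → proj₂ (proj₂ u) e
    s : InW (i , k)
    s = b-InW i k ri rk β≢0
    decide : _ → ∃[ x ] (InR m x × BR x k ≡ BR i k × b x (nx n k) ≢ 0)
    decide (inj₁ (x , l , p , q)) = x , (p , ℕₚ.≤-pred l) , q
    decide (inj₂ none) = ⊥-elim (exceptional root-bound)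
      where
      open Confined {i} {k} s (λ x rx e ne → none x (s≤s (proj₂ rx)) (proj₁ rx , e , ne))
      exceptional : 0ℤ ℤ.< r i k ⊎ (0ℤ ≡ r i k × n ≤ k) → ⊥
      exceptional (inj₁ l)       = ¬1 (label-2 , l , max-roll , no-3)
      exceptional (inj₂ (e , l)) = ¬2 (ℕₚ.≤-antisym (proj₂ rk) l , label-2 , sym e , max-roll ,
                                       subst (λ z → ¬ Occ k (3 , z)) (sym e) no-3)

  module _ {k : ℕ} (rk : InR n k) where

    -- A path in the half strip of the preceding column, extended by one edge to the right at each
    -- end, is a path in the half strip of column `k`.
    joined-across : ∀ i j → InW (i , pv n k) → InW (j , pv n k) → InW (i , k) → InW (j , k) →
      BR i (pv n k) ≡ BR j (pv n k) → r i k ≡ r j k × b i k ≡ b j k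
    joined-across i j si sj ti tj e = re , same-label i j k ti tj re
      (castPath re (step (column-J i k ti) (flip-SAdj (next-adj ni))
        (snoc (mapPath (λ {c} → J-weaken {c = c} (pv-InR rk) rk ni) path) (next-adj nj')
          (subst (λ z → JSet k z (j , k , z)) (sym re) (column-J j k tj)))))
      where
      ni : Next n (pv n k) (r i (pv n k)) k (r i k)
      ni = roll-next i k si ti
      nj : Next n (pv n k) (r j (pv n k)) k (r j k)
      nj = roll-next j k sj tj
      re : r i k ≡ r j k
      re = Next-unique ni (subst (λ z → Next n (pv n k) z k (r j k)) (sym (cong proj₂ e)) nj)
      nj' : Next n (pv n k) (r j (pv n k)) k (r i k)
      nj' = subst (Next n (pv n k) (r j (pv n k)) k) (sym re) nj
      path : JPath (pv n k) (r i (pv n k)) (cell i (pv n k)) (cell j (pv n k))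
      path = same-class i j (pv n k) si sj (cong proj₂ e) (cong proj₁ e)

  part3c : ∀ k → InR n k → ∀ i j → InR m i → InR m j → i ≢ j → BR i (pv n k) ≡ BR j (pv n k) →
           a i k ≡ 1 → a j k ≡ 1 → a i (pv n k) ≡ 1 → a j (pv n k) ≡ 1 → b i k ≡ b j k
  part3c k rk i j ri rj _ e ei ej ei' ej' = proj₂ (joined-across rk i j
    (a-InW i (pv n k) ri (pv-InR rk) ei') (a-InW j (pv n k) rj (pv-InR rk) ej')
    (a-InW i k ri rk ei) (a-InW j k rj rk ej) e)

  Entry : ℕ → ℤ → Set
  Entry k ρ = ∃[ x ] ∃[ j ] ∃[ z ] (Next n j z k ρ × Basic (x , j , z) × Basic (x , k , ρ))

  -- A discrete intermediate value argument: the coordinate changes by at most one in each step, so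
  -- the column is first reached by a horizontal step from the left.
  entry : ∀ k ρ → InR n k → ∀ {c d} → Path Basic (SAdj m n) c d →
          X n (proj₁ (proj₂ c)) (proj₂ (proj₂ c)) ℤ.< X n k ρ →
          X n k ρ ℤ.≤ X n (proj₁ (proj₂ d)) (proj₂ (proj₂ d)) → Entry k ρ
  entry k ρ rk (here _) l l' = ⊥-elim (ℤₚ.≤⇒≯ l' l)
  entry k ρ rk {c} (step {y = y} s a p) l l' =
    decide (X n (proj₁ (proj₂ y)) (proj₂ (proj₂ y)) ℤₚ.<? X n k ρ)
    where
    go-right : ∀ {x j z j' z'} → Next n j z j' z' → Basic (x , j , z) → Basic (x , j' , z') →
               X n j z ℤ.< X n k ρ → X n k ρ ℤ.≤ X n j' z' → Entry k ρ
    go-right {x} {j} {z} {j'} {z'} nx s t l g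
      with X-injective (proj₁ (proj₂ (proj₁ t))) rk
             (ℤₚ.≤-antisym (ℤₚ.≤-trans (ℤₚ.≤-reflexive (X-next nx)) (ℤₚ.i<j⇒suc[i]≤j l)) g)
    ... | refl , refl = x , j , z , nx , s , t
    go-left : ∀ {j z j' z'} → Next n j z j' z' → X n j' z' ℤ.< X n k ρ → X n k ρ ℤ.≤ X n j z → ⊥
    go-left {j} {z} nx l g = ℤₚ.≤⇒≯ g (ℤₚ.≤-<-trans (ℤₚ.i≤suc[i] (X n j z))
      (ℤₚ.≤-<-trans (ℤₚ.≤-reflexive (sym (X-next nx))) l))
    cross : ∀ {c y} → SAdj m n c y → Basic c → Basic y →
            X n (proj₁ (proj₂ c)) (proj₂ (proj₂ c)) ℤ.< X n k ρ →
            X n k ρ ℤ.≤ X n (proj₁ (proj₂ y)) (proj₂ (proj₂ y)) → Entry k ρ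
    cross vdown        s t l g = ⊥-elim (ℤₚ.≤⇒≯ g l)
    cross vup          s t l g = ⊥-elim (ℤₚ.≤⇒≯ g l)
    cross (hright q)   s t l g = go-right (nright q) s t l g
    cross (wrapR refl) s t l g = go-right nwrap s t l g
    cross (hleft q)    s t l g = ⊥-elim (go-left (nright q) l g)
    cross (wrapL refl) s t l g = ⊥-elim (go-left nwrap l g)
    decide : Dec _ → Entry k ρ
    decide (yes l″) = entry k ρ rk p l″ l'
    decide (no ¬l)  = cross a s (path-start p) l (ℤₚ.≮⇒≥ ¬l)

  part3f : ∀ k → InR n k → ∀ ρ → 0ℤ ℤ.< ρ → Occ k (2 , ρ) →
    ∃[ i ] (InR m i × (k ≡ 1 → r i n ≡ ρ ℤ.- 1ℤ × a i 1 ≡ 1 × a i n ≡ 1)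
                    × (1 < k → r i (k ∸ 1) ≡ ρ × a i (k ∸ 1) ≡ 1 × a i k ≡ 1))
  -- The path comes from the root window, which has roll 0 and so lies to the left of every column
  -- of positive level.
  part3f k rk ρ 0<ρ (i , ri , e) = finish (entry k (r i k) rk (basicPath (lift {1} {n} {i} {k} root-InW s)) start ℤₚ.≤-refl)
    where
    s : InW (i , k)
    s = occ-InW i k (λ ()) ri rk e
    start : X n n (r 1 n) ℤ.< X n k (r i k)
    start = X-mono-roll n ℕₚ.≤-refl (proj₁ rk) (subst₂ ℤ._<_ (sym root-roll) (sym (cong proj₂ e)) 0<ρ)
    finish : Entry k (r i k) → _
    finish (x , j , z , nx , (sx , ez) , (tx , _)) = x , proj₁ sx , first , later
      where
      first : k ≡ 1 → r x n ≡ ρ ℤ.- 1ℤ × a x 1 ≡ 1 × a x n ≡ 1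
      first refl with Next-prev-1 (proj₁ (proj₂ sx)) nx
      ... | refl , q = trans (sym ez) (trans q (cong (λ z → z ℤ.- 1ℤ) (cong proj₂ e))) , in-a x 1 tx , in-a x n sx
      later : 1 < k → r x (k ∸ 1) ≡ ρ × a x (k ∸ 1) ≡ 1 × a x k ≡ 1
      later 1<k with Next-prev 1<k nx
      ... | refl , q = trans (sym ez) (trans q (cong proj₂ e)) , in-a x (k ∸ 1) sx , in-a x k tx

  part4 : Part4
  part4 = (cong₂ _,_ (proj₁ o) (proj₂ o) , second , cong₂ _,_ label root-roll) , wrapping
    where
    o : b 1 1 ≡ 0 × r 1 1 ≡ 0ℤ
    o = outZero 1 1 top-InR 1-InR out-11
    -- The path down the split tree must leave `(1 , 1)`, and both horizontal neighbours are inside,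
    -- so its first step leads to `(2 , 1)`.
    escape : 2 ≤ m → ∀ {j} → Path (OutW C) (WAdj m n) (1 , 1) (m , j) → inside C 2 1 ≡ false
    escape (s≤s ()) (here _)
    escape 2≤m (step _ vdown p) = proj₂ (proj₂ (path-start p))
    escape 2≤m (step _ vup p) with path-start p
    ... | ((() , _) , _)
    escape 2≤m (step _ (hright l) p) =
      ⊥-elim (top-row 1-InR out-11 (trans (cong (inside C 1) (nx-< l)) (proj₂ (proj₂ (path-start p)))))
    escape 2≤m (step _ (hleft l) p) with path-start p
    ... | (_ , (() , _) , _)
    escape 2≤m (step _ wrapR p) = ⊥-elim (ℕₚ.<⇒≱ 2≤n ℕₚ.≤-refl)
    escape 2≤m (step _ wrapL p) = ⊥-elim (true≢false (trans (sym inside-1n) (proj₂ (proj₂ (path-start p)))))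
    second : 2 ≤ m → BR 2 1 ≡ (0 , 0ℤ)
    second 2≤m with outZero 2 1 (s≤s z≤n , 2≤m) 1-InR (escape 2≤m (proj₂ (proj₂ upRoot)))
    ... | e , e' = cong₂ _,_ e e'
    label : b 1 n ≡ 2
    label with ℕₚ.<-cmp 2 (b 1 n)
    ... | tri≈ _ e _ = sym e
    ... | tri> _ _ l = ⊥-elim (ℕₚ.<⇒≱ l (inLabel 1 n top-InR n-InR inside-1n))
    -- A label above 2 would need its predecessor strictly above row 1.
    ... | tri< l _ _ with order n 1 n-InR top-InR inside-1n l
    ...   | x , 1≤x , x<1 , _ = ⊥-elim (ℕₚ.<⇒≱ x<1 1≤x)
    wrapping : ∀ i → 2 < i → i ≤ m → a i n ≡ 1 → a i 1 ≡ 1 → r i 1 ≡ r i n ℤ.+ 1ℤ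
    wrapping i 2<i i≤m e e' = sym (roll-wrap (a-InW i n ri n-InR e) (a-InW i 1 ri 1-InR e'))
      where
      ri : InR m i
      ri = ℕₚ.≤-trans (s≤s z≤n) 2<i , i≤m

  part5 : Part5
  part5 = planar , λ k rk → proj₁ (rollWord-linked rk)
    where
    planar : ∀ k → InR n k → ∀ i₁ j₁ i₂ j₂ → 1 < i₁ → i₁ < j₁ → j₁ < i₂ → i₂ < j₂ →
       j₂ ≤ m → b i₁ k ≡ b i₂ k → 1 < b i₁ k → b j₁ k ≡ b j₂ k → 1 < b j₁ k →
       r i₁ k ≡ r i₂ k → r i₂ k ≡ r j₁ k → r j₁ k ≡ r j₂ k → b i₁ k ≡ b j₁ k
    planar k rk i₁ j₁ i₂ j₂ 1<i₁ l₁ l₂ l₃ j₂≤m be 1<b be' 1<b' re re' re″ = decide (b i₁ k ℕₚ.≟ b j₁ k)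
      where
      j₁≤m : j₁ ≤ m
      j₁≤m = ℕₚ.<⇒≤ (ℕₚ.<-≤-trans l₂ (ℕₚ.<⇒≤ (ℕₚ.<-≤-trans l₃ j₂≤m)))
      nonzero : ∀ {x} → 1 < x → x ≢ 0
      nonzero l refl = ℕₚ.n≮0 l
      si₁ : InW (i₁ , k)
      si₁ = b-InW i₁ k (ℕₚ.<⇒≤ 1<i₁ , ℕₚ.≤-trans (ℕₚ.<⇒≤ l₁) j₁≤m) rk (nonzero 1<b)
      sj₁ : InW (j₁ , k)
      sj₁ = b-InW j₁ k (ℕₚ.≤-trans (s≤s z≤n) l₁ , j₁≤m) rk (nonzero 1<b')
      si₂ : InW (i₂ , k)
      si₂ = b-InW i₂ k (ℕₚ.≤-trans (s≤s z≤n) l₂ , ℕₚ.<⇒≤ (ℕₚ.<-≤-trans l₃ j₂≤m)) rk (subst (_≢ 0) be (nonzero 1<b))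
      sj₂ : InW (j₂ , k)
      sj₂ = b-InW j₂ k (ℕₚ.≤-trans (s≤s z≤n) l₃ , j₂≤m) rk (subst (_≢ 0) be' (nonzero 1<b'))
      ρ : ℤ
      ρ = r i₁ k
      rj : ρ ≡ r j₁ k
      rj = trans re re'
      P : JPath k ρ (i₁ , k , ρ) (i₂ , k , ρ)
      P = castPath (sym re) (same-class i₁ i₂ k si₁ si₂ re be)
      Q : JPath k ρ (j₁ , k , ρ) (j₂ , k , ρ)
      Q = subst (λ z → JPath k z (j₁ , k , z) (j₂ , k , z)) (sym rj)
            (castPath (sym re″) (same-class j₁ j₂ k sj₁ sj₂ re″ be'))
      module _ (ne : b i₁ k ≢ b j₁ k) where
        disjoint : Disjoint n (JPath k ρ (i₁ , k , ρ)) (JPath k ρ (j₁ , k , ρ))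
        disjoint {i} {j} {z} {j'} {z'} p q e
          with X-injective (proj₁ (proj₂ (proj₁ (path-end p)))) (proj₁ (proj₂ (proj₁ (path-end q)))) e
        ... | refl , refl = ne (same-label i₁ j₁ k si₁ sj₁ rj (castPath rj (p ⊕ reversePath flip-SAdj q)))
        crossing-impossible : ⊥
        crossing-impossible = interlace {S = JPath k ρ (i₁ , k , ρ)} {T = JPath k ρ (j₁ , k , ρ)} disjoint
          (λ p → J-bound rk (path-end p)) (λ p → J-bound rk (path-end p)) (reachable P) (reachable Q) l₁ l₂ l₃
      decide : Dec (b i₁ k ≡ b j₁ k) → b i₁ k ≡ b j₁ k
      decide (yes e) = e
      decide (no ne) = ⊥-elim (crossing-impossible ne)

-- Factors and their links

cancel-minus : ∀ a b c → a ℤ.- b ≡ a ℤ.- c → b ≡ c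
cancel-minus a b c h = trans (lem a b) (trans (cong (λ z → a ℤ.- z) h) (sym (lem a c)))
  where
  lem : ∀ a b → b ≡ a ℤ.- (a ℤ.- b)
  lem = solve-∀

row-sound : ∀ e x → row e x ≡ 1ℤ → x ≡ e
row-sound e x q with x ≡ᵇ e in eq
... | true = ≡ᵇ-sound x e eq

hor-next : ∀ {m n} f g {i j k j' k'} (nx : Next n j k j' k') → hor {m} f g (next-adj {i = i} nx) ≡ f i ℤ.* g (X n j k)
hor-next f g (nright l) = refl
hor-next f g nwrap      = refl

tot-cast : ∀ {m n S x i j k k'} (w : ∀ {x y} → SAdj m n x y → ℤ) (e : k ≡ k') (p : Path S (SAdj m n) x (i , j , k)) →
           tot w (castPath e p) ≡ tot w p
tot-cast w refl p = refl

Next-unique-left : ∀ {n j z j' z' k ρ} → InR n j → InR n j' → Next n j z k ρ → Next n j' z' k ρ → j ≡ j' × z ≡ z'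
Next-unique-left rj rj' a b = X-injective rj rj' (suc-injectiveℤ (trans (sym (X-next a)) (X-next b)))

SAdj-view : ∀ {m n i j z i' j' z'} → SAdj m n (i , j , z) (i' , j' , z') →
  (j ≡ j' × z ≡ z' × (i' ≡ suc i ⊎ i ≡ suc i')) ⊎ (i ≡ i' × Next n j z j' z') ⊎ (i ≡ i' × Next n j' z' j z)
SAdj-view vdown        = inj₁ (refl , refl , inj₁ refl)
SAdj-view vup          = inj₁ (refl , refl , inj₂ refl)
SAdj-view (hright l)   = inj₂ (inj₁ (refl , nright l))
SAdj-view (hleft l)    = inj₂ (inj₂ (refl , nright l))
SAdj-view (wrapR refl) = inj₂ (inj₁ (refl , nwrap))
SAdj-view (wrapL refl) = inj₂ (inj₂ (refl , nwrap))

prev-roll : ∀ n k ρ → 1 ≤ k → k ≤ n → ∃[ ρ' ] Next n (pv n k) ρ' k ρ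
prev-roll n (suc zero) ρ _ _ = ρ ℤ.- 1ℤ , subst (Next n n (ρ ℤ.- 1ℤ) 1) (lem ρ) nwrap
  where
  lem : ∀ z → z ℤ.- 1ℤ ℤ.+ 1ℤ ≡ z
  lem = solve-∀
prev-roll n (suc (suc k)) ρ _ l = ρ , nright l

module Factors {m n : ℕ} (1≤m : 1 ≤ m) (2≤n : 2 ≤ n) (C : HamCycle m n) (contractible : Contractible C)
  (upRoot : STUpRoot11 C) (b : ℕ → ℕ → ℕ) (r : ℕ → ℕ → ℤ) (isB : IsB C b r) where
  open Matrix 1≤m 2≤n C contractible upRoot b r isB public
  open Bridges 1≤m 2≤n C contractible using (crossing-unique)

  decInW : ∀ i j → Dec (InW (i , j))
  decInW i j with 1 ℕₚ.≤? i | i ℕₚ.≤? m | 1 ℕₚ.≤? j | j ℕₚ.≤? n | inside-cases (inside C i j)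
  ... | yes a | yes b | yes c | yes d | inj₁ t = yes ((a , b) , (c , d) , t)
  ... | no ¬a | _ | _ | _ | _ = no λ s → ¬a (proj₁ (proj₁ s))
  ... | yes _ | no ¬a | _ | _ | _ = no λ s → ¬a (proj₂ (proj₁ s))
  ... | yes _ | yes _ | no ¬a | _ | _ = no λ s → ¬a (proj₁ (proj₁ (proj₂ s)))
  ... | yes _ | yes _ | yes _ | no ¬a | _ = no λ s → ¬a (proj₂ (proj₁ (proj₂ s)))
  ... | yes _ | yes _ | yes _ | yes _ | inj₂ f = no λ s → true≢false (trans (sym (proj₂ (proj₂ s))) f)

  private
    fromRoot : ∀ i j → InW (i , j) → IPath (cell 1 n) (cell i j)
    fromRoot i j s = lift {1} {n} {i} {j} root-InW s

    value : ℕ → ℕ → ∀ i j → Dec (InW (i , j)) → ℤ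
    value q e i j (yes s) = crossing e (X n q (r e q)) (fromRoot i j s)
    -- A default outside the interior; `pot-unique` is stated along a path and never meets it.
    value q e i j (no _)  = 0ℤ

    value-unique : ∀ q e i j → InR m e → InR n q → (p : IPath (cell 1 n) (cell i j)) → InW (i , j) →
                   ∀ d → value q e i j d ≡ crossing e (X n q (r e q)) p
    value-unique q e i j re rq p s (yes s') = crossing-unique (r e q) re rq (fromRoot i j s') p
    value-unique q e i j re rq p s (no ¬s)  = ⊥-elim (¬s s)

  abstract
    -- Net number of times a path in the interior from the root to (i , j) crosses the line to the right
    -- of column q in row e: since the interior has no cycles, this does not depend on the path.
    pot : ℕ → ℕ → ℕ → ℕ → ℤ
    pot q e i j = value q e i j (decInW i j)

    pot-unique : ∀ q e i j → InR m e → InR n q → (p : IPath (cell 1 n) (cell i j)) →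
                 pot q e i j ≡ crossing e (X n q (r e q)) p
    pot-unique q e i j re rq p = value-unique q e i j re rq p (path-end p) (decInW i j)

  pot-path : ∀ q e i j i' j' → InR m e → InR n q → InW (i , j) → (p : IPath (cell i j) (cell i' j')) →
             pot q e i' j' ≡ pot q e i j ℤ.+ crossing e (X n q (r e q)) p
  pot-path q e i j i' j' re rq s p = begin
    pot q e i' j' ≡⟨ pot-unique q e i' j' re rq (fromRoot i j s ⊕ p) ⟩
    cr' (fromRoot i j s ⊕ p) ≡⟨ tot-⊕ _ (fromRoot i j s) p ⟩
    cr' (fromRoot i j s) ℤ.+ cr' p ≡⟨ cong (λ z → z ℤ.+ cr' p) (sym (pot-unique q e i j re rq (fromRoot i j s))) ⟩
    pot q e i j ℤ.+ cr' p ∎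
    where
    open ≡-Reasoning
    cr' : ∀ {x y} → IPath x y → ℤ
    cr' = crossing e (X n q (r e q))

  module Column (k : ℕ) (rk : InR n k) where

    q : ℕ
    q = pv n k

    rq : InR n q
    rq = pv-InR rk

    -- Belongs to the edge that leads from column `q` to column `k` in row `e`, evaluated at the
    -- window `(x , k)`; `π'` evaluates the same potential at `(x , q)`.
    π : ℕ → ℕ → ℤ
    π e x = pot q e x k

    π' : ℕ → ℕ → ℤ
    π' e x = pot q e x q

    π-vertical : ∀ e x → InR m e → InW (x , k) → InW (suc x , k) → π e (suc x) ≡ π e x
    π-vertical e x re s s' = trans (pot-path q e x k (suc x) k re rq s (castPath same p))
      (trans (cong (λ z → π e x ℤ.+ z) (tot-cast (hor (row e) (δ (X n q (r e q)))) same p)) (ℤₚ.+-identityʳ _))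
      where
      same : r x k ≡ r (suc x) k
      same = roll-vertical s s'
      p : IPath (cell x k) (suc x , k , r x k)
      p = step s vdown (here s')

    -- Windows of one class of column `q` are joined inside its half strip, without crossing the
    -- line to the right of `q`.
    π-class : ∀ e x y → InR m e → InW (x , q) → InW (y , q) → BR x q ≡ BR y q → r x q ≡ r e q → π' e y ≡ π' e x
    π-class e x y re s s' same roll = trans (pot-path q e x q y q re rq s (mapPath proj₁ p))
      (trans (cong (λ z → π' e x ℤ.+ z) (trans (tot-map (hor (row e) (δ (X n q (r e q)))) proj₁ p) none)) (ℤₚ.+-identityʳ _))
      where
      p : JPath q (r x q) (cell x q) (cell y q)
      p = same-class x y q s s' (cong proj₂ same) (cong proj₁ same)
      avoid : ∀ {j z j' z'} → Next n j z j' z' → JSet q (r x q) (e , j , z) → JSet q (r x q) (e , j' , z') → X n j z ≢ X n q (r e q)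
      avoid {j} {z} next _ d h = ℤₚ.<-irrefl {X n j z} (trans h (cong (X n q) (sym roll)))
        (ℤₚ.suc[i]≤j⇒i<j (ℤₚ.≤-trans (ℤₚ.≤-reflexive (sym (X-next next))) (J-bound rq d)))
      none : crossing e (X n q (r e q)) p ≡ 0ℤ
      none = crossing-zero e (X n q (r e q)) avoid p

    π-cross : ∀ e x → InR m e → InW (x , q) → InW (x , k) → r x q ≡ r e q → π e x ≡ π' e x ℤ.+ row e x
    π-cross e x re s s' roll = trans (pot-path q e x q x k re rq s (step s (next-adj across) (here s')))
      (cong (λ z → π' e x ℤ.+ z) (trans (ℤₚ.+-identityʳ _) (trans (hor-next (row e) (δ (X n q (r e q))) across)
        (trans (cong (λ z → row e x ℤ.* z) (trans (cong (λ z → δ (X n q (r e q)) (X n q z)) roll) (δ-refl _)))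
               (ℤₚ.*-identityʳ _)))))
      where
      across : Next n q (r x q) k (r x k)
      across = roll-next x k s s'

    Crosses : ℕ → Set
    Crosses x = InW (x , q) × InW (x , k)

    crosses-roll : ∀ x y → Crosses x → Crosses y → r x k ≡ r y k → r x q ≡ r y q
    crosses-roll x y (s , s') (t , t') e = proj₂ (Next-unique-left rq rq
      (subst (Next n q (r x q) k) e (roll-next x k s s')) (roll-next y k t t'))

    -- From `(x , k)` go back across row `x`, stay to the left of the line, and return across row
    -- `y`: both sides are the value of the potential on the common class of column `q`.
    π-link : ∀ e x y → Crosses e → Crosses x → Crosses y → BR x q ≡ BR y q → r x k ≡ r e k →
             π e x ℤ.- row e x ≡ π e y ℤ.- row e y
    π-link e x y ce@(se , _) cx@(sx , sx') cy@(sy , sy') same roll = begin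
      π e x ℤ.- row e x ≡⟨ cong (λ z → z ℤ.- row e x) (π-cross e x re sx sx' rolls) ⟩
      π' e x ℤ.+ row e x ℤ.- row e x ≡⟨ lem (π' e x) (row e x) ⟩
      π' e x ≡⟨ sym (π-class e x y re sx sy same rolls) ⟩
      π' e y ≡⟨ sym (lem (π' e y) (row e y)) ⟩
      π' e y ℤ.+ row e y ℤ.- row e y ≡⟨ cong (λ z → z ℤ.- row e y) (sym (π-cross e y re sy sy' (trans (sym (cong proj₂ same)) rolls))) ⟩
      π e y ℤ.- row e y ∎
      where
      open ≡-Reasoning
      re : InR m e
      re = proj₁ se
      rolls : r x q ≡ r e q
      rolls = crosses-roll x e cx ce roll
      lem : ∀ a b → a ℤ.+ b ℤ.- b ≡ a
      lem = solve-∀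

    module _ {β : ℕ} (β≢0 : β ≢ 0) where

      factor-InR : ∀ f → Factor k β f → ∀ {x} → InF f x → InR m x
      factor-InR f (1≤u , _ , v≤m , _) (u≤x , x≤v) = ℕₚ.≤-trans 1≤u u≤x , ℕₚ.≤-trans x≤v v≤m

      factor-InW : ∀ f → Factor k β f → ∀ {x} → InF f x → InW (x , k)
      factor-InW f F {x} i = b-InW x k (factor-InR f F i) rk (subst (_≢ 0) (sym (proj₂ (proj₂ (proj₂ F)) x (proj₁ i) (proj₂ i))) β≢0)

      factor-const : ∀ {A : Set} (h : ℕ → A) → (∀ x → InW (x , k) → InW (suc x , k) → h (suc x) ≡ h x) →
                     ∀ f → Factor k β f → ∀ {x} → InF f x → h x ≡ h (proj₁ f)
      factor-const h hs (u , v) F {x} (u≤x , x≤v) =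
        trans (cong h (sym (ℕₚ.m∸n+n≡m u≤x))) (go (x ∸ u) (subst (_≤ v) (sym (ℕₚ.m∸n+n≡m u≤x)) x≤v))
        where
        go : ∀ d → d + u ≤ v → h (d + u) ≡ h u
        go zero    l = refl
        go (suc d) l = trans (hs (d + u) (factor-InW (u , v) F (ℕₚ.m≤n+m u d , ℕₚ.<⇒≤ l))
                                         (factor-InW (u , v) F (ℕₚ.m≤n+m u (suc d) , l))) (go d (ℕₚ.<⇒≤ l))

      factor-roll : ∀ f → Factor k β f → ∀ {x} → InF f x → r x k ≡ r (proj₁ f) k
      factor-roll = factor-const (λ x → r x k) (λ x s s' → sym (roll-vertical s s'))

      factor-π : ∀ e → InR m e → ∀ f → Factor k β f → ∀ {x} → InF f x → π e x ≡ π e (proj₁ f)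
      factor-π e re = factor-const (π e) (λ x → π-vertical e x re)

      -- The factor and the class in column `q` would close a cycle through the edge in row `i`: the
      -- potential of this edge is constant on the factor, but changes by one across the link.
      same-factor-class : ∀ f → Factor k β f → ∀ {i j} → InF f i → InF f j → i ≢ j → Crosses i → Crosses j →
                          BR i q ≡ BR j q → ⊥
      same-factor-class f F {i} {j} fi fj i≢j ci cj same = 1≢0 (begin
        1ℤ ≡⟨ sym (row-refl i) ⟩
        row i i ≡⟨ cancel-minus (π i i) (row i i) (row i j)
                                 (trans (π-link i i j ci ci cj same refl) (cong (λ z → z ℤ.- row i j)
                                   (trans (factor-π i ri f F fj) (sym (factor-π i ri f F fi))))) ⟩
        row i j ≡⟨ row-≢ i j (λ e → i≢j (sym e)) ⟩
        0ℤ ∎)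
        where
        open ≡-Reasoning
        ri : InR m i
        ri = proj₁ (proj₁ ci)
        1≢0 : 1ℤ ≢ 0ℤ
        1≢0 ()

  part3d : ∀ k → InR n k → ∀ i j β → InR m i → InR m j → i ≢ j → BR i (pv n k) ≡ BR j (pv n k) →
           a i k ≡ 1 → a j k ≡ 1 → a i (pv n k) ≡ 1 → a j (pv n k) ≡ 1 → b i k ≡ β → b j k ≡ β →
           ¬ (∃[ f ] (Factor k β f × InF f i × InF f j))
  part3d k rk i j β ri rj i≢j same ei ej ei' ej' bi bj (f , F , fi , fj) =
    same-factor-class (λ z → in-b i k si (trans bi z)) f F fi fj i≢j
      (a-InW i q ri rq ei' , si) (a-InW j q rj rq ej' , a-InW j k rj rk ej) same
    where
    open Column k rk
    si : InW (i , k)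
    si = a-InW i k ri rk ei

  -- Sequences of linked factors: potentials, uniqueness, existence

  module Sequence (k : ℕ) (rk : InR n k) (β : ℕ) (β≢0 : β ≢ 0) where
    open Column k rk

    Max : ℕ × ℕ → Set
    Max = MaxFactor k β

    -- Evaluated at the top row of the factor; by `factor-π` every row of it gives the same value.
    Φ : ℕ → ℕ × ℕ → ℤ
    Φ e f = π e (proj₁ f)

    max-start-≤ : ∀ f g {x} → Max f → Max g → InF f x → InF g x → proj₁ f ≤ proj₁ g
    max-start-≤ (zero , v) (u' , v') _ _ _ _ = z≤n
    max-start-≤ (suc u , v) (u' , v') (_ , left , _) ((1≤u' , _ , _ , G) , _) (u<x , _) (_ , x≤v') = ℕₚ.≮⇒≥ (go left)
      where
      go : suc u ≡ 1 ⊎ b u k ≢ β → ¬ u' < suc u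
      go (inj₁ refl) (s≤s l) = ℕₚ.n≮0 (ℕₚ.≤-trans 1≤u' l)
      go (inj₂ ne)   (s≤s l) = ne (G u l (ℕₚ.≤-trans (ℕₚ.<⇒≤ u<x) x≤v'))

    max-end-≤ : ∀ f g {x} → Max f → Max g → InF f x → InF g x → proj₂ g ≤ proj₂ f
    max-end-≤ (u , v) (u' , v') (_ , _ , right) ((_ , _ , v'≤m , G) , _) (_ , x≤v) (u'≤x , _) = ℕₚ.≮⇒≥ (go right)
      where
      go : v ≡ m ⊎ b (suc v) k ≢ β → ¬ v < v'
      go (inj₁ refl) l = ℕₚ.<⇒≱ l v'≤m
      go (inj₂ ne)   l = ne (G (suc v) (ℕₚ.≤-trans u'≤x (ℕₚ.m≤n⇒m≤1+n x≤v)) l)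

    max-unique : ∀ f g {x} → Max f → Max g → InF f x → InF g x → f ≡ g
    max-unique f g F G i j = cong₂ _,_ (ℕₚ.≤-antisym (max-start-≤ f g F G i j) (max-start-≤ g f G F j i))
                                       (ℕₚ.≤-antisym (max-end-≤ g f G F j i) (max-end-≤ f g F G i j))

    extend-up : ∀ x → b (suc x) k ≡ β →
      ∃[ u ] (1 ≤ u × u ≤ suc x × (∀ t → u ≤ t → t ≤ suc x → b t k ≡ β) × (u ≡ 1 ⊎ b (u ∸ 1) k ≢ β))
    extend-up zero e = 1 , ℕₚ.≤-refl , ℕₚ.≤-refl , (λ t l l' → subst (λ z → b z k ≡ β) (ℕₚ.≤-antisym l l') e) , inj₁ refl
    extend-up (suc x) e with b (suc x) k ℕₚ.≟ β
    ... | no ne = suc (suc x) , s≤s z≤n , ℕₚ.≤-refl , (λ t l l' → subst (λ z → b z k ≡ β) (ℕₚ.≤-antisym l l') e) , inj₂ ne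
    ... | yes e' with extend-up x e'
    ...   | u , 1≤u , u≤x , all , left = u , 1≤u , ℕₚ.m≤n⇒m≤1+n u≤x , all' , left
      where
      all' : ∀ t → u ≤ t → t ≤ suc (suc x) → b t k ≡ β
      all' t l l' with ℕₚ.m≤n⇒m<n∨m≡n l'
      ... | inj₁ l″   = all t l (ℕₚ.≤-pred l″)
      ... | inj₂ refl = e

    extend-down : ∀ d x → d + x ≡ m → b x k ≡ β →
      ∃[ v ] (x ≤ v × v ≤ m × (∀ t → x ≤ t → t ≤ v → b t k ≡ β) × (v ≡ m ⊎ b (suc v) k ≢ β))
    extend-down zero x q e = x , ℕₚ.≤-refl , ℕₚ.≤-reflexive q , (λ t l l' → subst (λ z → b z k ≡ β) (ℕₚ.≤-antisym l l') e) , inj₁ q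
    extend-down (suc d) x q e with b (suc x) k ℕₚ.≟ β
    ... | no ne = x , ℕₚ.≤-refl , subst (x ≤_) q (ℕₚ.m≤n+m x (suc d)) , (λ t l l' → subst (λ z → b z k ≡ β) (ℕₚ.≤-antisym l l') e) , inj₂ ne
    ... | yes e' with extend-down d (suc x) (trans (ℕₚ.+-suc d x) q) e'
    ...   | v , x<v , v≤m , all , right = v , ℕₚ.<⇒≤ x<v , v≤m , all' , right
      where
      all' : ∀ t → x ≤ t → t ≤ v → b t k ≡ β
      all' t l l' with ℕₚ.m≤n⇒m<n∨m≡n l
      ... | inj₁ l″   = all t l″ l'
      ... | inj₂ refl = e

    factor-of : ∀ x → InR m x → b x k ≡ β → ∃[ f ] (Max f × InF f x)
    factor-of (suc x₀) (_ , x≤m) e with extend-up x₀ e | extend-down (m ∸ suc x₀) (suc x₀) (ℕₚ.m∸n+n≡m x≤m) e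
    ... | u , 1≤u , u≤x , up , left | v , x≤v , v≤m , down , right =
      (u , v) , ((1≤u , ℕₚ.≤-trans u≤x x≤v , v≤m , all) , left , right) , u≤x , x≤v
      where
      all : ∀ t → u ≤ t → t ≤ v → b t k ≡ β
      all t l l' with ℕₚ.≤-total t (suc x₀)
      ... | inj₁ s = up t l s
      ... | inj₂ s = down t s l'

    InF-down : ∀ f x → Max f → InF f x → suc x ≤ m → b (suc x) k ≡ β → InF f (suc x)
    InF-down (u , v) x (_ , _ , right) (u≤x , x≤v) l e with ℕₚ.m≤n⇒m<n∨m≡n x≤v | right
    ... | inj₁ x<v  | _         = ℕₚ.m≤n⇒m≤1+n u≤x , x<v
    ... | inj₂ refl | inj₁ refl = ⊥-elim (ℕₚ.<-irrefl refl l)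
    ... | inj₂ refl | inj₂ ne   = ⊥-elim (ne e)

    InF-up : ∀ f x → Max f → InF f (suc x) → 1 ≤ x → b x k ≡ β → InF f x
    InF-up (u , v) x (_ , left , _) (u≤x , x≤v) l e with ℕₚ.m≤n⇒m<n∨m≡n u≤x | left
    ... | inj₁ u<x  | _         = ℕₚ.≤-pred u<x , ℕₚ.<⇒≤ x≤v
    ... | inj₂ refl | inj₁ refl = ⊥-elim (ℕₚ.n≮0 l)
    ... | inj₂ refl | inj₂ ne   = ⊥-elim (ne e)

    distinct-rows : ∀ f g {x y} → Max f → Max g → f ≢ g → InF f x → InF g y → x ≢ y
    distinct-rows f g F G ne i j refl = ne (max-unique f g F G i j)

    row-crosses : ∀ f x → Max f → InF f x → a x q ≡ 1 → a x k ≡ 1 → Crosses x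
    row-crosses f x F i e e' = a-InW x q (factor-InR β≢0 f (proj₁ F) i) rq e , a-InW x k (factor-InR β≢0 f (proj₁ F) i) rk e'

    link-crosses : ∀ f g {x y} → Max f → Max g → Link k f g x y → Crosses x × Crosses y
    link-crosses f g {x} {y} F G (i , j , e₁ , e₂ , e₃ , e₄ , _) = row-crosses f x F i e₁ e₂ , row-crosses g y G j e₃ e₄

    link-rolls : ∀ f g {x y} → Max f → Max g → Link k f g x y → r (proj₁ f) k ≡ r (proj₁ g) k
    link-rolls f g {x} {y} F G l@(i , j , _ , _ , _ , _ , same) =
      trans (sym (factor-roll β≢0 f (proj₁ F) i)) (trans across (factor-roll β≢0 g (proj₁ G) j))
      where
      cs : Crosses x × Crosses y
      cs = link-crosses f g F G l
      across : r x k ≡ r y k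
      across = proj₁ (joined-across rk x y (proj₁ (proj₁ cs)) (proj₁ (proj₂ cs)) (proj₂ (proj₁ cs)) (proj₂ (proj₂ cs)) same)

    link-Φ : ∀ e f g {x y} → Crosses e → Max f → Max g → r (proj₁ f) k ≡ r e k → Link k f g x y →
             Φ e f ℤ.- row e x ≡ Φ e g ℤ.- row e y
    link-Φ e f g {x} {y} ce F G roll l@(i , j , _ , _ , _ , _ , same) =
      subst₂ (λ s t → s ℤ.- row e x ≡ t ℤ.- row e y) (factor-π β≢0 e re f (proj₁ F) i) (factor-π β≢0 e re g (proj₁ G) j)
        (π-link e x y ce (proj₁ cs) (proj₂ cs) same (trans (factor-roll β≢0 f (proj₁ F) i) roll))
      where
      re : InR m e
      re = proj₁ (proj₁ ce)
      cs : Crosses x × Crosses y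
      cs = link-crosses f g F G l

    private
      minus-zero : ∀ p → p ℤ.- 0ℤ ≡ p
      minus-zero = solve-∀

      solve-left : ∀ p q z → p ℤ.- z ≡ q ℤ.- 0ℤ → q ≡ p ℤ.- z
      solve-left p q z e = trans (sym (minus-zero q)) (sym e)

      solve-right : ∀ p q z → p ℤ.- 0ℤ ≡ q ℤ.- z → q ≡ p ℤ.+ z
      solve-right p q z e = trans (lem q z) (cong (λ w → w ℤ.+ z) (trans (sym e) (minus-zero p)))
        where
        lem : ∀ q z → q ≡ q ℤ.- z ℤ.+ z
        lem = solve-∀

      cancel-plus : ∀ a b c → a ℤ.+ b ≡ a ℤ.+ c → b ≡ c
      cancel-plus a b c h = trans (lem a b) (trans (cong (λ z → z ℤ.- a) h) (sym (lem a c)))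
        where
        lem : ∀ a b → b ≡ a ℤ.+ b ℤ.- a
        lem = solve-∀

    -- This lemma and the next two specialise `link-Φ`: a link lowers the potential of the edge
    -- through which it leaves a factor, raises that of the edge through which it enters one, and
    -- changes no other.
    leave-Φ : ∀ e f g {x y} → Crosses e → Max f → Max g → r (proj₁ f) k ≡ r e k → Link k f g x y → y ≢ e → Φ e g ≡ Φ e f ℤ.- row e x
    leave-Φ e f g {x} {y} ce F G roll l ne = solve-left (Φ e f) (Φ e g) (row e x)
      (subst (λ z → Φ e f ℤ.- row e x ≡ Φ e g ℤ.- z) (row-≢ e y ne) (link-Φ e f g ce F G roll l))

    enter-Φ : ∀ e f g {x y} → Crosses e → Max f → Max g → r (proj₁ f) k ≡ r e k → Link k f g x y → x ≢ e → Φ e g ≡ Φ e f ℤ.+ row e y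
    enter-Φ e f g {x} {y} ce F G roll l ne = solve-right (Φ e f) (Φ e g) (row e y)
      (subst (λ z → Φ e f ℤ.- z ≡ Φ e g ℤ.- row e y) (row-≢ e x ne) (link-Φ e f g ce F G roll l))

    keep-Φ : ∀ e f g {x y} → Crosses e → Max f → Max g → r (proj₁ f) k ≡ r e k → Link k f g x y → x ≢ e → y ≢ e → Φ e g ≡ Φ e f
    keep-Φ e f g {x} {y} ce F G roll l ne ne' = trans (enter-Φ e f g ce F G roll l ne)
      (trans (cong (λ z → Φ e f ℤ.+ z) (row-≢ e y ne')) (ℤₚ.+-identityʳ _))

    -- The potential of the edge in row `x` drops by one from `f` to `g`. A second link must produce
    -- the same drop, so it leaves through row `x` too; the rise for row `y` fixes the other end.
    unique-link : ∀ f g x y → Max f → Max g → f ≢ g → Link k f g x y → ∀ x' y' → Link k f g x' y' → x' ≡ x × y' ≡ y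
    unique-link f g x y F G ne l@(i , j , _) x' y' l'@(i' , j' , _) =
        row-sound x x' (trans (cancel-minus (Φ x f) (row x x') (row x x) (trans (sym (leave-Φ x f g cx F G rx l' (apart i j')))
                                 (leave-Φ x f g cx F G rx l (apart i j)))) (row-refl x))
      , row-sound y y' (trans (cancel-plus (Φ y f) (row y y') (row y y) (trans (sym (enter-Φ y f g cy F G ry l' (λ e → apart i' j (sym e))))
                                 (enter-Φ y f g cy F G ry l (λ e → apart i j (sym e))))) (row-refl y))
      where
      apart : ∀ {s t} → InF f s → InF g t → t ≢ s
      apart s t e = distinct-rows f g F G ne s t (sym e)
      cx : Crosses x
      cx = proj₁ (link-crosses f g F G l)
      cy : Crosses y
      cy = proj₂ (link-crosses f g F G l)
      rx : r (proj₁ f) k ≡ r x k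
      rx = sym (factor-roll β≢0 f (proj₁ F) i)
      ry : r (proj₁ f) k ≡ r y k
      ry = trans (link-rolls f g F G l) (sym (factor-roll β≢0 g (proj₁ G) j))

    -- GoodSeq without the requirement that its length exceeds one
    Chain : ℕ × ℕ → ℕ × ℕ → Seq → Set
    Chain v u (p , f) =
      0 < p × f 0 ≡ v × f (p ∸ 1) ≡ u
      × (∀ i → i < p → Max (f i))
      × (∀ i i' → i < p → i' < p → f i ≡ f i' → i ≡ i')
      × (∀ i → suc i < p → UniqueLink k (f i) (f (suc i)))
      × (∀ i → suc (suc i) < p → ∀ j s j' s' → Link k (f i) (f (suc i)) j s → Link k (f (suc i)) (f (suc (suc i))) j' s' → s ≢ j')

    good-chain : ∀ {v u σ} → GoodSeq k β v u σ → Chain v u σ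
    good-chain (1<p , rest) = ℕₚ.<⇒≤ 1<p , rest

    chain-tail : ∀ {v u p f} → Chain v u (suc (suc p) , f) → Chain (f 1) u (suc p , λ t → f (suc t))
    chain-tail (_ , _ , last , max , inj , links , turn) =
      s≤s z≤n , refl , last , (λ i l → max (suc i) (s≤s l)) ,
      (λ i i' l l' e → ℕₚ.suc-injective (inj (suc i) (suc i') (s≤s l) (s≤s l') e)) ,
      (λ i l → links (suc i) (s≤s l)) , (λ i l → turn (suc i) (s≤s l))

    module Walk {v u p f} (chain : Chain v u (p , f)) where

      max : ∀ i → i < p → Max (f i)
      max = proj₁ (proj₂ (proj₂ (proj₂ chain)))

      distinct : ∀ i i' → i < p → i' < p → f i ≡ f i' → i ≡ i'
      distinct = proj₁ (proj₂ (proj₂ (proj₂ (proj₂ chain))))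

      links : ∀ i → suc i < p → UniqueLink k (f i) (f (suc i))
      links = proj₁ (proj₂ (proj₂ (proj₂ (proj₂ (proj₂ chain)))))

      turn : ∀ i → suc (suc i) < p → ∀ j s j' s' → Link k (f i) (f (suc i)) j s → Link k (f (suc i)) (f (suc (suc i))) j' s' → s ≢ j'
      turn = proj₂ (proj₂ (proj₂ (proj₂ (proj₂ (proj₂ chain)))))

      out into : ∀ i → suc i < p → ℕ
      out i l = proj₁ (links i l)
      into i l = proj₁ (proj₂ (links i l))

      link : ∀ i (l : suc i < p) → Link k (f i) (f (suc i)) (out i l) (into i l)
      link i l = proj₁ (proj₂ (proj₂ (links i l)))

      out-in : ∀ i (l : suc i < p) → InF (f i) (out i l)
      out-in i l = proj₁ (link i l)

      into-in : ∀ i (l : suc i < p) → InF (f (suc i)) (into i l)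
      into-in i l = proj₁ (proj₂ (link i l))

      rolls : ∀ i → i < p → r (proj₁ (f i)) k ≡ r (proj₁ v) k
      rolls zero    l = cong (λ g → r (proj₁ g) k) (proj₁ (proj₂ chain))
      rolls (suc i) l = trans (sym (link-rolls (f i) (f (suc i)) (max i (ℕₚ.<⇒≤ l)) (max (suc i) l) (link i l))) (rolls i (ℕₚ.<⇒≤ l))

      apart : ∀ {i i' x y} → i < p → i' < p → i ≢ i' → InF (f i) x → InF (f i') y → x ≢ y
      apart {i} {i'} l l' ne = distinct-rows (f i) (f i') (max i l) (max i' l') (λ e → ne (distinct i i' l l' e))

      Φ-constant : ∀ e s → Crosses e → r e k ≡ r (proj₁ v) k →
        (∀ i → s ≤ i → (l : suc i < p) → out i l ≢ e × into i l ≢ e) → ∀ i → s ≤ i → i < p → Φ e (f i) ≡ Φ e (f s)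
      Φ-constant e s ce re avoid zero    z≤n l = refl
      Φ-constant e s ce re avoid (suc i) s≤i l with ℕₚ.m≤n⇒m<n∨m≡n s≤i
      ... | inj₂ refl = refl
      ... | inj₁ s<i  = trans
        (keep-Φ e (f i) (f (suc i)) ce (max i (ℕₚ.<⇒≤ l)) (max (suc i) l) (trans (rolls i (ℕₚ.<⇒≤ l)) (sym re)) (link i l)
          (proj₁ (avoid i (ℕₚ.≤-pred s<i) l)) (proj₂ (avoid i (ℕₚ.≤-pred s<i) l)))
        (Φ-constant e s ce re avoid i (ℕₚ.≤-pred s<i) (ℕₚ.<⇒≤ l))

      Φ-last : 0 < p → ∀ e → Φ e (f (p ∸ 1)) ≡ Φ e u
      Φ-last _ e = cong (Φ e) (proj₁ (proj₂ (proj₂ chain)))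

      module _ (1<p : 1 < p) where

        private
          last< : p ∸ 1 < p
          last< = pred-< 1<p
            where
            pred-< : ∀ {p} → 1 < p → p ∸ 1 < p
            pred-< (s≤s _) = ℕₚ.≤-refl

          1≤last : 1 ≤ p ∸ 1
          1≤last = ℕₚ.∸-monoˡ-≤ 1 1<p

        first-crosses : Crosses (out 0 1<p) × Crosses (into 0 1<p)
        first-crosses = link-crosses (f 0) (f 1) (max 0 (ℕₚ.<⇒≤ 1<p)) (max 1 1<p) (link 0 1<p)

        first-roll-out : r (out 0 1<p) k ≡ r (proj₁ v) k
        first-roll-out = trans (factor-roll β≢0 (f 0) (proj₁ (max 0 (ℕₚ.<⇒≤ 1<p))) (out-in 0 1<p)) (rolls 0 (ℕₚ.<⇒≤ 1<p))

        first-roll-into : r (into 0 1<p) k ≡ r (proj₁ v) k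
        first-roll-into = trans (factor-roll β≢0 (f 1) (proj₁ (max 1 1<p)) (into-in 0 1<p)) (rolls 1 1<p)

        -- Factors do not repeat, so after the first link no row of `f 0` is used again. Hence the
        -- potential at `u` alone reveals the row through which a chain leaves its first factor.
        total : ∀ e → Crosses e → r e k ≡ r (proj₁ v) k → InF (f 0) e → Φ e u ≡ Φ e (f 0) ℤ.- row e (out 0 1<p)
        total e ce re i = trans (sym (Φ-last (ℕₚ.<⇒≤ 1<p) e)) (trans (Φ-constant e 1 ce re avoid (p ∸ 1) 1≤last last<)
          (leave-Φ e (f 0) (f 1) ce (max 0 (ℕₚ.<⇒≤ 1<p)) (max 1 1<p) (trans (rolls 0 (ℕₚ.<⇒≤ 1<p)) (sym re)) (link 0 1<p)
            (apart 1<p (ℕₚ.<⇒≤ 1<p) (λ ()) (into-in 0 1<p) i)))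
          where
          avoid : ∀ i → 1 ≤ i → (l : suc i < p) → out i l ≢ e × into i l ≢ e
          avoid (suc t) _ l = apart (ℕₚ.<⇒≤ l) (ℕₚ.<⇒≤ 1<p) (λ ()) (out-in (suc t) l) i ,
                              apart l (ℕₚ.<⇒≤ 1<p) (λ ()) (into-in (suc t) l) i

        -- The row through which f 1 is entered is never crossed again.
        beyond : ∀ i → 1 ≤ i → i < p → Φ (into 0 1<p) (f i) ≡ Φ (into 0 1<p) (f 0) ℤ.+ 1ℤ
        beyond i 1≤i i<p = trans (Φ-constant e 1 (proj₂ first-crosses) first-roll-into avoid i 1≤i i<p)
          (trans (enter-Φ e (f 0) (f 1) (proj₂ first-crosses) (max 0 (ℕₚ.<⇒≤ 1<p)) (max 1 1<p)
                   (trans (rolls 0 (ℕₚ.<⇒≤ 1<p)) (sym first-roll-into)) (link 0 1<p)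
                   (apart (ℕₚ.<⇒≤ 1<p) 1<p (λ ()) (out-in 0 1<p) (into-in 0 1<p)))
                 (cong (λ z → Φ e (f 0) ℤ.+ z) (row-refl e)))
          where
          e : ℕ
          e = into 0 1<p
          avoid : ∀ i → 1 ≤ i → (l : suc i < p) → out i l ≢ e × into i l ≢ e
          avoid (suc zero)    _ l = (λ q → turn 0 l _ _ _ _ (link 0 1<p) (link 1 l) (sym q)) ,
                                    apart l 1<p (λ ()) (into-in 1 l) (into-in 0 1<p)
          avoid (suc (suc t)) _ l = apart (ℕₚ.<⇒≤ l) 1<p (λ ()) (out-in (suc (suc t)) l) (into-in 0 1<p) ,
                                    apart l 1<p (λ ()) (into-in (suc (suc t)) l) (into-in 0 1<p)

        beyond-last : Φ (into 0 1<p) u ≡ Φ (into 0 1<p) (f 0) ℤ.+ 1ℤ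
        beyond-last = trans (sym (Φ-last (ℕₚ.<⇒≤ 1<p) (into 0 1<p))) (beyond (p ∸ 1) 1≤last last<)

    module _ {v u p f p' f'} (chain : Chain v u (p , f)) (chain' : Chain v u (p' , f')) (1<p : 1 < p) (1<p' : 1 < p') where

      private
        module W = Walk chain
        module W' = Walk chain'

        same-start : f 0 ≡ f' 0
        same-start = trans (proj₁ (proj₂ chain)) (sym (proj₁ (proj₂ chain')))

        x y x' y' : ℕ
        x  = W.out 0 1<p
        y  = W.into 0 1<p
        x' = W'.out 0 1<p'
        y' = W'.into 0 1<p'

        z≢z+1 : ∀ z → z ≢ z ℤ.+ 1ℤ
        z≢z+1 z e = ℤₚ.i≢suc[i] (trans e (ℤₚ.+-comm z 1ℤ))

        same-out : x' ≡ x
        same-out = row-sound x x' (trans (cancel-minus (Φ x (f 0)) (row x x') (row x x) (sym (begin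
          Φ x (f 0) ℤ.- row x x ≡⟨ sym (W.total 1<p x (proj₁ (W.first-crosses 1<p)) (W.first-roll-out 1<p) (W.out-in 0 1<p)) ⟩
          Φ x u ≡⟨ W'.total 1<p' x (proj₁ (W.first-crosses 1<p)) (W.first-roll-out 1<p)
                                       (subst (λ g → InF g x) same-start (W.out-in 0 1<p)) ⟩
          Φ x (f' 0) ℤ.- row x x' ≡⟨ cong (λ g → Φ x g ℤ.- row x x') (sym same-start) ⟩
          Φ x (f 0) ℤ.- row x x' ∎))) (row-refl x))
          where open ≡-Reasoning

        same-class-into : BR y q ≡ BR y' q
        same-class-into = trans (sym (joint (W.link 0 1<p))) (trans (cong (λ t → BR t q) (sym same-out)) (joint (W'.link 0 1<p')))
          where
          joint : ∀ {g h s t} → Link k g h s t → BR s q ≡ BR t q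
          joint (_ , _ , _ , _ , _ , _ , e) = e

        compare : ∀ e → Crosses e → r e k ≡ r (proj₁ v) k → Φ e (f 1) ℤ.- row e y ≡ Φ e (f' 1) ℤ.- row e y'
        compare e ce re = subst₂ (λ s t → s ℤ.- row e y ≡ t ℤ.- row e y')
          (factor-π β≢0 e (proj₁ (proj₁ ce)) (f 1) (proj₁ (W.max 1 1<p)) (W.into-in 0 1<p))
          (factor-π β≢0 e (proj₁ (proj₁ ce)) (f' 1) (proj₁ (W'.max 1 1<p')) (W'.into-in 0 1<p'))
          (π-link e y y' ce (proj₂ (W.first-crosses 1<p)) (proj₂ (W'.first-crosses 1<p')) same-class-into
            (trans (W.first-roll-into 1<p) (sym re)))

        module _ (y≢y' : y ≢ y') where

          -- On all later factors of the second chain the potential of the edge in row `y'` is one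
          -- more than at the start. On `f 1` it equals the value at the start, as `f 1` is reached
          -- from the same class of column `q` without using row `y'`.
          met : ∀ i → i < p' → f' i ≡ f 1 → ⊥
          met zero    l e with () ← W.distinct 0 1 (ℕₚ.<⇒≤ 1<p) 1<p (trans same-start e)
          met (suc i) l e = z≢z+1 (Φ y' (f' 0)) (trans (sym (begin
              Φ y' (f 1) ≡⟨ lem (Φ y' (f 1)) ⟩
              Φ y' (f 1) ℤ.- 0ℤ ≡⟨ cong (λ z → Φ y' (f 1) ℤ.- z) (sym (row-≢ y' y y≢y')) ⟩
              Φ y' (f 1) ℤ.- row y' y ≡⟨ compare y' (proj₂ (W'.first-crosses 1<p')) (W'.first-roll-into 1<p') ⟩
              Φ y' (f' 1) ℤ.- row y' y' ≡⟨ cong₂ ℤ._-_ (W'.beyond 1<p' 1 ℕₚ.≤-refl 1<p') (row-refl y') ⟩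
              Φ y' (f' 0) ℤ.+ 1ℤ ℤ.- 1ℤ ≡⟨ lem' (Φ y' (f' 0)) ⟩
              Φ y' (f' 0) ∎))
            (trans (cong (Φ y') (sym e)) (W'.beyond 1<p' (suc i) (s≤s z≤n) l)))
            where
            open ≡-Reasoning
            lem : ∀ a → a ≡ a ℤ.- 0ℤ
            lem = solve-∀
            lem' : ∀ a → a ℤ.+ 1ℤ ℤ.- 1ℤ ≡ a
            lem' = solve-∀

          -- A second chain that avoids `f 1` never uses row `y`, so the potential of that edge is
          -- at `u` what it was at the start; the first chain makes it one more.
          missed : (∀ i → i < p' → f' i ≢ f 1) → ⊥
          missed none = z≢z+1 (Φ y (f 0)) (trans (sym (begin
              Φ y u ≡⟨ sym (W'.Φ-last (ℕₚ.<⇒≤ 1<p') y) ⟩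
              Φ y (f' (p' ∸ 1)) ≡⟨ W'.Φ-constant y 1 (proj₂ (W.first-crosses 1<p)) (W.first-roll-into 1<p) avoid (p' ∸ 1)
                                                     (ℕₚ.∸-monoˡ-≤ 1 1<p') (pred-< 1<p') ⟩
              Φ y (f' 1) ≡⟨ lem (Φ y (f' 1)) ⟩
              Φ y (f' 1) ℤ.- 0ℤ ≡⟨ cong (λ z → Φ y (f' 1) ℤ.- z) (sym (row-≢ y y' (λ e → y≢y' (sym e)))) ⟩
              Φ y (f' 1) ℤ.- row y y' ≡⟨ sym (compare y (proj₂ (W.first-crosses 1<p)) (W.first-roll-into 1<p)) ⟩
              Φ y (f 1) ℤ.- row y y ≡⟨ cong₂ ℤ._-_ (W.beyond 1<p 1 ℕₚ.≤-refl 1<p) (row-refl y) ⟩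
              Φ y (f 0) ℤ.+ 1ℤ ℤ.- 1ℤ ≡⟨ lem' (Φ y (f 0)) ⟩
              Φ y (f 0) ∎))
            (W.beyond-last 1<p))
            where
            open ≡-Reasoning
            pred-< : ∀ {p} → 1 < p → p ∸ 1 < p
            pred-< (s≤s _) = ℕₚ.≤-refl
            lem : ∀ a → a ≡ a ℤ.- 0ℤ
            lem = solve-∀
            lem' : ∀ a → a ℤ.+ 1ℤ ℤ.- 1ℤ ≡ a
            lem' = solve-∀
            away : ∀ i → i < p' → ∀ {t} → InF (f' i) t → t ≢ y
            away i l j = distinct-rows (f' i) (f 1) (W'.max i l) (W.max 1 1<p) (none i l) j (W.into-in 0 1<p)
            avoid : ∀ i → 1 ≤ i → (l : suc i < p') → W'.out i l ≢ y × W'.into i l ≢ y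
            avoid i _ l = away i (ℕₚ.<⇒≤ l) (W'.out-in i l) , away (suc i) l (W'.into-in i l)

          contradiction : ⊥
          contradiction = decide (searchUpTo (λ i → f' i ≡ f 1) (λ i → ×ₚ.≡-dec ℕₚ._≟_ ℕₚ._≟_ (f' i) (f 1)) p')
            where
            decide : _ → ⊥
            decide (inj₁ (i , l , e)) = met i l e
            decide (inj₂ none)        = missed none

      -- If the entry rows differ, `met` and `missed` exclude both that the second chain visits
      -- `f 1` and that it does not. If they agree, the two factors share a row.
      head-unique : f 1 ≡ f' 1
      head-unique = decide (y ℕₚ.≟ y')
        where
        decide : Dec (y ≡ y') → f 1 ≡ f' 1
        decide (yes e) = max-unique (f 1) (f' 1) (W.max 1 1<p) (W'.max 1 1<p') (W.into-in 0 1<p)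
                           (subst (InF (f' 1)) (sym e) (W'.into-in 0 1<p'))
        decide (no ne) = ⊥-elim (contradiction ne)

    chain-unique : ∀ p {v u f p' f'} → Chain v u (suc p , f) → Chain v u (p' , f') → suc p ≡ p' × (∀ i → i < suc p → f i ≡ f' i)
    chain-unique _ {p' = zero} _ (() , _)
    chain-unique zero {p' = suc zero} (_ , s , _) (_ , s' , _) =
      refl , λ { zero _ → trans s (sym s') ; (suc i) (s≤s ()) }
    chain-unique zero {p' = suc (suc p')} (_ , s , l , _) (_ , s' , l' , _ , inj' , _)
      -- A chain of one factor has equal ends, so a longer chain with these ends would repeat a
      -- factor.
      with () ← inj' 0 (suc p') (s≤s z≤n) ℕₚ.≤-refl (trans s' (trans (sym s) (trans l (sym l'))))
    chain-unique (suc p) {p' = suc zero} (_ , s , l , _ , inj , _) (_ , s' , l' , _)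
      with () ← inj 0 (suc p) (s≤s z≤n) ℕₚ.≤-refl (trans s (trans (sym s') (trans l' (sym l))))
    chain-unique (suc p) {u = u} {f} {suc (suc p')} {f'} c c' = cong suc (proj₁ rest) , same
      where
      head : f 1 ≡ f' 1
      head = head-unique c c' (s≤s (s≤s z≤n)) (s≤s (s≤s z≤n))
      rest : suc p ≡ suc p' × (∀ i → i < suc p → f (suc i) ≡ f' (suc i))
      rest = chain-unique p (chain-tail c) (subst (λ g → Chain g u (suc p' , λ t → f' (suc t))) (sym head) (chain-tail c'))
      same : ∀ i → i < suc (suc p) → f i ≡ f' i
      same zero    _       = trans (proj₁ (proj₂ c)) (sym (proj₁ (proj₂ c')))
      same (suc i) (s≤s l) = proj₂ rest i l

    chain-suffix : ∀ i p {v u f} → Chain v u (p , f) → i < p → ∃[ σ ] Chain (f i) u σ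
    chain-suffix zero p {u = u} {f} c l = (p , f) , subst (λ g → Chain g u (p , f)) (sym (proj₁ (proj₂ c))) c
    chain-suffix (suc i) (suc zero) c (s≤s ())
    chain-suffix (suc i) (suc (suc p)) c (s≤s l) = chain-suffix i (suc p) (chain-tail c) l

    chain-single : ∀ u → Max u → Chain u u (1 , λ _ → u)
    chain-single u M = s≤s z≤n , refl , refl , (λ _ _ → M) ,
      (λ { zero zero _ _ _ → refl ; zero (suc _) _ (s≤s ()) ; (suc _) _ (s≤s ()) }) ,
      (λ { _ (s≤s ()) }) , (λ { _ (s≤s ()) })

    cons : ℕ × ℕ → (ℕ → ℕ × ℕ) → ℕ → ℕ × ℕ
    cons g f zero    = g
    cons g f (suc i) = f i

    chain-cons : ∀ {g v u p f} → Max g → Chain v u (p , f) → (∀ i → i < p → f i ≢ g) → UniqueLink k g (f 0) →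
      (1 < p → ∀ j s j' s' → Link k g (f 0) j s → Link k (f 0) (f 1) j' s' → s ≢ j') → Chain g u (suc p , cons g f)
    chain-cons {g} {p = suc p} {f} G (0<p , s , last , max , inj , links , turn) new link nonback =
      s≤s z≤n , refl , last ,
      (λ { zero _ → G ; (suc i) (s≤s l) → max i l }) ,
      (λ { zero zero _ _ _ → refl
         ; zero (suc i') _ (s≤s l') e → ⊥-elim (new i' l' (sym e))
         ; (suc i) zero (s≤s l) _ e → ⊥-elim (new i l e)
         ; (suc i) (suc i') (s≤s l) (s≤s l') e → cong suc (inj i i' l l' e) }) ,
      (λ { zero _ → link ; (suc i) (s≤s l) → links i l }) ,
      (λ { zero (s≤s l) → nonback l ; (suc i) (s≤s l) → turn i l })

    link-once : ∀ g h x y → Max g → Max h → g ≢ h → Link k g h x y → UniqueLink k g h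
    link-once g h x y G H ne l = x , y , l , unique-link g h x y G H ne l

    -- If s is also the row through which the chain leaves h, then g is linked directly to the next factor.
    chain-prepend : ∀ g h i s {u} p {f} → Max g → Link k g h i s → Chain h u (p , f) → ∃[ σ ] Chain g u σ
    chain-prepend g h i s {u} p {f} G link chain =
      decide (searchUpTo (λ t → f t ≡ g) (λ t → ×ₚ.≡-dec ℕₚ._≟_ ℕₚ._≟_ (f t) g) p)
      where
      link₀ : Link k g (f 0) i s
      link₀ = subst (λ z → Link k g z i s) (sym (proj₁ (proj₂ chain))) link

      fresh : ∀ p → (c : Chain h u (p , f)) → (∀ t → t < p → f t ≢ g) → ∃[ σ ] Chain g u σ
      fresh zero (() , _) new
      fresh (suc zero) c new = _ , chain-cons G c new
        (link-once g (f 0) i s G (Walk.max c 0 (s≤s z≤n)) (λ e → new 0 (s≤s z≤n) (sym e)) link₀) (λ { (s≤s ()) })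
      fresh (suc (suc p)) c new = choose (s ℕₚ.≟ W.out 0 1<)
        where
        module W = Walk c
        1< : 1 < suc (suc p)
        1< = s≤s (s≤s z≤n)
        F₀ : Max (f 0)
        F₀ = W.max 0 (s≤s z≤n)
        F₁ : Max (f 1)
        F₁ = W.max 1 1<
        next : Link k (f 0) (f 1) (W.out 0 1<) (W.into 0 1<)
        next = W.link 0 1<
        g≢0 : g ≢ f 0
        g≢0 e = new 0 (s≤s z≤n) (sym e)
        g≢1 : g ≢ f 1
        g≢1 e = new 1 1< (sym e)
        0≢1 : f 0 ≢ f 1
        0≢1 e with () ← W.distinct 0 1 (s≤s z≤n) 1< e
        choose : Dec (s ≡ W.out 0 1<) → ∃[ σ ] Chain g u σ
        choose (no ne) = _ , chain-cons G c new (link-once g (f 0) i s G F₀ g≢0 link₀) turn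
          where
          turn : 1 < suc (suc p) → ∀ j s₁ j' s' → Link k g (f 0) j s₁ → Link k (f 0) (f 1) j' s' → s₁ ≢ j'
          turn _ j s₁ j' s' l l' e = ne (trans (sym (proj₂ (unique-link g (f 0) i s G F₀ g≢0 link₀ j s₁ l)))
            (trans e (proj₁ (unique-link (f 0) (f 1) _ _ F₀ F₁ 0≢1 next j' s' l'))))
        choose (yes e) = _ , chain-cons G (chain-tail c) (λ t l → new (suc t) (s≤s l))
            (link-once g (f 1) i (W.into 0 1<) G F₁ g≢1 skip) turn
          where
          splice : ∀ {t} → Link k g (f 0) i s → s ≡ t → Link k (f 0) (f 1) t (W.into 0 1<) → Link k g (f 1) i (W.into 0 1<)
          splice (x₁ , _ , a₁ , a₂ , _ , _ , same) refl (_ , y₂ , _ , _ , a₃ , a₄ , same') = x₁ , y₂ , a₁ , a₂ , a₃ , a₄ , trans same same'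
          skip : Link k g (f 1) i (W.into 0 1<)
          skip = splice link₀ e next
          turn : 1 < suc p → ∀ j s₁ j' s' → Link k g (f 1) j s₁ → Link k (f 1) (f 2) j' s' → s₁ ≢ j'
          turn l j s₁ j' s' l₁ l₂ q = W.turn 0 (s≤s l) _ _ j' s' next l₂
            (trans (sym (proj₂ (unique-link g (f 1) i (W.into 0 1<) G F₁ g≢1 skip j s₁ l₁))) q)

      decide : (∃[ t ] (t < p × f t ≡ g)) ⊎ (∀ t → t < p → f t ≢ g) → ∃[ σ ] Chain g u σ
      decide (inj₁ (t , l , e)) = subst (λ z → ∃[ σ ] Chain z u σ) e (chain-suffix t p chain l)
      decide (inj₂ new)         = fresh p chain new

    module Build (u : ℕ × ℕ) (M : Max u) (ρ' : ℤ) (nρ : Next n q ρ' k (r (proj₁ u) k)) where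

      xu : ℕ
      xu = proj₁ u

      ρ : ℤ
      ρ = r xu k

      su : InF u xu
      su = ℕₚ.≤-refl , proj₁ (proj₂ (proj₁ M))

      -- The induction claim for cells of column `k` at level `ρ`: the factor of the cell is chained
      -- to `u`.
      Here : Cell → Set
      Here (i , j , z) = j ≡ k × z ≡ ρ × ∃[ f ] ∃[ σ ] (Max f × InF f i × Chain f u σ)

      -- The induction claim for cells further left: the path goes on in the half strip of `q` to a
      -- row `s` in which it enters column `k`, and the factor entered there is chained to `u`.
      Before : Cell → Set
      Before c = ∃[ s ] ∃[ g ] ∃[ σ ] (JPath q ρ' c (s , q , ρ') × InW (s , k) × Max g × InF g s × Chain g u σ)

      J-prev : ∀ {x y z} → JSet k ρ (x , y , z) → JSet q ρ' (x , y , z) ⊎ (y ≡ k × z ≡ ρ)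
      J-prev {x} {y} {z} d@(t , e , _) = decide (X n y z ℤₚ.≤? X n q ρ')
        where
        decide : Dec (X n y z ℤ.≤ X n q ρ') → JSet q ρ' (x , y , z) ⊎ (y ≡ k × z ≡ ρ)
        decide (yes l) = inj₁ (bound-J rq t e l)
        decide (no ¬l) = inj₂ (X-injective (proj₁ (proj₂ t)) rk (ℤₚ.≤-antisym (J-bound rk d)
          (ℤₚ.≤-trans (ℤₚ.≤-reflexive (X-next nρ)) (ℤₚ.i<j⇒suc[i]≤j (ℤₚ.≰⇒> ¬l)))))

      no-right : ∀ {x j z} → Next n k ρ j z → JSet k ρ (x , j , z) → ⊥
      no-right step-right d = J-next rk step-right d

      label : ∀ i → JPath k ρ (i , k , ρ) (cell xu k) → b i k ≡ β
      label i p = trans (same-label i xu k (proj₁ (path-start p)) (factor-InW β≢0 u (proj₁ M) su) (sym e)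
                          (subst (λ z → JPath k z (i , k , z) (cell xu k)) e p))
                        (proj₂ (proj₂ (proj₂ (proj₁ M))) xu (proj₁ su) (proj₂ su))
        where
        e : ρ ≡ r i k
        e = proj₁ (proj₂ (path-start p))

      -- An excursion to the left of column `k` from row `i` to row `s` keeps the two windows of
      -- column `q` in one class. So it is a link between the factors of `i` and `s`, which
      -- `chain-prepend` puts in front.
      enter : ∀ i s g {p f} → JPath q ρ' (i , q , ρ') (s , q , ρ') → InW (i , k) → InW (s , k) → Max g → InF g s →
              Chain g u (p , f) → b i k ≡ β → Here (i , k , ρ)
      enter i s g {p} path si ss G gs chain e = attach (factor-of i (proj₁ si) e)
        where
        iq : InW (i , q)
        iq = proj₁ (path-start path)
        sq : InW (s , q)
        sq = proj₁ (path-end path)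
        ei : ρ' ≡ r i q
        ei = proj₁ (proj₂ (path-start path))
        es : ρ' ≡ r s q
        es = proj₁ (proj₂ (path-end path))
        same : BR i q ≡ BR s q
        same = cong₂ _,_ (same-label i s q iq sq (trans (sym ei) es)
          (subst (λ z → JPath q z (i , q , z) (cell s q)) ei (castPath es path))) (trans (sym ei) es)
        attach : ∃[ f ] (Max f × InF f i) → Here (i , k , ρ)
        attach (f , F , fi) = refl , refl , f , proj₁ extended , F , fi , proj₂ extended
          where
          extended : ∃[ σ ] Chain f u σ
          extended = chain-prepend f g i s p F (fi , gs , in-a i q iq , in-a i k si , in-a s q sq , in-a s k ss , same) chain

      go-before : ∀ {i j z i' j' z'} → SAdj m n (i , j , z) (i' , j' , z') → JSet k ρ (i , j , z) → JSet q ρ' (i , j , z) →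
                  JSet k ρ (i' , j' , z') → Here (i' , j' , z') ⊎ Before (i' , j' , z') → Before (i , j , z)
      go-before {i} adj d d' t (inj₂ (s , g , σ , path , rest)) = s , g , σ , step d' adj path , rest
      go-before {i} {j} {z} {i'} adj d d' t (inj₁ (refl , refl , f , σ , F , fi , chain)) = view (SAdj-view adj)
        where
        view : _ → Before (i , j , z)
        view (inj₁ (refl , refl , _)) = ⊥-elim (J-next rq nρ d')
        view (inj₂ (inj₂ (refl , nx₁))) = ⊥-elim (no-right nx₁ d)
        view (inj₂ (inj₁ (refl , nx₁))) = at-q (Next-unique-left (proj₁ (proj₂ (proj₁ d))) rq nx₁ nρ)
          where
          at-q : j ≡ q × z ≡ ρ' → Before (i , j , z)
          at-q (refl , refl) = i , f , σ , here d' , proj₁ t , F , fi , chain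

      go-here : ∀ {i i' j' z'} → SAdj m n (i , k , ρ) (i' , j' , z') → JPath k ρ (i , k , ρ) (cell xu k) →
                JSet k ρ (i' , j' , z') → Here (i' , j' , z') ⊎ Before (i' , j' , z') → Here (i , k , ρ)
      go-here {i} {i'} adj p t (inj₁ (refl , refl , f , σ , F , fi , chain)) = view (SAdj-view adj)
        where
        si : InW (i , k)
        si = proj₁ (path-start p)
        view : _ → Here (i , k , ρ)
        view (inj₁ (_ , _ , inj₁ refl)) = refl , refl , f , σ , F , InF-up f i F fi (proj₁ (proj₁ si)) (label i p) , chain
        view (inj₁ (_ , _ , inj₂ refl)) = refl , refl , f , σ , F , InF-down f i' F fi (proj₂ (proj₁ si)) (label i p) , chain
        view (inj₂ (inj₁ (_ , nx₁))) = ⊥-elim (no-right nx₁ t)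
        view (inj₂ (inj₂ (_ , nx₁))) = ⊥-elim (no-right nx₁ t)
      go-here {i} {i'} {j'} {z'} adj p t (inj₂ (s , g , σ , path , ss , G , gs , chain)) = view (SAdj-view adj)
        where
        view : _ → Here (i , k , ρ)
        view (inj₁ (refl , refl , _))   = ⊥-elim (J-next rq nρ (path-start path))
        view (inj₂ (inj₁ (refl , nx₁))) = ⊥-elim (no-right nx₁ t)
        view (inj₂ (inj₂ (refl , nx₁))) = at-q (Next-unique-left (proj₁ (proj₂ (proj₁ t))) rq nx₁ nρ)
          where
          at-q : j' ≡ q × z' ≡ ρ' → Here (i , k , ρ)
          at-q (refl , refl) = enter i s g path (proj₁ (path-start p)) ss G gs chain (label i p)

      -- Existence comes from reading a joining path backwards from `u`: its runs in column `k` stay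
      -- within factors, and its excursions to the left are links.
      build : ∀ {c} → JPath k ρ c (cell xu k) → Here c ⊎ Before c
      build (here s) = inj₁ (refl , refl , u , _ , M , su , chain-single u M)
      build {i , j , z} (step s adj p) = decide (J-prev s)
        where
        decide : JSet q ρ' (i , j , z) ⊎ (j ≡ k × z ≡ ρ) → Here (i , j , z) ⊎ Before (i , j , z)
        decide (inj₁ d)             = inj₂ (go-before adj s d (path-start p) (build p))
        decide (inj₂ (refl , refl)) = inj₁ (go-here adj (step s adj p) (path-start p) (build p))

      chain-exists : ∀ v → Max v → r (proj₁ v) k ≡ ρ → ∃[ σ ] Chain v u σ
      chain-exists v V e = finish (build path)
        where
        sv : InF v (proj₁ v)
        sv = ℕₚ.≤-refl , proj₁ (proj₂ (proj₁ V))
        value-of : ∀ f → Max f → b (proj₁ f) k ≡ β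
        value-of f F = proj₂ (proj₂ (proj₂ (proj₁ F))) (proj₁ f) ℕₚ.≤-refl (proj₁ (proj₂ (proj₁ F)))
        path : JPath k ρ (proj₁ v , k , ρ) (cell xu k)
        path = subst (λ z → JPath k z (proj₁ v , k , z) (cell xu k)) e
          (same-class (proj₁ v) xu k (factor-InW β≢0 v (proj₁ V) sv) (factor-InW β≢0 u (proj₁ M) su) e
            (trans (value-of v V) (sym (value-of u M))))
        finish : Here (proj₁ v , k , ρ) ⊎ Before (proj₁ v , k , ρ) → ∃[ σ ] Chain v u σ
        finish (inj₁ (_ , _ , f , σ , F , fi , chain)) = subst (λ z → ∃[ σ ] Chain z u σ) (max-unique f v F V fi sv) (σ , chain)
        finish (inj₂ (_ , _ , _ , p , _)) = ⊥-elim (J-next rq nρ (path-start p))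

  part3e : ∀ k → InR n k → ∀ β → β ≢ 0 → ∀ v u → MaxFactor k β v → MaxFactor k β u → v ≢ u →
           r (proj₁ v) k ≡ r (proj₁ u) k →
           ∃[ σ ] (GoodSeq k β v u σ × (∀ σ' → GoodSeq k β v u σ' → SeqEq σ' σ))
  part3e k rk β β≢0 v u V W v≢u e = finish (prev-roll n k (r (proj₁ u) k) (proj₁ rk) (proj₂ rk))
    where
    open Sequence k rk β β≢0
    good : ∀ σ → Chain v u σ → GoodSeq k β v u σ
    good (suc zero , f) (_ , s , l , _)          = ⊥-elim (v≢u (trans (sym s) l))
    good (suc (suc p) , f) (_ , rest)            = s≤s (s≤s z≤n) , rest
    finish : ∃[ ρ' ] Next n (pv n k) ρ' k (r (proj₁ u) k) → _
    finish (ρ' , nρ) = σ , good σ chain , λ σ' g → unique σ' (good-chain g)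
      where
      found : ∃[ σ ] Chain v u σ
      found = Build.chain-exists u W ρ' nρ v V e
      σ : Seq
      σ = proj₁ found
      chain : Chain v u σ
      chain = proj₂ found
      unique : ∀ σ' → Chain v u σ' → SeqEq σ' σ
      unique (zero , _)   (() , _)
      unique (suc p , f) c = chain-unique p c chain

theorem5 : (m n : ℕ) → 1 ≤ m → 2 ≤ n → (C : HamCycle m n) →
    Contractible C → STUpRoot11 C →
    (b : ℕ → ℕ → ℕ) (r : ℕ → ℕ → ℤ) → IsB C b r →
    Conclusions.Theorem5Conclusion m n b r
theorem5 m n 1≤m 2≤n C contractible upRoot b r isB =
  part1 , part2 , (part3a , part3b , part3c , part3d , part3e , part3f) , part4 , part5
  where open Factors 1≤m 2≤n C contractible upRoot b r isB
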